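{- Let $d$ and $n$ be positive integers with $d>2$ and $n\equiv -1\pmod d$. Then \[ \sum_{k=0}^{n-1}[2dk+1]\frac{(q;q^d)_k^4}{(q^d;q^d)_k^4}\,q^{(d-2)k} \equiv 0\pmod{[n]\Phi_n(q)}. \]
   Context: Here $q$ is an indeterminate. For $x$ and a base $p$ (a power of $q$), $(x;p)_k=\prod_{j=0}^{k-1}(1-xp^j)$ for integers $k\ge 0$. The $q$-integer is $[m]=1+q+\cdots+q^{m-1}$, and $\Phi_n(q)$ is the $n$-th cyclotomic polynomial. For rational functions $A(q),B(q)$ and a polynomial $P(q)$, $A(q)\equiv B(q)\pmod{P(q)}$ means that the numerator of the reduced form of $A(q)-B(q)$ is divisible by $P(q)$ in $\mathbb{Z}[q]$. -}

module Defs where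

open import Data.Nat as ℕ using (ℕ; zero; suc)
open import Data.Nat.Divisibility using (_∣?_)
import Data.List
open import Data.Integer as ℤ using (ℤ; +_; 0ℤ; 1ℤ)
open import Data.List using (List; []; _∷_; filter; applyUpTo; foldr)
open import Data.Product using (Σ; ∃; _×_; _,_)
open import Relation.Binary.PropositionalEquality using (_≡_)
open import Relation.Nullary using (¬_)

-- Polynomials in ℤ[q], as coefficient lists (constant term first).
-- Equality is semantic (coefficientwise), so trailing zeros are irrelevant.

Poly : Set
Poly = List ℤ

coeff : Poly → ℕ → ℤ
coeff []       _       = 0ℤ
coeff (a ∷ p)  zero    = a
coeff (a ∷ p)  (suc i) = coeff p i

infix 4 _≈_
_≈_ : Poly → Poly → Set
p ≈ r = ∀ i → coeff p i ≡ coeff r i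

0ₚ 1ₚ : Poly
0ₚ = []
1ₚ = 1ℤ ∷ []

infixl 6 _+ₚ_ _-ₚ_
infixl 7 _*ₚ_

_+ₚ_ : Poly → Poly → Poly
[]      +ₚ r       = r
(a ∷ p) +ₚ []      = a ∷ p
(a ∷ p) +ₚ (b ∷ r) = (a ℤ.+ b) ∷ (p +ₚ r)

negₚ : Poly → Poly
negₚ []      = []
negₚ (a ∷ p) = ℤ.- a ∷ negₚ p

_-ₚ_ : Poly → Poly → Poly
p -ₚ r = p +ₚ negₚ r

scaleₚ : ℤ → Poly → Poly
scaleₚ c []      = []
scaleₚ c (a ∷ p) = (c ℤ.* a) ∷ scaleₚ c p

_*ₚ_ : Poly → Poly → Poly
[]      *ₚ r = []
(a ∷ p) *ₚ r = scaleₚ a r +ₚ (0ℤ ∷ (p *ₚ r))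

X^ : ℕ → Poly
X^ zero    = 1ₚ
X^ (suc m) = 0ℤ ∷ X^ m

infixr 8 _^ₚ_
_^ₚ_ : Poly → ℕ → Poly
p ^ₚ zero  = 1ₚ
p ^ₚ suc k = p *ₚ (p ^ₚ k)

prodₚ : List Poly → Poly
prodₚ = foldr _*ₚ_ 1ₚ

infix 4 _∣ₚ_
_∣ₚ_ : Poly → Poly → Set
P ∣ₚ N = Σ Poly λ Q → Q *ₚ P ≈ N

Coprimeₚ : Poly → Poly → Set
Coprimeₚ A B = ∀ G → G ∣ₚ A → G ∣ₚ B → G ∣ₚ 1ₚ

qint : ℕ → Poly
qint zero    = 0ₚ
qint (suc m) = 1ₚ +ₚ (0ℤ ∷ qint m)

poch : ℕ → ℕ → ℕ → Poly
poch a b zero    = 1ₚ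
poch a b (suc k) = poch a b k *ₚ (1ₚ -ₚ X^ (a ℕ.+ b ℕ.* k))

Frac : Set
Frac = Poly × Poly

_+f_ : Frac → Frac → Frac
(a , b) +f (c , e) = (a *ₚ e +ₚ c *ₚ b , b *ₚ e)

0f : Frac
0f = (0ₚ , 1ₚ)

sumf : ℕ → (ℕ → Frac) → Frac
sumf zero    f = 0f
sumf (suc n) f = sumf n f +f f n

-- A ≡ 0 (mod P): the numerator of the reduced form of A is divisible by P.
-- (N0 , D0) is a reduced form of N/D: same rational function, D0 ≠ 0,
-- numerator and denominator coprime in ℤ[q].
infix 4 _≡0mod_
_≡0mod_ : Frac → Poly → Set
(N , D) ≡0mod P =
  Σ Poly λ N0 → Σ Poly λ D0 →
    (¬ (D0 ≈ 0ₚ)) × (N *ₚ D0 ≈ N0 *ₚ D) × Coprimeₚ N0 D0 × (P ∣ₚ N0)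

-- Cyclotomic polynomials: a family Φ with  q^n - 1 = ∏_{m ∣ n} Φ_m  for all n ≥ 1.
-- (This determines Φ_n for every n ≥ 1 uniquely, ℤ[q] being a domain.)

divisors : ℕ → List ℕ
divisors n = filter (_∣? n) (applyUpTo suc n)

IsCyclotomicFamily : (ℕ → Poly) → Set
IsCyclotomicFamily Φ =
  ∀ n → 1 ℕ.≤ n → prodₚ (Data.List.map Φ (divisors n)) ≈ X^ n -ₚ 1ₚ

term : ℕ → ℕ → Frac
term d k =
  ( qint (2 ℕ.* d ℕ.* k ℕ.+ 1) *ₚ (poch 1 d k ^ₚ 4) *ₚ X^ ((d ℕ.∸ 2) ℕ.* k)
  , poch d d k ^ₚ 4 )

{-# OPTIONS --safe #-}
-- For m ∣ n, m > 1, choose N < m with m ∣ dN + 1 (N = n - e if m = n, where n + 1 = de), and let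
-- y = q^(dN+1). In ℤ[q] modulo Φ_m, or modulo Φ_n² when m = n, localised at the polynomials
-- prime to Φ_m, one has (1 - y)² = 0, so y and v = 2 - y are inverse to each other and
-- (1 - ys)(1 - vs) = (1 - s)² for all s. Hence the first m summands are those of a terminating
-- ₆φ₅ sum with base q^d and parameters q, q, 1/u, q^(-dN), where uq = v. By the ₆φ₅ summation,
-- proved with a WZ certificate, they add up to a product containing 1 - y and, if m = n, also
-- the factor 1 - u q^(de) = 1 - v² q^(dn), hence to 0. Modulo Φ_m each further block of m
-- summands is a multiple of the first. The polynomials Φ_m are pairwise prime because
-- q^n - 1 is prime to its derivative, so the product [n]Φ_n divides the reduced numerator.
module Submission where

open import Algebra.Bundles using (CommutativeRing; RawRing)
import Algebra.Properties.Semiring.Exp as Exp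
open import Algebra.Solver.Ring.AlmostCommutativeRing using (fromCommutativeRing; _-Raw-AlmostCommutative⟶_)
open import Data.Empty using (⊥-elim)
open import Data.Integer as ℤ using (ℤ; +_; -[1+_]; 0ℤ; 1ℤ; ∣_∣)
import Data.Integer.Divisibility.Signed as ℤ
import Data.Integer.Properties as ℤ
open import Data.List using ([]; _∷_; length; map; filter; applyUpTo; _++_)
open import Data.List.Membership.Propositional using (_∈_)
open import Data.List.Membership.Propositional.Properties using (∈-applyUpTo⁺; ∈-applyUpTo⁻; ∈-filter⁺; ∈-filter⁻)
open import Data.List.Properties using (applyUpTo-∷ʳ; filter-++; filter-reject; ++-identityʳ)
open import Data.List.Relation.Unary.Any using (here; there)
open import Data.List.Relation.Unary.All as All using (All; []; _∷_)
open import Data.List.Relation.Unary.AllPairs using ([]; _∷_)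
open import Data.List.Relation.Unary.Unique.Propositional using (Unique)
import Data.List.Relation.Unary.Unique.Propositional.Properties as Unique
open import Data.Maybe using (Maybe; just; nothing)
open import Data.Nat as ℕ using (ℕ; zero; suc; s≤s; z≤n; _<_; _≤_)
open import Data.Nat.Divisibility as ℕ using (_∣_; _∣?_)
open import Data.Nat.GCD using (module Bézout; module GCD)
open import Data.Nat.ListAction using (product)
open import Data.Nat.Primality using (Prime; euclidsLemma; prime⇒nonZero)
open import Data.Nat.Primality.Factorisation using (factorise; PrimeFactorisation)
import Data.Nat.DivMod as ℕ
import Data.Nat.Properties as ℕ
open import Data.Nat.Solver using (module +-*-Solver)
open import Data.Product using (∃; _×_; _,_; proj₁; proj₂; ∃₂)
import Data.Sign as Sign
open import Data.Sum as Sum using (_⊎_; inj₁; inj₂)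
open import Function using (_∘_)
open import Level using (0ℓ; _⊔_)
open import Relation.Binary using (IsEquivalence; Setoid)
import Relation.Binary.Reasoning.Setoid
open import Relation.Binary.PropositionalEquality as ≡ using (_≡_; cong; cong₂; _≢_)
open import Relation.Nullary using (Dec; yes; no; ¬_; ¬?; _×-dec_)

-- The obstacle modulo Φ_n² is that y is not 1, so a sum that merely terminates would differ from
-- the given one to first order. In the localisation the two special parameters are q^(-dN) = qv and
-- 1/u = qy, with denominator partners y q^d and v q^d. The deviations therefore occur in pairs y, v
-- on both sides of the fraction and cancel exactly, leaving the fourth powers of the theorem. A
-- second obstacle concerns m < n: the denominators of later summands contain factors 1 - q^(dk)
-- with k divisible by m, which are not prime to Φ_m. Such a summand has a value only after a factor
-- 1 - q^m is cancelled against the numerator, whence a relation "has the value" instead of a map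
-- from fractions. All moduli and denominators have constant coefficient 1 or -1. Division,
-- cancellation and the descent from ℚ[q] to ℤ[q] therefore start from the constant term; leading
-- coefficients, awkward for lists with trailing zeros, are never inspected. The bound d > 2 makes e
-- at most n - e, so that the factor 1 - u q^(de) really occurs in the product.

-- Polynomial identities with integer coefficients in a commutative ring

module IntegerCoefficients {c ℓ} (R : CommutativeRing c ℓ) where
  open CommutativeRing R
  open import Algebra.Properties.Ring ring
  open import Algebra.Properties.AbelianGroup +-abelianGroup using (⁻¹-∙-comm)
  open import Algebra.Properties.Semiring.Mult.TCOptimised semiring renaming (_×_ to _·_)
  open import Relation.Binary.Reasoning.Setoid setoid

  fromℤ : ℤ → Carrier
  fromℤ (+ n)    = n · 1#
  fromℤ -[1+ n ] = - (suc n · 1#)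

  private
    x-0≈x : ∀ x → x - 0# ≈ x
    x-0≈x x = trans (+-congˡ -0#≈0#) (+-identityʳ x)

    cancel-1 : ∀ x y → (1# + x) - (1# + y) ≈ x - y
    cancel-1 x y = begin
      (1# + x) - (1# + y)       ≈⟨ +-congˡ (sym (⁻¹-∙-comm 1# y)) ⟩
      (1# + x) + (- 1# - y)     ≈⟨ +-congʳ (+-comm 1# x) ⟩
      (x + 1#) + (- 1# - y)     ≈⟨ +-assoc x 1# _ ⟩
      x + (1# + (- 1# - y))     ≈⟨ +-congˡ (sym (+-assoc 1# (- 1#) (- y))) ⟩
      x + ((1# - 1#) - y)       ≈⟨ +-congˡ (+-congʳ (-‿inverseʳ 1#)) ⟩
      x + (0# - y)              ≈⟨ +-congˡ (+-identityˡ (- y)) ⟩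
      x - y                     ∎

    fromℤ-⊖ : ∀ m n → fromℤ (m ℤ.⊖ n) ≈ m · 1# - n · 1#
    fromℤ-⊖ zero    zero    = sym (x-0≈x 0#)
    fromℤ-⊖ zero    (suc n) = sym (+-identityˡ _)
    fromℤ-⊖ (suc m) zero    = sym (x-0≈x _)
    fromℤ-⊖ (suc m) (suc n) = begin
      fromℤ (suc m ℤ.⊖ suc n)            ≡⟨ ≡.cong fromℤ (ℤ.[1+m]⊖[1+n]≡m⊖n m n) ⟩
      fromℤ (m ℤ.⊖ n)                    ≈⟨ fromℤ-⊖ m n ⟩
      m · 1# - n · 1#                    ≈⟨ sym (cancel-1 _ _) ⟩
      (1# + m · 1#) - (1# + n · 1#)      ≈⟨ +-cong (sym (1+× m 1#)) (-‿cong (sym (1+× n 1#))) ⟩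
      suc m · 1# - suc n · 1#            ∎

    fromℤ-+ : ∀ i j → fromℤ (i ℤ.+ j) ≈ fromℤ i + fromℤ j
    fromℤ-+ (+ m)    (+ n)    = ×-homo-+ 1# m n
    fromℤ-+ (+ m)    -[1+ n ] = fromℤ-⊖ m (suc n)
    fromℤ-+ -[1+ m ] (+ n)    = trans (fromℤ-⊖ n (suc m)) (+-comm _ _)
    fromℤ-+ -[1+ m ] -[1+ n ] = begin
      - (suc (suc (m ℕ.+ n)) · 1#)       ≡⟨ ≡.cong (λ k → - (k · 1#)) (≡.cong suc (≡.sym (ℕ+-suc m n))) ⟩
      - ((suc m ℕ.+ suc n) · 1#)         ≈⟨ -‿cong (×-homo-+ 1# (suc m) (suc n)) ⟩
      - (suc m · 1# + suc n · 1#)        ≈⟨ sym (⁻¹-∙-comm _ _) ⟩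
      - (suc m · 1#) - suc n · 1#        ∎
      where open import Data.Nat.Properties using () renaming (+-suc to ℕ+-suc)

    fromℤ-- : ∀ i → fromℤ (ℤ.- i) ≈ - fromℤ i
    fromℤ-- (+ zero)  = sym -0#≈0#
    fromℤ-- (+ suc n) = refl
    fromℤ-- -[1+ n ]  = sym (-‿involutive _)

    fromℤ-◃+ : ∀ n → fromℤ (Sign.+ ℤ.◃ n) ≈ n · 1#
    fromℤ-◃+ zero    = refl
    fromℤ-◃+ (suc n) = refl

    fromℤ-◃- : ∀ n → fromℤ (Sign.- ℤ.◃ n) ≈ - (n · 1#)
    fromℤ-◃- zero    = sym -0#≈0#
    fromℤ-◃- (suc n) = refl

    fromℤ-* : ∀ i j → fromℤ (i ℤ.* j) ≈ fromℤ i * fromℤ j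
    fromℤ-* (+ m)    (+ n)    = trans (fromℤ-◃+ (m ℕ.* n)) (×1-homo-* m n)
    fromℤ-* (+ m)    -[1+ n ] = trans (fromℤ-◃- (m ℕ.* suc n))
      (trans (-‿cong (×1-homo-* m (suc n))) (-‿distribʳ-* _ _))
    fromℤ-* -[1+ m ] (+ n)    = trans (fromℤ-◃- (suc m ℕ.* n))
      (trans (-‿cong (×1-homo-* (suc m) n)) (-‿distribˡ-* _ _))
    fromℤ-* -[1+ m ] -[1+ n ] = begin
      (suc m ℕ.* suc n) · 1#                ≈⟨ ×1-homo-* (suc m) (suc n) ⟩
      suc m · 1# * suc n · 1#               ≈⟨ sym (-‿involutive _) ⟩
      - - (suc m · 1# * suc n · 1#)         ≈⟨ -‿cong (-‿distribʳ-* _ _) ⟩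
      - (suc m · 1# * - (suc n · 1#))       ≈⟨ -‿distribˡ-* _ _ ⟩
      - (suc m · 1#) * - (suc n · 1#)       ∎

    ℤ-rawRing : RawRing _ _
    ℤ-rawRing = record
      { Carrier = ℤ ; _≈_ = _≡_ ; _+_ = ℤ._+_ ; _*_ = ℤ._*_ ; -_ = ℤ.-_ ; 0# = 0ℤ ; 1# = 1ℤ }

    homomorphism : ℤ-rawRing -Raw-AlmostCommutative⟶ fromCommutativeRing R
    homomorphism = record
      { ⟦_⟧ = fromℤ ; +-homo = fromℤ-+ ; *-homo = fromℤ-* ; -‿homo = fromℤ--
      ; 0-homo = refl ; 1-homo = refl }

    -- A partial test is all that can be had: distinct integers may agree in a quotient ring, and
    -- equality there is not decided.
    fromℤ-≟ : ∀ i j → Maybe (fromℤ i ≈ fromℤ j)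
    fromℤ-≟ i j with i ℤ.≟ j
    ... | yes i≡j = just (reflexive (≡.cong fromℤ i≡j))
    ... | no  _   = nothing

  open import Algebra.Solver.Ring ℤ-rawRing (fromCommutativeRing R) homomorphism fromℤ-≟ public
    using (Polynomial; con; _:+_; _:*_; _:-_; :-_; _:=_; solve)

-- Finite sums, finite products and invertible elements

module RingSums {c ℓ} (R : CommutativeRing c ℓ) where
  open CommutativeRing R
  open import Relation.Binary.Reasoning.Setoid setoid

  ∑ ∏ : ℕ → (ℕ → Carrier) → Carrier
  ∑ zero    f = 0#
  ∑ (suc n) f = ∑ n f + f n
  ∏ zero    f = 1#
  ∏ (suc n) f = ∏ n f * f n

  ∑-cong : ∀ n {f g} → (∀ i → i ℕ.< n → f i ≈ g i) → ∑ n f ≈ ∑ n g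
  ∑-cong zero    h = refl
  ∑-cong (suc n) h = +-cong (∑-cong n (λ i i<n → h i (ℕ.m<n⇒m<1+n i<n))) (h n ℕ.≤-refl)

  *-∑ : ∀ x n f → x * ∑ n f ≈ ∑ n (λ i → x * f i)
  *-∑ x zero    f = zeroʳ x
  *-∑ x (suc n) f = trans (distribˡ x _ _) (+-congʳ (*-∑ x n f))

  1-cong : ∀ {x y} → x ≈ y → 1# - x ≈ 1# - y
  1-cong e = +-congˡ (-‿cong e)

  ∏-zero : ∀ n {f} i → i ℕ.< n → f i ≈ 0# → ∏ n f ≈ 0#
  ∏-zero (suc n) i (s≤s i≤n) h with ℕ.m≤n⇒m<n∨m≡n i≤n
  ... | inj₁ i<n    = trans (*-congʳ (∏-zero n i i<n h)) (zeroˡ _)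
  ... | inj₂ ≡.refl = trans (*-congˡ h) (zeroʳ _)

  ∏-factor : ∀ n {f c} i → i ℕ.< n → f i ≈ c → ∃ λ x → ∏ n f ≈ c * x
  ∏-factor (suc n) {f} {c} i (s≤s i≤n) h with ℕ.m≤n⇒m<n∨m≡n i≤n
  ... | inj₂ ≡.refl = ∏ n f , trans (*-comm _ _) (*-congʳ h)
  ... | inj₁ i<n    = let x , k = ∏-factor n i i<n h in x * f n , trans (*-congʳ k) (*-assoc c x (f n))

  Invertible : Carrier → Set _
  Invertible x = ∃ λ x⁻¹ → x * x⁻¹ ≈ 1#

  invertible-* : ∀ {x y} → Invertible x → Invertible y → Invertible (x * y)
  invertible-* {x} {y} (x⁻¹ , h) (y⁻¹ , k) = x⁻¹ * y⁻¹ , (begin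
    x * y * (x⁻¹ * y⁻¹)    ≈⟨ solve 4 (λ x y a b → x :* y :* (a :* b) := x :* a :* (y :* b)) refl x y x⁻¹ y⁻¹ ⟩
    x * x⁻¹ * (y * y⁻¹)    ≈⟨ *-cong h k ⟩
    1# * 1#                ≈⟨ *-identityˡ 1# ⟩
    1#                     ∎)
    where open IntegerCoefficients R

  invertible-∏ : ∀ n {f} → (∀ i → i ℕ.< n → Invertible (f i)) → Invertible (∏ n f)
  invertible-∏ zero    h = 1# , *-identityˡ 1#
  invertible-∏ (suc n) h =
    invertible-* (invertible-∏ n (λ i i<n → h i (ℕ.m<n⇒m<1+n i<n))) (h n ℕ.≤-refl)

  invertible-resp : ∀ {x y} → x ≈ y → Invertible x → Invertible y
  invertible-resp e (z , h) = z , trans (*-congʳ (sym e)) h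

  invertible-cancelˡ : ∀ {x y z} → Invertible x → x * y ≈ x * z → y ≈ z
  invertible-cancelˡ {x} {y} {z} (x⁻¹ , h) e = begin
    y                ≈⟨ unfold y ⟩
    x⁻¹ * (x * y)    ≈⟨ *-congˡ e ⟩
    x⁻¹ * (x * z)    ≈⟨ sym (unfold z) ⟩
    z                ∎
    where
    open IntegerCoefficients R
    unfold : ∀ y → y ≈ x⁻¹ * (x * y)
    unfold y = begin
      y                ≈⟨ sym (*-identityˡ y) ⟩
      1# * y           ≈⟨ *-congʳ (sym h) ⟩
      x * x⁻¹ * y      ≈⟨ solve 3 (λ x i y → x :* i :* y := i :* (x :* y)) refl x x⁻¹ y ⟩
      x⁻¹ * (x * y)    ∎

  invertible-cancel-0 : ∀ {x y} → Invertible x → x * y ≈ 0# → y ≈ 0#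
  invertible-cancel-0 {x} u e = invertible-cancelˡ u (trans e (sym (zeroʳ x)))

-- The terminating ₆φ₅ summation

-- The terminating very-well-poised ₆φ₅ sum over k ≤ M with base Q and parameters a, b = a,
-- c = u⁻¹, Q^-M, multiplied by (1 - a)(aQ^(M+1);Q)_M so that no denominator depends on M;
-- u⁻¹ itself does not occur, since u(1 - u⁻¹Q^k) = u - Q^k.
module SixPhiFive {c ℓ} (R : CommutativeRing c ℓ) (a u Q : CommutativeRing.Carrier R)
  (N : ℕ) (inv invᵤ : ℕ → CommutativeRing.Carrier R) where

  open CommutativeRing R
  open import Algebra.Properties.Semiring.Exp semiring using (_^_; ^-homo-*)
  open import Relation.Binary.Reasoning.Setoid setoid
  open RingSums R
  open IntegerCoefficients R

  private
    :1 : ∀ {n} → Polynomial n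
    :1 = con 1ℤ

  pochhammer : Carrier → ℕ → Carrier
  pochhammer x n = ∏ n (λ i → 1# - x * Q ^ i)

  pochhammer-cong : ∀ {x y} n → x ≈ y → pochhammer x n ≈ pochhammer y n
  pochhammer-cong zero    e = refl
  pochhammer-cong (suc n) e = *-cong (pochhammer-cong n e) (1-cong (*-congʳ e))

  pochhammer-head : ∀ x n → pochhammer x (suc n) ≈ (1# - x) * pochhammer (x * Q) n
  pochhammer-head x zero    = solve 1 (λ x → :1 :* (:1 :- x :* :1) := (:1 :- x) :* :1) refl x
  pochhammer-head x (suc n) = begin
    pochhammer x (suc n) * (1# - x * (Q * Q ^ n))
      ≈⟨ *-cong (pochhammer-head x n) (1-cong (sym (*-assoc x Q (Q ^ n)))) ⟩
    (1# - x) * pochhammer (x * Q) n * (1# - x * Q * Q ^ n)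
      ≈⟨ *-assoc _ _ _ ⟩
    (1# - x) * pochhammer (x * Q) (suc n) ∎

  -- The part of a summand that depends on M = k + r. The first factor is (Q^-M;Q)_k up to sign and
  -- a power of Q; the second is (aQ^(M+1);Q)_M / (aQ^(M+1);Q)_k, a polynomial because k ≤ M.
  A : ℕ → ℕ → Carrier
  A k r = pochhammer (Q * Q ^ r) k * pochhammer (a * Q ^ k * Q ^ k * (Q * Q ^ r)) r

  -- Compares M and M + 1 at the same k.
  A-lower : ∀ k r → let z = Q ^ k ; p = Q ^ r ; w = Q * p in
    A k (suc r) * ((1# - w) * (1# - a * z * z * w)) ≈
    A k r * ((1# - z * w) * ((1# - a * (z * p) * (z * w)) * (1# - a * (z * w) * (z * w))))
  A-lower k r = begin
    pochhammer (Q * w) k * pochhammer (a * z * z * (Q * w)) (suc r) * ((1# - w) * (1# - a * z * z * w))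
      ≈⟨ solve 4 (λ x y s t → x :* y :* (s :* t) := (s :* x) :* (t :* y)) refl
           (pochhammer (Q * w) k) (pochhammer (a * z * z * (Q * w)) (suc r)) (1# - w) (1# - a * z * z * w) ⟩
    ((1# - w) * pochhammer (Q * w) k) * ((1# - a * z * z * w) * pochhammer (a * z * z * (Q * w)) (suc r))
      ≈⟨ *-cong (*-congˡ (pochhammer-cong k (*-comm Q w))) (*-congˡ (pochhammer-cong (suc r)
           (solve 3 (λ x Q w → x :* (Q :* w) := x :* w :* Q) refl (a * z * z) Q w))) ⟩
    ((1# - w) * pochhammer (w * Q) k) * ((1# - a * z * z * w) * pochhammer (a * z * z * w * Q) (suc r))
      ≈⟨ *-cong (sym (pochhammer-head w k)) (sym (pochhammer-head (a * z * z * w) (suc r))) ⟩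
    (pochhammer w k * (1# - w * z)) * (pochhammer (a * z * z * w) r * (1# - a * z * z * w * p) * (1# - a * z * z * w * w))
      ≈⟨ solve 6 (λ x y a z w p →
           (x :* (:1 :- w :* z)) :* (y :* (:1 :- a :* z :* z :* w :* p) :* (:1 :- a :* z :* z :* w :* w))
           := x :* y :* ((:1 :- z :* w) :* ((:1 :- a :* (z :* p) :* (z :* w)) :* (:1 :- a :* (z :* w) :* (z :* w)))))
           refl (pochhammer w k) (pochhammer (a * z * z * w) r) a z w p ⟩
    pochhammer w k * pochhammer (a * z * z * w) r * ((1# - z * w) * ((1# - a * (z * p) * (z * w)) * (1# - a * (z * w) * (z * w)))) ∎
    where z = Q ^ k ; p = Q ^ r ; w = Q * p

  -- Compares k and k + 1 at the same M = k + r + 1.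
  A-shift : ∀ k r → let z = Q ^ k ; w = Q * Q ^ r in
    A (suc k) r * (1# - a * z * z * (Q * w)) ≈ A k (suc r) * (1# - w)
  A-shift k r = begin
    pochhammer w (suc k) * pochhammer (a * (Q * z) * (Q * z) * w) r * (1# - a * z * z * (Q * w))
      ≈⟨ *-congʳ (*-cong (pochhammer-head w k)
           (pochhammer-cong r (solve 4 (λ a Q z w → a :* (Q :* z) :* (Q :* z) :* w := a :* z :* z :* (Q :* w) :* Q) refl a Q z w))) ⟩
    (1# - w) * pochhammer (w * Q) k * pochhammer (x * Q) r * (1# - x)
      ≈⟨ solve 4 (λ s p t r → s :* p :* r :* t := p :* (t :* r) :* s) refl
           (1# - w) (pochhammer (w * Q) k) (1# - x) (pochhammer (x * Q) r) ⟩
    pochhammer (w * Q) k * ((1# - x) * pochhammer (x * Q) r) * (1# - w)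
      ≈⟨ *-congʳ (*-cong (pochhammer-cong k (*-comm w Q)) (sym (pochhammer-head x r))) ⟩
    pochhammer (Q * w) k * pochhammer x (suc r) * (1# - w) ∎
    where z = Q ^ k ; w = Q * Q ^ r ; x = a * z * z * (Q * w)

  -- The part of a summand independent of M. The argument of the series is uQ^(M+1). Its u turns 1 -
  -- z/u into u - z, and Q^(M+1)(1 - Q^-M z) = -Qz(1 - Q^(M-k)) leaves `- (Q * z)` here, the other
  -- factor being in `A`.
  β : ℕ → Carrier
  β zero    = 1#
  β (suc k) = β k * ((1# - a * z) * (1# - a * z) * (u - z) * - (Q * z)) * (inv k * inv k * invᵤ k)
    where z = Q ^ k

  e : ℕ → ℕ → Carrier
  e k r = (1# - a * Q ^ k * Q ^ k) * (β k * A k r)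

  S : ℕ → ℕ → Carrier
  S k m = ∑ k (λ i → e i (m ℕ.∸ i))

  -- At g = Q^M these are the coefficients of the recurrence `S-suc` with one additional factor 1 -
  -- Qg on both sides. That factor lets `A-lower` rewrite `A k r` through `A k (suc r)` without
  -- dividing.
  c₁ c₂ : Carrier → Carrier
  c₁ g = (1# - Q * g) * (1# - Q * g) * (1# - a * u * (Q * g))
  c₂ g = (1# - u * (Q * g)) * ((1# - Q * g) * ((1# - a * g * (Q * g)) * (1# - a * (Q * g) * (Q * g))))

  c₁-cong : ∀ {g h} → g ≈ h → c₁ g ≈ c₁ h
  c₁-cong i = *-cong (*-cong (1-cong (*-congˡ i)) (1-cong (*-congˡ i))) (1-cong (*-congˡ (*-congˡ i)))

  c₂-cong : ∀ {g h} → g ≈ h → c₂ g ≈ c₂ h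
  c₂-cong i = *-cong (1-cong (*-congˡ (*-congˡ i))) (*-cong (1-cong (*-congˡ i))
    (*-cong (1-cong (*-cong (*-congˡ i) (*-congˡ i))) (1-cong (*-cong (*-congˡ (*-congˡ i)) (*-congˡ i)))))

  -- The certificate found by the WZ method.
  G : ℕ → ℕ → Carrier
  G k r = - Q ^ r * (β k * ((1# - z) * (1# - z) * (1# - a * u * z)) * (A k r * (1# - a * z * z * Q ^ r)))
    where z = Q ^ k

  module _ (inv-correct : ∀ k → k ℕ.< N → (1# - Q * Q ^ k) * inv k ≈ 1#)
           (invᵤ-correct : ∀ k → k ℕ.< N → (1# - a * u * (Q * Q ^ k)) * invᵤ k ≈ 1#) where

    β-suc : ∀ k → k ℕ.< N → let z = Q ^ k in
      β (suc k) * ((1# - Q * z) * (1# - Q * z) * (1# - a * u * (Q * z))) ≈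
      β k * ((1# - a * z) * (1# - a * z) * (u - z) * - (Q * z))
    β-suc k k<N = begin
      x * (inv k * inv k * invᵤ k) * (s * s * t)
        ≈⟨ solve 5 (λ x i j s t → x :* (i :* i :* j) :* (s :* s :* t) := x :* (s :* i) :* (s :* i) :* (t :* j)) refl x (inv k) (invᵤ k) s t ⟩
      x * (s * inv k) * (s * inv k) * (t * invᵤ k)
        ≈⟨ *-cong (*-cong (*-congˡ (inv-correct k k<N)) (inv-correct k k<N)) (invᵤ-correct k k<N) ⟩
      x * 1# * 1# * 1#
        ≈⟨ solve 1 (λ x → x :* :1 :* :1 :* :1 := x) refl x ⟩
      x ∎
      where
      z = Q ^ k ; s = 1# - Q * z ; t = 1# - a * u * (Q * z)
      x = β k * ((1# - a * z) * (1# - a * z) * (u - z) * - (Q * z))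

    -- The WZ equation at M = k + r. `A-lower`, `A-shift` and `β-suc` bring every term to a multiple
    -- of `β k * A k (suc r)`; what remains is a polynomial identity in a, u, z = Q^k and w =
    -- Q^(r+1).
    G-step : ∀ k r → k ℕ.< N → let g = Q ^ k * Q ^ r in
      G k (suc r) + (c₁ g * e k (suc r) - c₂ g * e k r) ≈ G (suc k) r
    G-step k r k<N = begin
      G k (suc r) + (c₁ g * e k (suc r) - c₂ g * e k r)
        ≈⟨ +-congˡ (+-cong (solve 8 (λ a u Q z p b A₁ A₀ →
               let g = z :* p in
               (:1 :- Q :* g) :* (:1 :- Q :* g) :* (:1 :- a :* u :* (Q :* g)) :* ((:1 :- a :* z :* z) :* (b :* A₁))
               := b :* A₁ :* ((:1 :- a :* z :* z) :* ((:1 :- Q :* p :* z) :* (:1 :- Q :* p :* z) :* (:1 :- a :* u :* (Q :* p) :* z))))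
             refl a u Q z p b A₁ A₀)
           (-‿cong (begin
             c₂ g * ((1# - a * z * z) * (b * A₀))
               ≈⟨ solve 7 (λ a u Q z p b A₀ →
                   let g = z :* p ; w = Q :* p in
                   (:1 :- u :* (Q :* g)) :* ((:1 :- Q :* g) :* ((:1 :- a :* g :* (Q :* g)) :* (:1 :- a :* (Q :* g) :* (Q :* g)))) :* ((:1 :- a :* z :* z) :* (b :* A₀))
                   := b :* ((:1 :- a :* z :* z) :* (:1 :- u :* w :* z)) :* (A₀ :* ((:1 :- z :* w) :* ((:1 :- a :* (z :* p) :* (z :* w)) :* (:1 :- a :* (z :* w) :* (z :* w))))))
                   refl a u Q z p b A₀ ⟩
             b * ((1# - a * z * z) * (1# - u * w * z)) * (A₀ * ((1# - z * w) * ((1# - a * (z * p) * (z * w)) * (1# - a * (z * w) * (z * w)))))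
               ≈⟨ *-congˡ (sym (A-lower k r)) ⟩
             b * ((1# - a * z * z) * (1# - u * w * z)) * (A₁ * ((1# - w) * (1# - a * z * z * w)))
               ∎))) ⟩
      - w * (b * ((1# - z) * (1# - z) * (1# - a * u * z)) * (A₁ * (1# - a * z * z * w)))
        + (b * A₁ * ((1# - a * z * z) * ((1# - w * z) * (1# - w * z) * (1# - a * u * w * z)))
          - b * ((1# - a * z * z) * (1# - u * w * z)) * (A₁ * ((1# - w) * (1# - a * z * z * w))))
        ≈⟨ solve 6 (λ a u z w b A₁ →
             :- w :* (b :* ((:1 :- z) :* (:1 :- z) :* (:1 :- a :* u :* z)) :* (A₁ :* (:1 :- a :* z :* z :* w)))
             :+ (b :* A₁ :* ((:1 :- a :* z :* z) :* ((:1 :- w :* z) :* (:1 :- w :* z) :* (:1 :- a :* u :* w :* z)))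
               :- b :* ((:1 :- a :* z :* z) :* (:1 :- u :* w :* z)) :* (A₁ :* ((:1 :- w) :* (:1 :- a :* z :* z :* w))))
             := w :* z :* (b :* ((:1 :- a :* z) :* (:1 :- a :* z) :* (u :- z))) :* (A₁ :* (:1 :- w))) refl a u z w b A₁ ⟩
      w * z * (b * ((1# - a * z) * (1# - a * z) * (u - z))) * (A₁ * (1# - w))
        ≈⟨ *-congʳ (solve 5 (λ Q z p b x →
             Q :* p :* z :* (b :* x) := :- p :* (b :* (x :* :- (Q :* z)))) refl Q z p b ((1# - a * z) * (1# - a * z) * (u - z))) ⟩
      - p * (b * ((1# - a * z) * (1# - a * z) * (u - z) * - (Q * z))) * (A₁ * (1# - w))
        ≈⟨ *-cong (*-congˡ (sym (β-suc k k<N))) (sym (A-shift k r)) ⟩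
      - p * (β (suc k) * ((1# - Q * z) * (1# - Q * z) * (1# - a * u * (Q * z)))) * (A (suc k) r * (1# - a * z * z * (Q * w)))
        ≈⟨ trans (*-assoc _ _ _) (*-congˡ (*-congˡ (*-congˡ (1-cong
             (solve 4 (λ a z Q p → a :* z :* z :* (Q :* (Q :* p)) := a :* (Q :* z) :* (Q :* z) :* p) refl a z Q p))))) ⟩
      G (suc k) r ∎
      where
      z = Q ^ k ; p = Q ^ r ; w = Q * p ; g = z * p
      b = β k ; A₁ = A k (suc r) ; A₀ = A k r

    S-partial : ∀ M k r → k ℕ.+ r ≡ suc M → M ℕ.< N →
      c₁ (Q ^ M) * S k (suc M) - c₂ (Q ^ M) * S k M ≈ G k r
    S-partial M zero r _ _ = begin
      c₁ (Q ^ M) * 0# - c₂ (Q ^ M) * 0#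
        -- The telescoping starts at zero, since `G 0 r` contains (1 - Q^0)².
        ≈⟨ solve 6 (λ x y u b A p → x :* con 0ℤ :- y :* con 0ℤ
             := :- p :* (b :* ((:1 :- :1) :* (:1 :- :1) :* (:1 :- u :* :1)) :* A)) refl
             (c₁ (Q ^ M)) (c₂ (Q ^ M)) (a * u) (β 0) (A 0 r * (1# - a * 1# * 1# * Q ^ r)) (Q ^ r) ⟩
      G 0 r ∎
    S-partial M (suc k) r eq M<N = begin
      c₁ (Q ^ M) * (S k (suc M) + e k (suc M ℕ.∸ k)) - c₂ (Q ^ M) * (S k M + e k (M ℕ.∸ k))
        ≈⟨ solve 6 (λ x s e y t f → x :* (s :+ e) :- y :* (t :+ f) := (x :* s :- y :* t) :+ (x :* e :- y :* f)) refl
             (c₁ (Q ^ M)) (S k (suc M)) (e k (suc M ℕ.∸ k)) (c₂ (Q ^ M)) (S k M) (e k (M ℕ.∸ k)) ⟩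
      (c₁ (Q ^ M) * S k (suc M) - c₂ (Q ^ M) * S k M)
        + (c₁ (Q ^ M) * e k (suc M ℕ.∸ k) - c₂ (Q ^ M) * e k (M ℕ.∸ k))
        ≈⟨ +-cong (S-partial M k (suc r) (≡.trans (ℕ.+-suc k r) eq) M<N)
             (+-cong (*-cong (c₁-cong Q^M) (reflexive (≡.cong (e k) 1+M∸k)))
               (-‿cong (*-cong (c₂-cong Q^M) (reflexive (≡.cong (e k) M∸k))))) ⟩
      G k (suc r) + (c₁ g * e k (suc r) - c₂ g * e k r)
        ≈⟨ G-step k r (ℕ.≤-<-trans (ℕ.≤-trans (ℕ.m≤m+n k r) (ℕ.≤-reflexive k+r)) M<N) ⟩
      G (suc k) r ∎
      where
      g = Q ^ k * Q ^ r
      k+r : k ℕ.+ r ≡ M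
      k+r = ℕ.suc-injective eq
      M∸k : M ℕ.∸ k ≡ r
      M∸k = ≡.trans (≡.cong (ℕ._∸ k) (≡.sym k+r)) (ℕ.m+n∸m≡n k r)
      1+M∸k : suc M ℕ.∸ k ≡ suc r
      1+M∸k = ≡.trans (≡.cong (ℕ._∸ k) (≡.sym (≡.trans (ℕ.+-suc k r) eq))) (ℕ.m+n∸m≡n k (suc r))
      Q^M : Q ^ M ≈ g
      Q^M = trans (reflexive (≡.cong (Q ^_) (≡.sym k+r))) (^-homo-* Q k r)

    -- `S-partial` accounts for the indices that both sums share. The additional last summand of the
    -- longer sum, multiplied by `c₁`, is exactly `- G (suc M) 0`, so the boundary terms cancel; the
    -- surplus factor 1 - y is then removed by `inv M`.
    S-suc : ∀ M → M ℕ.< N → let y = Q * Q ^ M in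
      S (suc (suc M)) (suc M) * ((1# - y) * (1# - a * u * y)) ≈
      S (suc M) M * ((1# - u * y) * ((1# - a * Q ^ M * y) * (1# - a * y * y)))
    S-suc M M<N = invertible-cancelˡ (inv M , inv-correct M M<N) (begin
      (1# - y) * ((s + e (suc M) (M ℕ.∸ M)) * ((1# - y) * (1# - a * u * y)))
        ≈⟨ *-congˡ (*-congʳ (+-congˡ (reflexive (≡.cong (e (suc M)) (ℕ.n∸n≡0 M))))) ⟩
      (1# - y) * ((s + e (suc M) 0) * ((1# - y) * (1# - a * u * y)))
        ≈⟨ solve 7 (λ a u y s t b A →
             let e = (:1 :- a :* y :* y) :* (b :* A) in
             (:1 :- y) :* ((s :+ e) :* ((:1 :- y) :* (:1 :- a :* u :* y)))
             := ((:1 :- y) :* (:1 :- y) :* (:1 :- a :* u :* y) :* s :- t)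
                :+ (e :* ((:1 :- y) :* (:1 :- y) :* (:1 :- a :* u :* y)) :+ t)) refl a u y s (c₂ (Q ^ M) * t) (β (suc M)) (A (suc M) 0) ⟩
      (c₁ (Q ^ M) * s - c₂ (Q ^ M) * t) + (e (suc M) 0 * c₁ (Q ^ M) + c₂ (Q ^ M) * t)
        ≈⟨ +-congʳ (S-partial M (suc M) 0 (ℕ.+-identityʳ (suc M)) M<N) ⟩
      G (suc M) 0 + (e (suc M) 0 * c₁ (Q ^ M) + c₂ (Q ^ M) * t)
        ≈⟨ solve 8 (λ a u y b A t g x →
             (:- :1 :* (b :* ((:1 :- y) :* (:1 :- y) :* (:1 :- a :* u :* y)) :* (A :* (:1 :- a :* y :* y :* :1))))
             :+ ((:1 :- a :* y :* y) :* (b :* A) :* ((:1 :- y) :* (:1 :- y) :* (:1 :- a :* u :* y))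
               :+ (:1 :- u :* y) :* ((:1 :- y) :* g) :* t)
             := (:1 :- y) :* (t :* ((:1 :- u :* y) :* g))) refl
             a u y (β (suc M)) (A (suc M) 0) t ((1# - a * Q ^ M * y) * (1# - a * y * y)) 1# ⟩
      (1# - y) * (t * ((1# - u * y) * ((1# - a * Q ^ M * y) * (1# - a * y * y)))) ∎)
      where
      y = Q * Q ^ M ; s = S (suc M) (suc M) ; t = S (suc M) M

    den num : ℕ → Carrier
    den M = ∏ M (λ i → (1# - Q * Q ^ i) * (1# - a * u * (Q * Q ^ i)))
    num M = ∏ M (λ i → let y = Q * Q ^ i in (1# - u * y) * ((1# - a * Q ^ i * y) * (1# - a * y * y)))

    sixPhiFive : ∀ M → M ℕ.≤ N → S (suc M) M * den M ≈ (1# - a) * num M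
    sixPhiFive zero    _   = solve 1 (λ a →
      (con 0ℤ :+ (:1 :- a :* :1 :* :1) :* (:1 :* (:1 :* :1))) :* :1 := (:1 :- a) :* :1) refl a
    sixPhiFive (suc M) M<N = begin
      S (suc (suc M)) (suc M) * (den M * d)          ≈⟨ solve 3 (λ x y z → x :* (y :* z) := x :* z :* y) refl _ (den M) d ⟩
      S (suc (suc M)) (suc M) * d * den M            ≈⟨ *-congʳ (S-suc M M<N) ⟩
      S (suc M) M * n * den M                        ≈⟨ solve 3 (λ x y z → x :* y :* z := x :* z :* y) refl _ n (den M) ⟩
      S (suc M) M * den M * n                        ≈⟨ *-congʳ (sixPhiFive M (ℕ.<⇒≤ M<N)) ⟩
      (1# - a) * num M * n                           ≈⟨ *-assoc _ _ _ ⟩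
      (1# - a) * num (suc M)                         ∎
      where
      y = Q * Q ^ M
      d = (1# - y) * (1# - a * u * y)
      n = (1# - u * y) * ((1# - a * Q ^ M * y) * (1# - a * y * y))

-- From the ₆φ₅ sum to fourth powers

even-or-odd : ∀ n → ∃ λ i → n ≡ i ℕ.+ i ⊎ n ≡ i ℕ.+ suc i
even-or-odd zero    = 0 , inj₁ ≡.refl
even-or-odd (suc n) with even-or-odd n
... | i , inj₁ ≡.refl = i , inj₂ (≡.sym (ℕ.+-suc i i))
... | i , inj₂ ≡.refl = suc i , inj₁ ≡.refl

-- With y = aQᴺ and v = y⁻¹ infinitely near 1 (y + v = 2), the parameter u = v/a turns the
-- ₆φ₅ sum into one whose factors (1 - yr)(1 - vr) equal (1 - r)².
module WellPoised {c ℓ} (R : CommutativeRing c ℓ) where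
  open CommutativeRing R
  open Exp semiring using (_^_; ^-homo-*)
  open import Relation.Binary.Reasoning.Setoid setoid
  open RingSums R
  open IntegerCoefficients R

  module _ (a Q t y v : Carrier) (N : ℕ) (inv : ℕ → Carrier)
    (y-def : a * Q ^ N ≈ y) (yv : y * v ≈ 1#) (y+v : y + v ≈ 1# + 1#) (taa : t * a * a ≈ Q)
    (inv-correct : ∀ k → k ℕ.< N → (1# - Q * Q ^ k) * inv k ≈ 1#) where

    private
      :1 : ∀ {n} → Polynomial n
      :1 = con 1ℤ

    -- This is v/a written without an inverse of a: a Q^N = y and y v = 1.
    u : Carrier
    u = Q ^ N * v * v

    a*u : a * u ≈ v
    a*u = begin
      a * (Q ^ N * v * v)    ≈⟨ solve 3 (λ a p v → a :* (p :* v :* v) := a :* p :* v :* v) refl a (Q ^ N) v ⟩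
      a * Q ^ N * v * v      ≈⟨ *-congʳ (trans (*-congʳ y-def) yv) ⟩
      1# * v                 ≈⟨ *-identityˡ v ⟩
      v                      ∎

    [1-yr][1-vr] : ∀ r → (1# - y * r) * (1# - v * r) ≈ (1# - r) * (1# - r)
    [1-yr][1-vr] r = begin
      (1# - y * r) * (1# - v * r)
        ≈⟨ solve 3 (λ y v r → (:1 :- y :* r) :* (:1 :- v :* r) := :1 :- (y :+ v) :* r :+ y :* v :* r :* r) refl y v r ⟩
      1# - (y + v) * r + y * v * r * r
        ≈⟨ +-cong (+-congˡ (-‿cong (*-congʳ y+v))) (*-congʳ (*-congʳ yv)) ⟩
      1# - (1# + 1#) * r + 1# * r * r
        ≈⟨ solve 1 (λ r → :1 :- (:1 :+ :1) :* r :+ :1 :* r :* r := (:1 :- r) :* (:1 :- r)) refl r ⟩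
      (1# - r) * (1# - r) ∎

    square-inverse : ∀ k → k ℕ.< N → let s = Q * Q ^ k in
      (1# - y * s) * (1# - v * s) * (inv k * inv k) ≈ 1#
    square-inverse k k<N = begin
      (1# - y * s) * (1# - v * s) * (inv k * inv k)
        ≈⟨ *-congʳ ([1-yr][1-vr] s) ⟩
      (1# - s) * (1# - s) * (inv k * inv k)
        ≈⟨ solve 2 (λ s i → s :* s :* (i :* i) := (s :* i) :* (s :* i)) refl (1# - s) (inv k) ⟩
      (1# - s) * inv k * ((1# - s) * inv k)
        ≈⟨ *-cong (inv-correct k k<N) (inv-correct k k<N) ⟩
      1# * 1#
        ≈⟨ *-identityˡ 1# ⟩
      1# ∎
      where s = Q * Q ^ k

    -- For s = Q^(k+1), the inverse of 1 - v s is (1 - y s)/(1 - s)².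
    invᵤ : ℕ → Carrier
    invᵤ k = (1# - y * (Q * Q ^ k)) * (inv k * inv k)

    open SixPhiFive R a u Q N inv invᵤ

    invᵤ-correct : ∀ k → k ℕ.< N → (1# - a * u * (Q * Q ^ k)) * invᵤ k ≈ 1#
    invᵤ-correct k k<N = begin
      (1# - a * u * s) * ((1# - y * s) * (inv k * inv k))
        ≈⟨ *-congʳ (1-cong (*-congʳ a*u)) ⟩
      (1# - v * s) * ((1# - y * s) * (inv k * inv k))
        ≈⟨ solve 3 (λ x y i → x :* (y :* i) := y :* x :* i) refl (1# - v * s) (1# - y * s) (inv k * inv k) ⟩
      (1# - y * s) * (1# - v * s) * (inv k * inv k)
        ≈⟨ square-inverse k k<N ⟩
      1# ∎
      where s = Q * Q ^ k

    invertible-1-y : ∀ k → k ℕ.< N → Invertible (1# - y * (Q * Q ^ k))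
    invertible-1-y k k<N = _ , trans (sym (*-assoc _ _ _)) (square-inverse k k<N)

    τ : ℕ → Carrier
    τ k = ∏ k (λ j → t * ((1# - a * Q ^ j) * inv j) ^ 4)

    -- Writing Q as t a a gives one a to each factor: a(u - z) = v - az and -az(1 - w) = y - az.
    -- Since y v = 1, (v - r)(y - r) equals (1 - yr)(1 - vr), hence (1 - r)².
    deformed-factor : ∀ {z w} → a * (z * w) ≈ y → Q ^ N ≈ z * w →
      (u - z) * - (Q * z) * (1# - w) ≈ t * ((1# - a * z) * (1# - a * z))
    deformed-factor {z} {w} azw Q^N = begin
      (u - z) * - (Q * z) * (1# - w)
        ≈⟨ *-congʳ (*-cong (+-congʳ (*-congʳ (*-congʳ Q^N))) (-‿cong (*-congʳ (sym taa)))) ⟩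
      (z * w * v * v - z) * - (t * a * a * z) * (1# - w)
        ≈⟨ solve 5 (λ a t v z w → (z :* w :* v :* v :- z) :* :- (t :* a :* a :* z) :* (:1 :- w)
             := t :* ((a :* (z :* w) :* v :* v :- a :* z) :* (a :* (z :* w) :- a :* z))) refl a t v z w ⟩
      t * ((a * (z * w) * v * v - a * z) * (a * (z * w) - a * z))
        ≈⟨ *-congˡ (*-cong (+-congʳ (trans (*-congʳ (trans (*-congʳ azw) yv)) (*-identityˡ v))) (+-congʳ azw)) ⟩
      t * ((v - a * z) * (y - a * z))
        ≈⟨ *-congˡ (solve 3 (λ y v r → (v :- r) :* (y :- r)
             := (:1 :- y :* r) :* (:1 :- v :* r) :+ (y :* v :- :1) :* (:1 :- r :* r)) refl y v (a * z)) ⟩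
      t * ((1# - y * (a * z)) * (1# - v * (a * z)) + (y * v - 1#) * (1# - a * z * (a * z)))
        ≈⟨ *-congˡ (+-cong ([1-yr][1-vr] (a * z)) (*-congʳ (+-congʳ yv))) ⟩
      t * ((1# - a * z) * (1# - a * z) + (1# - 1#) * (1# - a * z * (a * z)))
        ≈⟨ *-congˡ (solve 2 (λ x s → x :+ (:1 :- :1) :* s := x) refl _ _) ⟩
      t * ((1# - a * z) * (1# - a * z)) ∎

    -- The deformed numerator pair becomes a square by `deformed-factor`. In the denominator, 1 - v
    -- s comes from `β` and its partner 1 - y s from `A-shift`; `A 0 N` is the normalisation of the
    -- whole sum.
    βA≈τ : ∀ k r → k ℕ.+ r ≡ N → β k * A k r ≈ A 0 N * τ k
    βA≈τ zero    r ≡.refl = *-comm 1# (A 0 r)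
    βA≈τ (suc k) r eq = begin
      b * ((1# - a * z) * (1# - a * z) * (u - z) * - (Q * z)) * (i * i * ((1# - y * (Q * z)) * (i * i))) * A (suc k) r
        ≈⟨ solve 7 (λ b s x x′ i l A → b :* (s :* s :* x :* x′) :* (i :* i :* (l :* (i :* i))) :* A
             := b :* (s :* s :* (x :* x′)) :* (i :* i :* (i :* i)) :* (A :* l)) refl b (1# - a * z) (u - z) (- (Q * z)) i (1# - y * (Q * z)) (A (suc k) r) ⟩
      b * ((1# - a * z) * (1# - a * z) * ((u - z) * - (Q * z))) * (i * i * (i * i)) * (A (suc k) r * (1# - y * (Q * z)))
        ≈⟨ *-congˡ (trans (*-congˡ (1-cong (begin
             y * (Q * z)              ≈⟨ *-congʳ (sym azw) ⟩
             a * (z * w) * (Q * z)    ≈⟨ solve 4 (λ a z w Q → a :* (z :* w) :* (Q :* z) := a :* z :* z :* (Q :* w)) refl a z w Q ⟩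
             a * z * z * (Q * w)      ∎))) (A-shift k r)) ⟩
      b * ((1# - a * z) * (1# - a * z) * ((u - z) * - (Q * z))) * (i * i * (i * i)) * (A k (suc r) * (1# - w))
        ≈⟨ solve 6 (λ b s x i A l → b :* (s :* s :* x) :* (i :* i :* (i :* i)) :* (A :* l)
             := b :* A :* (s :* s :* (x :* l) :* (i :* i :* (i :* i)))) refl b (1# - a * z) ((u - z) * - (Q * z)) i (A k (suc r)) (1# - w) ⟩
      b * A k (suc r) * ((1# - a * z) * (1# - a * z) * ((u - z) * - (Q * z) * (1# - w)) * (i * i * (i * i)))
        ≈⟨ *-cong (βA≈τ k (suc r) k+1+r) (*-congʳ (*-congˡ (deformed-factor azw Q^N))) ⟩
      A 0 N * τ k * ((1# - a * z) * (1# - a * z) * (t * ((1# - a * z) * (1# - a * z))) * (i * i * (i * i)))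
        ≈⟨ solve 5 (λ A τ s t i → A :* τ :* (s :* s :* (t :* (s :* s)) :* (i :* i :* (i :* i)))
             := A :* (τ :* (t :* (s :* i :* (s :* i :* (s :* i :* (s :* i :* :1))))))) refl (A 0 N) (τ k) (1# - a * z) t i ⟩
      A 0 N * τ (suc k) ∎
      where
      b = β k ; z = Q ^ k ; w = Q * Q ^ r ; i = inv k
      k+1+r : k ℕ.+ suc r ≡ N
      k+1+r = ≡.trans (ℕ.+-suc k r) eq
      Q^N : Q ^ N ≈ z * w
      Q^N = trans (reflexive (≡.cong (Q ^_) (≡.sym k+1+r))) (^-homo-* Q k (suc r))
      azw : a * (z * w) ≈ y
      azw = trans (*-congˡ (sym Q^N)) y-def

    ∏-* : ∀ n f g → ∏ n (λ i → f i * g i) ≈ ∏ n f * ∏ n g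
    ∏-* zero    f g = sym (*-identityˡ 1#)
    ∏-* (suc n) f g = trans (*-congʳ (∏-* n f g))
      (solve 4 (λ x y z w → x :* y :* (z :* w) := x :* z :* (y :* w)) refl (∏ n f) (∏ n g) (f n) (g n))

    -- Some factor of the product is 1 - aQᴺ = 1 - y.
    1-y∣odd-even : 1 ℕ.≤ N → ∃ λ x →
      ∏ N (λ i → let s = Q * Q ^ i in (1# - a * Q ^ i * s) * (1# - a * s * s)) ≈ (1# - y) * x
    1-y∣odd-even 1≤N with even-or-odd N
    ... | zero , inj₁ ≡.refl with () ← 1≤N
    ... | suc i , inj₁ eq =
      let x , h = ∏-factor N i (ℕ.≤-trans (ℕ.m≤m+n (suc i) (suc i)) (ℕ.≤-reflexive (≡.sym eq))) refl
      in _ , trans h (trans (*-congʳ (trans (*-comm _ _) (*-congʳ (1-cong (begin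
           a * s * s              ≈⟨ *-assoc a s s ⟩
           a * (s * s)            ≈⟨ *-congˡ (sym (^-homo-* Q (suc i) (suc i))) ⟩
           a * Q ^ (suc i ℕ.+ suc i)   ≈⟨ trans (*-congˡ (reflexive (≡.cong (Q ^_) (≡.sym eq)))) y-def ⟩
           y                      ∎))))) (*-assoc _ _ _))
      where s = Q * Q ^ i
    ... | i , inj₂ eq =
      let x , h = ∏-factor N i (ℕ.≤-trans (ℕ.m≤n+m (suc i) i) (ℕ.≤-reflexive (≡.sym eq))) refl
      in _ , trans h (trans (*-congʳ (*-congʳ (1-cong (begin
           a * Q ^ i * s          ≈⟨ *-assoc a (Q ^ i) s ⟩
           a * (Q ^ i * s)        ≈⟨ *-congˡ (sym (^-homo-* Q i (suc i))) ⟩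
           a * Q ^ (i ℕ.+ suc i)       ≈⟨ trans (*-congˡ (reflexive (≡.cong (Q ^_) (≡.sym eq)))) y-def ⟩
           y                      ∎)))) (*-assoc _ _ _))
      where s = Q * Q ^ i

    num≈0 : 1 ℕ.≤ N → (1# - y) * ∏ N (λ i → 1# - u * (Q * Q ^ i)) ≈ 0# → num inv-correct invᵤ-correct N ≈ 0#
    num≈0 1≤N h =
      let x , k = 1-y∣odd-even 1≤N
      in begin
        num inv-correct invᵤ-correct N
          ≈⟨ trans (∏-* N _ _) (*-congˡ k) ⟩
        ∏ N (λ i → 1# - u * (Q * Q ^ i)) * ((1# - y) * x)
          ≈⟨ solve 3 (λ p y x → p :* (y :* x) := y :* p :* x) refl _ (1# - y) x ⟩
        (1# - y) * ∏ N (λ i → 1# - u * (Q * Q ^ i)) * x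
          ≈⟨ trans (*-congʳ h) (zeroˡ x) ⟩
        0# ∎

    wellPoised-sum : 1 ℕ.≤ N → (1# - y) * ∏ N (λ i → 1# - u * (Q * Q ^ i)) ≈ 0# →
      ∑ (suc N) (λ k → (1# - a * Q ^ k * Q ^ k) * τ k) ≈ 0#
    wellPoised-sum 1≤N h = invertible-cancel-0 (invertible-* invertible-A invertible-den) (begin
      A 0 N * den′ * ∑ (suc N) f
        ≈⟨ solve 3 (λ x y z → x :* y :* z := x :* z :* y) refl (A 0 N) den′ _ ⟩
      A 0 N * ∑ (suc N) f * den′
        ≈⟨ *-congʳ (trans (*-∑ (A 0 N) (suc N) f) (sym (∑-cong (suc N) term))) ⟩
      S (suc N) N * den′
        ≈⟨ sixPhiFive inv-correct invᵤ-correct N ℕ.≤-refl ⟩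
      (1# - a) * num inv-correct invᵤ-correct N
        ≈⟨ trans (*-congˡ (num≈0 1≤N h)) (zeroʳ _) ⟩
      0# ∎)
      where
      f : ℕ → Carrier
      f k = (1# - a * Q ^ k * Q ^ k) * τ k
      den′ = den inv-correct invᵤ-correct N
      term : ∀ i → i ℕ.< suc N → e i (N ℕ.∸ i) ≈ A 0 N * f i
      term i (s≤s i≤N) = trans (*-congˡ (βA≈τ i (N ℕ.∸ i) (ℕ.m+[n∸m]≡n i≤N)))
        (solve 3 (λ x A τ → x :* (A :* τ) := A :* (x :* τ)) refl (1# - a * Q ^ i * Q ^ i) (A 0 N) (τ i))
      -- `A 0 N` is the product of the 1 - yQ^(i+1), i < N, and each of these divides the invertible
      -- square (1 - Q^(i+1))².
      invertible-A : Invertible (A 0 N)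
      invertible-A = invertible-* (1# , *-identityˡ 1#) (invertible-∏ N (λ i i<N →
        invertible-resp (1-cong (begin
          y * (Q * Q ^ i)                    ≈⟨ *-congʳ (sym y-def) ⟩
          a * Q ^ N * (Q * Q ^ i)            ≈⟨ solve 4 (λ a p Q r → a :* p :* (Q :* r) := a :* :1 :* :1 :* (Q :* p) :* r) refl a (Q ^ N) Q (Q ^ i) ⟩
          a * 1# * 1# * (Q * Q ^ N) * Q ^ i  ∎)) (invertible-1-y i i<N)))
      invertible-den : Invertible den′
      invertible-den = invertible-∏ N (λ i i<N →
        invertible-* (inv i , inv-correct i i<N) (invᵤ i , invᵤ-correct i i<N))

-- Localisation of a commutative ring

module Fractions {c ℓ p} (R : CommutativeRing c ℓ) (S : CommutativeRing.Carrier R → Set p) where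
  open CommutativeRing R
  open IntegerCoefficients R

  record Fraction : Set (c ⊔ p) where
    constructor _/_[_]
    field
      num den : Carrier
      den∈S   : S den
  open Fraction public

  infix 4 _≃_
  record _≃_ (a b : Fraction) : Set ℓ where
    constructor mk≃
    field cross : num a * den b ≈ num b * den a
  open _≃_ public

  module _ (S-1 : S 1#) (S-* : ∀ {s t} → S s → S t → S (s * t))
           (S-cancel : ∀ {s x y} → S s → s * x ≈ s * y → x ≈ y) where

    private
      _⊕_ _⊗_ : Fraction → Fraction → Fraction
      (a / s [ h ]) ⊕ (b / t [ k ]) = (a * t + b * s) / (s * t) [ S-* h k ]
      (a / s [ h ]) ⊗ (b / t [ k ]) = (a * b) / (s * t) [ S-* h k ]

      ⊖_ : Fraction → Fraction
      ⊖ (a / s [ h ]) = (- a) / s [ h ]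

      -- Plain cross multiplication is transitive because elements of S can be cancelled, so
      -- equality of fractions carries no auxiliary multiplier.
      ≃-trans : ∀ {a b c} → a ≃ b → b ≃ c → a ≃ c
      ≃-trans {a / s [ _ ]} {b / t [ h ]} {c / u [ _ ]} (mk≃ e) (mk≃ f) = mk≃ (S-cancel h (begin
        t * (a * u)    ≈⟨ solve 3 (λ t a u → t :* (a :* u) := a :* t :* u) refl t a u ⟩
        a * t * u      ≈⟨ *-congʳ e ⟩
        b * s * u      ≈⟨ solve 3 (λ b s u → b :* s :* u := b :* u :* s) refl b s u ⟩
        b * u * s      ≈⟨ *-congʳ f ⟩
        c * t * s      ≈⟨ solve 3 (λ c t s → c :* t :* s := t :* (c :* s)) refl c t s ⟩
        t * (c * s)    ∎))
        where open import Relation.Binary.Reasoning.Setoid setoid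

      ⊕-cong : ∀ {a a′ b b′} → a ≃ a′ → b ≃ b′ → (a ⊕ b) ≃ (a′ ⊕ b′)
      ⊕-cong {a / s [ _ ]} {a′ / s′ [ _ ]} {b / t [ _ ]} {b′ / t′ [ _ ]} (mk≃ e) (mk≃ f) = mk≃ (begin
        (a * t + b * s) * (s′ * t′)
          ≈⟨ solve 6 (λ a b s t s′ t′ → (a :* t :+ b :* s) :* (s′ :* t′)
               := (a :* s′) :* (t :* t′) :+ (b :* t′) :* (s :* s′)) refl a b s t s′ t′ ⟩
        (a * s′) * (t * t′) + (b * t′) * (s * s′)
          ≈⟨ +-cong (*-congʳ e) (*-congʳ f) ⟩
        (a′ * s) * (t * t′) + (b′ * t) * (s * s′)
          ≈⟨ solve 6 (λ a b s t s′ t′ → (a :* s) :* (t :* t′) :+ (b :* t) :* (s :* s′)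
               := (a :* t′ :+ b :* s′) :* (s :* t)) refl a′ b′ s t s′ t′ ⟩
        (a′ * t′ + b′ * s′) * (s * t) ∎)
        where open import Relation.Binary.Reasoning.Setoid setoid

      ⊗-cong : ∀ {a a′ b b′} → a ≃ a′ → b ≃ b′ → (a ⊗ b) ≃ (a′ ⊗ b′)
      ⊗-cong {a / s [ _ ]} {a′ / s′ [ _ ]} {b / t [ _ ]} {b′ / t′ [ _ ]} (mk≃ e) (mk≃ f) = mk≃ (begin
        a * b * (s′ * t′)      ≈⟨ solve 4 (λ a b s t → a :* b :* (s :* t) := a :* s :* (b :* t)) refl a b s′ t′ ⟩
        a * s′ * (b * t′)      ≈⟨ *-cong e f ⟩
        a′ * s * (b′ * t)      ≈⟨ solve 4 (λ a b s t → a :* s :* (b :* t) := a :* b :* (s :* t)) refl a′ b′ s t ⟩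
        a′ * b′ * (s * t)      ∎)
        where open import Relation.Binary.Reasoning.Setoid setoid

      ⊖-cong : ∀ {a b} → a ≃ b → (⊖ a) ≃ (⊖ b)
      ⊖-cong {a / s [ _ ]} {b / t [ _ ]} (mk≃ e) = mk≃
        (trans (sym (-‿distribˡ-* a t)) (trans (-‿cong e) (-‿distribˡ-* b s)))
        where open import Algebra.Properties.Ring ring

    fractionRing : CommutativeRing (c ⊔ p) ℓ
    fractionRing = record
      { Carrier = Fraction ; _≈_ = _≃_ ; _+_ = _⊕_ ; _*_ = _⊗_ ; -_ = ⊖_
      ; 0# = 0# / 1# [ S-1 ] ; 1# = 1# / 1# [ S-1 ]
      ; isCommutativeRing = record
        { isRing = record
          { +-isAbelianGroup = record
            { isGroup = record
              { isMonoid = record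
                { isSemigroup = record
                  { isMagma = record
                    { isEquivalence = record
                      { refl = mk≃ refl ; sym = λ e → mk≃ (sym (cross e)) ; trans = ≃-trans }
                    ; ∙-cong = ⊕-cong }
                  ; assoc = λ (a / s [ _ ]) (b / t [ _ ]) (c / u [ _ ]) → mk≃
                      (solve 6 (λ a b c s t u → ((a :* t :+ b :* s) :* u :+ c :* (s :* t)) :* (s :* (t :* u))
                        := (a :* (t :* u) :+ (b :* u :+ c :* t) :* s) :* (s :* t :* u)) refl a b c s t u) }
                ; identity =
                    (λ (a / s [ _ ]) → mk≃ (solve 2 (λ a s → (con 0ℤ :* s :+ a :* con 1ℤ) :* s
                      := a :* (con 1ℤ :* s)) refl a s))
                  , (λ (a / s [ _ ]) → mk≃ (solve 2 (λ a s → (a :* con 1ℤ :+ con 0ℤ :* s) :* s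
                      := a :* (s :* con 1ℤ)) refl a s)) }
              ; inverse =
                  (λ (a / s [ _ ]) → mk≃ (solve 2 (λ a s → (:- a :* s :+ a :* s) :* con 1ℤ
                    := con 0ℤ :* (s :* s)) refl a s))
                , (λ (a / s [ _ ]) → mk≃ (solve 2 (λ a s → (a :* s :+ :- a :* s) :* con 1ℤ
                    := con 0ℤ :* (s :* s)) refl a s))
              ; ⁻¹-cong = ⊖-cong }
            ; comm = λ (a / s [ _ ]) (b / t [ _ ]) → mk≃
                (solve 4 (λ a b s t → (a :* t :+ b :* s) :* (t :* s) := (b :* s :+ a :* t) :* (s :* t)) refl a b s t) }
          ; *-cong = ⊗-cong
          ; *-assoc = λ (a / s [ _ ]) (b / t [ _ ]) (c / u [ _ ]) → mk≃
              (solve 6 (λ a b c s t u → a :* b :* c :* (s :* (t :* u)) := a :* (b :* c) :* (s :* t :* u)) refl a b c s t u)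
          ; *-identity =
              (λ (a / s [ _ ]) → mk≃ (solve 2 (λ a s → con 1ℤ :* a :* s := a :* (con 1ℤ :* s)) refl a s))
            , (λ (a / s [ _ ]) → mk≃ (solve 2 (λ a s → a :* con 1ℤ :* s := a :* (s :* con 1ℤ)) refl a s))
          ; distrib =
              (λ (a / s [ _ ]) (b / t [ _ ]) (c / u [ _ ]) → mk≃
                (solve 6 (λ a b c s t u → a :* (b :* u :+ c :* t) :* (s :* t :* (s :* u))
                  := (a :* b :* (s :* u) :+ a :* c :* (s :* t)) :* (s :* (t :* u))) refl a b c s t u))
            , (λ (a / s [ _ ]) (b / t [ _ ]) (c / u [ _ ]) → mk≃
                (solve 6 (λ a b c s t u → (b :* u :+ c :* t) :* a :* (t :* s :* (u :* s))
                  := (b :* a :* (u :* s) :+ c :* a :* (t :* s)) :* (t :* u :* s)) refl a b c s t u)) }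
        ; *-comm = λ (a / s [ _ ]) (b / t [ _ ]) → mk≃
            (solve 4 (λ a b s t → a :* b :* (t :* s) := b :* a :* (s :* t)) refl a b s t) } }

-- The sum over one block

module WellPoisedBlock {c ℓ} (R : CommutativeRing c ℓ) (a Q t : CommutativeRing.Carrier R)
  (N : ℕ) (inv : ℕ → CommutativeRing.Carrier R) where
  open CommutativeRing R
  open Exp semiring using (_^_)
  open import Relation.Binary.Reasoning.Setoid setoid
  open RingSums R
  open IntegerCoefficients R

  private
    :1 : ∀ {n} → Polynomial n
    :1 = con 1ℤ

  y v : Carrier
  y = a * Q ^ N
  v = 1# + 1# - y

  σ τ : ℕ → Carrier
  σ j = (1# - a * Q ^ j) * inv j
  τ k = ∏ k (λ j → t * σ j ^ 4)

  τ≈ : ∀ k → τ k ≈ ∏ k σ ^ 4 * t ^ k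
  τ≈ zero    = solve 0 (:1 := :1 :* (:1 :* (:1 :* (:1 :* :1))) :* :1) refl
  τ≈ (suc k) = trans (*-congʳ (τ≈ k))
    (solve 4 (λ p s t x → p :* (p :* (p :* (p :* :1))) :* x :* (t :* (s :* (s :* (s :* (s :* :1)))))
      := p :* s :* (p :* s :* (p :* s :* (p :* s :* :1))) :* (t :* x)) refl (∏ k σ) (σ k) t (t ^ k))

  -- To be read with ω the inverse of 1 - q coming from the q-integer, and C the value of (q;q^d)_h
  -- / (q^d;q^d)_h at the start h of the block: the block is ω C⁴ times a fixed one.
  block-term : ∀ {e ω z x} k → e ≈ ω * z → x ≈ t ^ k → ∀ C →
    e * (C * ∏ k σ) ^ 4 * x ≈ ω * C ^ 4 * (z * τ k)
  block-term {e} {ω} {z} {x} k e≈ x≈ C = begin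
    e * (C * ∏ k σ) ^ 4 * x
      ≈⟨ *-cong (*-congʳ e≈) x≈ ⟩
    ω * z * (C * ∏ k σ) ^ 4 * t ^ k
      ≈⟨ solve 5 (λ w z c p x → w :* z :* (c :* p :* (c :* p :* (c :* p :* (c :* p :* :1)))) :* x
           := w :* (c :* (c :* (c :* (c :* :1)))) :* (z :* (p :* (p :* (p :* (p :* :1))) :* x))) refl ω z C (∏ k σ) (t ^ k) ⟩
    ω * C ^ 4 * (z * (∏ k σ ^ 4 * t ^ k))
      ≈⟨ *-congˡ (*-congˡ (sym (τ≈ k))) ⟩
    ω * C ^ 4 * (z * τ k) ∎

  module _ (taa : t * a * a ≈ Q) (inv-correct : ∀ k → k ℕ.< N → (1# - Q * Q ^ k) * inv k ≈ 1#)
    (1≤N : 1 ℕ.≤ N) (y≈1 : (1# - y) * (1# - y) ≈ 0#)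
    (i : ℕ) (i<N : i ℕ.< N) (zero-factor : (1# - y) * (1# - Q ^ N * (Q * Q ^ i)) ≈ 0#) where

    private
      yv : y * v ≈ 1#
      yv = begin
        y * v                      ≈⟨ solve 1 (λ y → y :* (:1 :+ :1 :- y) := :1 :- (:1 :- y) :* (:1 :- y)) refl y ⟩
        1# - (1# - y) * (1# - y)   ≈⟨ +-congˡ (-‿cong y≈1) ⟩
        1# - 0#                    ≈⟨ solve 0 (:1 :- con 0ℤ := :1) refl ⟩
        1#                         ∎

      y+v : y + v ≈ 1# + 1#
      y+v = solve 1 (λ y → y :+ (:1 :+ :1 :- y) := :1 :+ :1) refl y

      vanishing : (1# - y) * ∏ N (λ i → 1# - Q ^ N * v * v * (Q * Q ^ i)) ≈ 0#
      vanishing = begin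
        (1# - y) * ∏ N (λ i → 1# - Q ^ N * v * v * (Q * Q ^ i))
          ≈⟨ *-congˡ (proj₂ split) ⟩
        (1# - y) * ((1# - Q ^ N * v * v * (Q * Q ^ i)) * proj₁ split)
          -- Since v = 1 + (1 - y), v² differs from 1 by a multiple of 1 - y; multiplied by 1 - y
          -- this difference dies with (1 - y)², so v² may be replaced by 1.
          ≈⟨ solve 4 (λ y p s x → (:1 :- y) :* ((:1 :- p :* (:1 :+ :1 :- y) :* (:1 :+ :1 :- y) :* s) :* x)
               := ((:1 :- y) :* (:1 :- p :* s)
                   :- (:1 :- y) :* (:1 :- y) :* (p :* s :* (:1 :+ :1 :+ (:1 :- y)))) :* x)
               refl y (Q ^ N) (Q * Q ^ i) (proj₁ split) ⟩
        ((1# - y) * (1# - Q ^ N * (Q * Q ^ i)) - (1# - y) * (1# - y) * (Q ^ N * (Q * Q ^ i) * (1# + 1# + (1# - y)))) * proj₁ split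
          ≈⟨ *-congʳ (+-cong zero-factor (-‿cong (*-congʳ y≈1))) ⟩
        (0# - 0# * (Q ^ N * (Q * Q ^ i) * (1# + 1# + (1# - y)))) * proj₁ split
          ≈⟨ solve 2 (λ x y → (con 0ℤ :- con 0ℤ :* x) :* y := con 0ℤ) refl _ _ ⟩
        0# ∎
        where
        split : ∃ λ x → ∏ N (λ i → 1# - Q ^ N * v * v * (Q * Q ^ i)) ≈ (1# - Q ^ N * v * v * (Q * Q ^ i)) * x
        split = ∏-factor N i i<N refl

    -- `σ N ^ 4` contains (1 - y)⁴, which is zero whatever the value of `inv N`. So a full block
    -- reduces to its terms up to N, the range of the terminating sum.
    τ-vanishing : ∀ {k} → N ℕ.< k → τ k ≈ 0#
    τ-vanishing {k} N<k = ∏-zero k N N<k (begin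
      t * σ N ^ 4
        ≈⟨ solve 3 (λ t x i → let s = x :* i in t :* (s :* (s :* (s :* (s :* :1))))
             := x :* x :* (t :* x :* x :* i :* i :* i :* i)) refl t (1# - y) (inv N) ⟩
      (1# - y) * (1# - y) * (t * (1# - y) * (1# - y) * inv N * inv N * inv N * inv N)
        ≈⟨ trans (*-congʳ y≈1) (zeroˡ _) ⟩
      0# ∎)

    block-sum : ∀ C m → N ℕ.< m → ∑ m (λ k → C * ((1# - a * Q ^ k * Q ^ k) * τ k)) ≈ 0#
    block-sum C (suc m) (s≤s N≤m) with ℕ.m≤n⇒m<n∨m≡n N≤m
    ... | inj₁ N<m = begin
      ∑ m (λ k → C * ((1# - a * Q ^ k * Q ^ k) * τ k)) + C * ((1# - a * Q ^ m * Q ^ m) * τ m)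
        ≈⟨ +-cong (block-sum C m N<m) (*-congˡ (*-congˡ (τ-vanishing N<m))) ⟩
      0# + C * ((1# - a * Q ^ m * Q ^ m) * 0#)
        ≈⟨ solve 2 (λ C x → con 0ℤ :+ C :* (x :* con 0ℤ) := con 0ℤ) refl _ _ ⟩
      0# ∎
    ... | inj₂ ≡.refl = trans (sym (*-∑ C (suc m) _)) (trans
      (*-congˡ (WellPoised.wellPoised-sum R a Q t y v N inv refl yv y+v taa inv-correct 1≤N vanishing))
      (zeroʳ C))

-- The ring ℤ[q] of coefficient lists

open import Defs

-- A record, unlike the function type _≈_, lets Agda infer p and r.
infix 4 _≋_
record _≋_ (p r : Poly) : Set where
  constructor mk≋
  field at : p ≈ r
open _≋_ public

≋-isEquivalence : IsEquivalence _≋_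
≋-isEquivalence = record
  { refl  = mk≋ λ _ → ≡.refl
  ; sym   = λ e → mk≋ λ i → ≡.sym (at e i)
  ; trans = λ e f → mk≋ λ i → ≡.trans (at e i) (at f i) }

≋-setoid : Setoid 0ℓ 0ℓ
≋-setoid = record { isEquivalence = ≋-isEquivalence }

open IsEquivalence ≋-isEquivalence public
  using () renaming (refl to ≋-refl; sym to ≋-sym; trans to ≋-trans)

∷-cong : ∀ {a b p r} → a ≡ b → p ≋ r → (a ∷ p) ≋ (b ∷ r)
∷-cong e f = mk≋ λ { zero → e ; (suc i) → at f i }

tail-≋ : ∀ {a b p r} → (a ∷ p) ≋ (b ∷ r) → p ≋ r
tail-≋ e = mk≋ λ i → at e (suc i)

0∷[]≋0 : (0ℤ ∷ []) ≋ []
0∷[]≋0 = mk≋ λ { zero → ≡.refl ; (suc i) → ≡.refl }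

coeff-+ : ∀ p r i → coeff (p +ₚ r) i ≡ coeff p i ℤ.+ coeff r i
coeff-+ []      r       i       = ≡.sym (ℤ.+-identityˡ _)
coeff-+ (a ∷ p) []      zero    = ≡.sym (ℤ.+-identityʳ _)
coeff-+ (a ∷ p) []      (suc i) = ≡.sym (ℤ.+-identityʳ _)
coeff-+ (a ∷ p) (b ∷ r) zero    = ≡.refl
coeff-+ (a ∷ p) (b ∷ r) (suc i) = coeff-+ p r i

coeff-neg : ∀ p i → coeff (negₚ p) i ≡ ℤ.- coeff p i
coeff-neg []      i       = ≡.refl
coeff-neg (a ∷ p) zero    = ≡.refl
coeff-neg (a ∷ p) (suc i) = coeff-neg p i

coeff-scale : ∀ c p i → coeff (scaleₚ c p) i ≡ c ℤ.* coeff p i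
coeff-scale c []      i       = ≡.sym (ℤ.*-zeroʳ c)
coeff-scale c (a ∷ p) zero    = ≡.refl
coeff-scale c (a ∷ p) (suc i) = coeff-scale c p i

+ₚ-cong : ∀ {p p′ r r′} → p ≋ p′ → r ≋ r′ → (p +ₚ r) ≋ (p′ +ₚ r′)
+ₚ-cong {p} {p′} {r} {r′} e f = mk≋ λ i → ≡.trans (coeff-+ p r i)
  (≡.trans (cong₂ ℤ._+_ (at e i) (at f i)) (≡.sym (coeff-+ p′ r′ i)))

negₚ-cong : ∀ {p r} → p ≋ r → negₚ p ≋ negₚ r
negₚ-cong {p} {r} e = mk≋ λ i → ≡.trans (coeff-neg p i)
  (≡.trans (cong ℤ.-_ (at e i)) (≡.sym (coeff-neg r i)))

scale-cong : ∀ {c c′ p r} → c ≡ c′ → p ≋ r → scaleₚ c p ≋ scaleₚ c′ r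
scale-cong {c} {c′} {p} {r} e f = mk≋ λ i → ≡.trans (coeff-scale c p i)
  (≡.trans (cong₂ ℤ._*_ e (at f i)) (≡.sym (coeff-scale c′ r i)))

+ₚ-assoc : ∀ p r s → ((p +ₚ r) +ₚ s) ≋ (p +ₚ (r +ₚ s))
+ₚ-assoc p r s = mk≋ λ i → begin
  coeff ((p +ₚ r) +ₚ s) i                    ≡⟨ coeff-+ (p +ₚ r) s i ⟩
  coeff (p +ₚ r) i ℤ.+ coeff s i             ≡⟨ cong (ℤ._+ coeff s i) (coeff-+ p r i) ⟩
  coeff p i ℤ.+ coeff r i ℤ.+ coeff s i      ≡⟨ ℤ.+-assoc (coeff p i) (coeff r i) (coeff s i) ⟩
  coeff p i ℤ.+ (coeff r i ℤ.+ coeff s i)    ≡⟨ cong (ℤ._+_ (coeff p i)) (coeff-+ r s i) ⟨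
  coeff p i ℤ.+ coeff (r +ₚ s) i             ≡⟨ coeff-+ p (r +ₚ s) i ⟨
  coeff (p +ₚ (r +ₚ s)) i                    ∎
  where open ≡.≡-Reasoning

+ₚ-comm : ∀ p r → (p +ₚ r) ≋ (r +ₚ p)
+ₚ-comm p r = mk≋ λ i → ≡.trans (coeff-+ p r i)
  (≡.trans (ℤ.+-comm (coeff p i) (coeff r i)) (≡.sym (coeff-+ r p i)))

+ₚ-identityˡ : ∀ p → (0ₚ +ₚ p) ≋ p
+ₚ-identityˡ p = ≋-refl

+ₚ-identityʳ : ∀ p → (p +ₚ 0ₚ) ≋ p
+ₚ-identityʳ p = +ₚ-comm p 0ₚ

negₚ-inverseʳ : ∀ p → (p +ₚ negₚ p) ≋ 0ₚ
negₚ-inverseʳ p = mk≋ λ i → ≡.trans (coeff-+ p (negₚ p) i)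
  (≡.trans (cong (ℤ._+_ (coeff p i)) (coeff-neg p i)) (ℤ.+-inverseʳ (coeff p i)))

negₚ-inverseˡ : ∀ p → (negₚ p +ₚ p) ≋ 0ₚ
negₚ-inverseˡ p = ≋-trans (+ₚ-comm (negₚ p) p) (negₚ-inverseʳ p)

scale-+ : ∀ c p r → scaleₚ c (p +ₚ r) ≋ (scaleₚ c p +ₚ scaleₚ c r)
scale-+ c p r = mk≋ λ i → begin
  coeff (scaleₚ c (p +ₚ r)) i                      ≡⟨ coeff-scale c (p +ₚ r) i ⟩
  c ℤ.* coeff (p +ₚ r) i                           ≡⟨ cong (ℤ._*_ c) (coeff-+ p r i) ⟩
  c ℤ.* (coeff p i ℤ.+ coeff r i)                  ≡⟨ ℤ.*-distribˡ-+ c (coeff p i) (coeff r i) ⟩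
  c ℤ.* coeff p i ℤ.+ c ℤ.* coeff r i              ≡⟨ cong₂ ℤ._+_ (coeff-scale c p i) (coeff-scale c r i) ⟨
  coeff (scaleₚ c p) i ℤ.+ coeff (scaleₚ c r) i    ≡⟨ coeff-+ (scaleₚ c p) (scaleₚ c r) i ⟨
  coeff (scaleₚ c p +ₚ scaleₚ c r) i               ∎
  where open ≡.≡-Reasoning

+-scale : ∀ b c p → scaleₚ (b ℤ.+ c) p ≋ (scaleₚ b p +ₚ scaleₚ c p)
+-scale b c p = mk≋ λ i → begin
  coeff (scaleₚ (b ℤ.+ c) p) i                     ≡⟨ coeff-scale (b ℤ.+ c) p i ⟩
  (b ℤ.+ c) ℤ.* coeff p i                          ≡⟨ ℤ.*-distribʳ-+ (coeff p i) b c ⟩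
  b ℤ.* coeff p i ℤ.+ c ℤ.* coeff p i              ≡⟨ cong₂ ℤ._+_ (coeff-scale b p i) (coeff-scale c p i) ⟨
  coeff (scaleₚ b p) i ℤ.+ coeff (scaleₚ c p) i    ≡⟨ coeff-+ (scaleₚ b p) (scaleₚ c p) i ⟨
  coeff (scaleₚ b p +ₚ scaleₚ c p) i               ∎
  where open ≡.≡-Reasoning

scale-scale : ∀ b c p → scaleₚ b (scaleₚ c p) ≋ scaleₚ (b ℤ.* c) p
scale-scale b c p = mk≋ λ i → begin
  coeff (scaleₚ b (scaleₚ c p)) i   ≡⟨ coeff-scale b (scaleₚ c p) i ⟩
  b ℤ.* coeff (scaleₚ c p) i        ≡⟨ cong (ℤ._*_ b) (coeff-scale c p i) ⟩
  b ℤ.* (c ℤ.* coeff p i)           ≡⟨ ℤ.*-assoc b c (coeff p i) ⟨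
  b ℤ.* c ℤ.* coeff p i             ≡⟨ coeff-scale (b ℤ.* c) p i ⟨
  coeff (scaleₚ (b ℤ.* c) p) i      ∎
  where open ≡.≡-Reasoning

scale-1 : ∀ p → scaleₚ 1ℤ p ≋ p
scale-1 p = mk≋ λ i → ≡.trans (coeff-scale 1ℤ p i) (ℤ.*-identityˡ (coeff p i))

scale-0 : ∀ p → scaleₚ 0ℤ p ≋ 0ₚ
scale-0 p = mk≋ λ i → coeff-scale 0ℤ p i

+ₚ-interchange : ∀ p r s t → ((p +ₚ r) +ₚ (s +ₚ t)) ≋ ((p +ₚ s) +ₚ (r +ₚ t))
+ₚ-interchange p r s t = begin
  (p +ₚ r) +ₚ (s +ₚ t)    ≈⟨ +ₚ-assoc p r (s +ₚ t) ⟩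
  p +ₚ (r +ₚ (s +ₚ t))    ≈⟨ +ₚ-cong (≋-refl {p}) (≋-sym (+ₚ-assoc r s t)) ⟩
  p +ₚ ((r +ₚ s) +ₚ t)    ≈⟨ +ₚ-cong (≋-refl {p}) (+ₚ-cong (+ₚ-comm r s) (≋-refl {t})) ⟩
  p +ₚ ((s +ₚ r) +ₚ t)    ≈⟨ +ₚ-cong (≋-refl {p}) (+ₚ-assoc s r t) ⟩
  p +ₚ (s +ₚ (r +ₚ t))    ≈⟨ +ₚ-assoc p s (r +ₚ t) ⟨
  (p +ₚ s) +ₚ (r +ₚ t)    ∎
  where open Relation.Binary.Reasoning.Setoid ≋-setoid

*ₚ-congˡ : ∀ p {r s} → r ≋ s → (p *ₚ r) ≋ (p *ₚ s)
*ₚ-congˡ []      e = ≋-refl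
*ₚ-congˡ (a ∷ p) e = +ₚ-cong (scale-cong ≡.refl e) (∷-cong ≡.refl (*ₚ-congˡ p e))

*ₚ-zeroʳ : ∀ p → (p *ₚ 0ₚ) ≋ 0ₚ
*ₚ-zeroʳ []      = ≋-refl
*ₚ-zeroʳ (a ∷ p) = ≋-trans (∷-cong ≡.refl (*ₚ-zeroʳ p)) 0∷[]≋0

*ₚ-∷ʳ : ∀ p b r → (p *ₚ (b ∷ r)) ≋ (scaleₚ b p +ₚ (0ℤ ∷ (p *ₚ r)))
*ₚ-∷ʳ []      b r = ≋-sym 0∷[]≋0
*ₚ-∷ʳ (a ∷ p) b r = ∷-cong (cong (ℤ._+ 0ℤ) (ℤ.*-comm a b)) (begin
  scaleₚ a r +ₚ (p *ₚ (b ∷ r))                      ≈⟨ +ₚ-cong (≋-refl {scaleₚ a r}) (*ₚ-∷ʳ p b r) ⟩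
  scaleₚ a r +ₚ (scaleₚ b p +ₚ (0ℤ ∷ (p *ₚ r)))     ≈⟨ +ₚ-assoc (scaleₚ a r) (scaleₚ b p) _ ⟨
  (scaleₚ a r +ₚ scaleₚ b p) +ₚ (0ℤ ∷ (p *ₚ r))     ≈⟨ +ₚ-cong (+ₚ-comm (scaleₚ a r) (scaleₚ b p)) ≋-refl ⟩
  (scaleₚ b p +ₚ scaleₚ a r) +ₚ (0ℤ ∷ (p *ₚ r))     ≈⟨ +ₚ-assoc (scaleₚ b p) (scaleₚ a r) _ ⟩
  scaleₚ b p +ₚ (scaleₚ a r +ₚ (0ℤ ∷ (p *ₚ r)))     ∎)
  where open Relation.Binary.Reasoning.Setoid ≋-setoid

*ₚ-comm : ∀ p r → (p *ₚ r) ≋ (r *ₚ p)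
*ₚ-comm []      r = ≋-sym (*ₚ-zeroʳ r)
*ₚ-comm (a ∷ p) r = ≋-trans
  (+ₚ-cong (≋-refl {scaleₚ a r}) (∷-cong ≡.refl (*ₚ-comm p r))) (≋-sym (*ₚ-∷ʳ r a p))

*ₚ-cong : ∀ {p p′ r r′} → p ≋ p′ → r ≋ r′ → (p *ₚ r) ≋ (p′ *ₚ r′)
*ₚ-cong {p} {p′} {r} {r′} e f = ≋-trans (*ₚ-congˡ p f)
  (≋-trans (*ₚ-comm p r′) (≋-trans (*ₚ-congˡ r′ e) (*ₚ-comm r′ p′)))

*ₚ-distribˡ : ∀ p r s → (p *ₚ (r +ₚ s)) ≋ ((p *ₚ r) +ₚ (p *ₚ s))
*ₚ-distribˡ []      r s = ≋-refl
*ₚ-distribˡ (a ∷ p) r s = ≋-trans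
  (+ₚ-cong (scale-+ a r s) (∷-cong ≡.refl (*ₚ-distribˡ p r s)))
  (+ₚ-interchange (scaleₚ a r) (scaleₚ a s) (0ℤ ∷ (p *ₚ r)) (0ℤ ∷ (p *ₚ s)))

*ₚ-distribʳ : ∀ s p r → ((p +ₚ r) *ₚ s) ≋ ((p *ₚ s) +ₚ (r *ₚ s))
*ₚ-distribʳ s p r = ≋-trans (*ₚ-comm (p +ₚ r) s)
  (≋-trans (*ₚ-distribˡ s p r) (+ₚ-cong (*ₚ-comm s p) (*ₚ-comm s r)))

scale-* : ∀ c p r → (scaleₚ c p *ₚ r) ≋ scaleₚ c (p *ₚ r)
scale-* c []      r = ≋-refl
scale-* c (a ∷ p) r = ≋-sym (≋-trans (scale-+ c (scaleₚ a r) (0ℤ ∷ (p *ₚ r)))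
  (+ₚ-cong (scale-scale c a r) (∷-cong (ℤ.*-zeroʳ c) (≋-sym (scale-* c p r)))))

0∷-* : ∀ p r → ((0ℤ ∷ p) *ₚ r) ≋ (0ℤ ∷ (p *ₚ r))
0∷-* p r = +ₚ-cong (scale-0 r) ≋-refl

*ₚ-assoc : ∀ p r s → ((p *ₚ r) *ₚ s) ≋ (p *ₚ (r *ₚ s))
*ₚ-assoc []      r s = ≋-refl
*ₚ-assoc (a ∷ p) r s = ≋-trans (*ₚ-distribʳ s (scaleₚ a r) (0ℤ ∷ (p *ₚ r)))
  (+ₚ-cong (scale-* a r s) (≋-trans (0∷-* (p *ₚ r) s) (∷-cong ≡.refl (*ₚ-assoc p r s))))

*ₚ-identityˡ : ∀ p → (1ₚ *ₚ p) ≋ p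
*ₚ-identityˡ p = ≋-trans (+ₚ-cong (scale-1 p) 0∷[]≋0) (+ₚ-identityʳ p)

ℤ[q] : CommutativeRing 0ℓ 0ℓ
ℤ[q] = record
  { Carrier = Poly ; _≈_ = _≋_ ; _+_ = _+ₚ_ ; _*_ = _*ₚ_ ; -_ = negₚ ; 0# = 0ₚ ; 1# = 1ₚ
  ; isCommutativeRing = record
    { isRing = record
      { +-isAbelianGroup = record
        { isGroup = record
          { isMonoid = record
            { isSemigroup = record
              { isMagma = record { isEquivalence = ≋-isEquivalence ; ∙-cong = +ₚ-cong }
              ; assoc = +ₚ-assoc }
            ; identity = +ₚ-identityˡ , +ₚ-identityʳ }
          ; inverse = negₚ-inverseˡ , negₚ-inverseʳ
          ; ⁻¹-cong = negₚ-cong }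
        ; comm = +ₚ-comm }
      ; *-cong = *ₚ-cong
      ; *-assoc = *ₚ-assoc
      ; *-identity = *ₚ-identityˡ , λ p → ≋-trans (*ₚ-comm p 1ₚ) (*ₚ-identityˡ p)
      ; distrib = *ₚ-distribˡ , *ₚ-distribʳ }
    ; *-comm = *ₚ-comm } }

open CommutativeRing ℤ[q] public using ()
  renaming ( reflexive to ≋-reflexive; *-identityʳ to *ₚ-identityʳ; +-congˡ to +ₚ-congˡ
           ; +-congʳ to +ₚ-congʳ; *-congʳ to *ₚ-congʳ; -‿inverseʳ to -ₚ-inverseʳ)

module PolySolver = IntegerCoefficients ℤ[q]
module ≋-Reasoning = Relation.Binary.Reasoning.Setoid ≋-setoid
open PolySolver
open ≋-Reasoning

-- Divisibility in ℤ[q] and invertible constant coefficients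

infixr 4 _,_
infix 4 _divides_
record _divides_ (p r : Poly) : Set where
  constructor _,_
  field
    quotient  : Poly
    quotient* : (quotient *ₚ p) ≋ r

divides-resp : ∀ {p r s} → r ≋ s → p divides r → p divides s
divides-resp e (x , f) = x , ≋-trans f e

const : ℤ → Poly
const c = c ∷ []

const-* : ∀ c p → (const c *ₚ p) ≋ scaleₚ c p
const-* c p = ≋-trans (+ₚ-congˡ 0∷[]≋0) (+ₚ-identityʳ (scaleₚ c p))

const-homo-* : ∀ b c → (const b *ₚ const c) ≋ const (b ℤ.* c)
const-homo-* b c = const-* b (const c)

X : Poly
X = X^ 1

X-* : ∀ p → (X *ₚ p) ≋ (0ℤ ∷ p)
X-* p = ≋-trans (0∷-* 1ₚ p) (∷-cong ≡.refl (*ₚ-identityˡ p))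

coeff₀-* : ∀ p r → coeff (p *ₚ r) 0 ≡ coeff p 0 ℤ.* coeff r 0
coeff₀-* []      r = ≡.refl
coeff₀-* (a ∷ p) r = ≡.trans (coeff-+ (scaleₚ a r) (0ℤ ∷ (p *ₚ r)) 0)
  (≡.trans (ℤ.+-identityʳ _) (coeff-scale a r 0))

nonZero-* : ∀ {b c} → b ≢ 0ℤ → c ≢ 0ℤ → b ℤ.* c ≢ 0ℤ
nonZero-* {b} b≢0 c≢0 e = Sum.[ b≢0 , c≢0 ] (ℤ.i*j≡0⇒i≡0∨j≡0 b e)

scale-cancel : ∀ {c p r} → c ≢ 0ℤ → scaleₚ c p ≋ scaleₚ c r → p ≋ r
scale-cancel {c} {p} {r} c≢0 e = mk≋ λ i →
  ℤ.*-cancelˡ-≡ c (coeff p i) (coeff r i) ⦃ ℤ.≢-nonZero c≢0 ⦄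
    (≡.trans (≡.sym (coeff-scale c p i)) (≡.trans (at e i) (coeff-scale c r i)))

-ₚ-zero⇒≋ : ∀ {p r} → (p -ₚ r) ≋ 0ₚ → p ≋ r
-ₚ-zero⇒≋ {p} {r} e = ≋-trans (solve 2 (λ p r → p := (p :- r) :+ r) ≋-refl p r) (+ₚ-congʳ e)

tail : Poly → Poly
tail []      = []
tail (_ ∷ p) = p

0∷-scale : ∀ {c p} r → (0ℤ ∷ p) ≋ scaleₚ c r → p ≋ scaleₚ c (tail r)
0∷-scale []      e = mk≋ λ i → at e (suc i)
0∷-scale (_ ∷ r) e = tail-≋ e

-- Polynomials with invertible constant coefficient: invertible as power series,
-- so that quotients by them can be computed coefficient by coefficient.

record Unit₀ (p : Poly) : Set where
  constructor _,_
  field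
    inverse  : ℤ
    inverse* : inverse ℤ.* coeff p 0 ≡ 1ℤ

Unit₀-resp : ∀ {p r} → p ≋ r → Unit₀ p → Unit₀ r
Unit₀-resp e (z , h) = z , ≡.trans (cong (z ℤ.*_) (≡.sym (at e 0))) h

Unit₀-divisor : ∀ {p r} → p divides r → Unit₀ r → Unit₀ p
Unit₀-divisor {p} (s , e) (z , h) = z ℤ.* coeff s 0 ,
  ≡.trans (ℤ.*-assoc z (coeff s 0) (coeff p 0))
    (≡.trans (cong (z ℤ.*_) (≡.trans (≡.sym (coeff₀-* s p)) (at e 0))) h)

Unit₀-* : ∀ {p r} → Unit₀ p → Unit₀ r → Unit₀ (p *ₚ r)
Unit₀-* {p} {r} (y , h) (z , k) = z ℤ.* y , (E.begin
  z ℤ.* y ℤ.* coeff (p *ₚ r) 0                 E.≡⟨ cong (z ℤ.* y ℤ.*_) (coeff₀-* p r) ⟩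
  z ℤ.* y ℤ.* (coeff p 0 ℤ.* coeff r 0)        E.≡⟨ ℤ.*-assoc z y _ ⟩
  z ℤ.* (y ℤ.* (coeff p 0 ℤ.* coeff r 0))      E.≡⟨ cong (z ℤ.*_) (≡.sym (ℤ.*-assoc y (coeff p 0) _)) ⟩
  z ℤ.* (y ℤ.* coeff p 0 ℤ.* coeff r 0)        E.≡⟨ cong (λ w → z ℤ.* (w ℤ.* coeff r 0)) h ⟩
  z ℤ.* (1ℤ ℤ.* coeff r 0)                     E.≡⟨ cong (z ℤ.*_) (ℤ.*-identityˡ _) ⟩
  z ℤ.* coeff r 0                              E.≡⟨ k ⟩
  1ℤ                                           E.∎)
  where module E = ≡.≡-Reasoning

Unit₀-1 : Unit₀ 1ₚ
Unit₀-1 = 1ℤ , ≡.refl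

-- Power series division: the constant coefficient b of y is z times that of p y, hence a multiple
-- of c; subtracting b p and dividing by q leaves the same situation for the tail of y. The case c =
-- 0 says that p is not a zero divisor.
scale∣*⇒scale∣ : ∀ {c p} → Unit₀ p → ∀ y x → (p *ₚ y) ≋ scaleₚ c x → ∃ λ y′ → y ≋ scaleₚ c y′
scale∣*⇒scale∣ u [] x e = [] , ≋-refl
scale∣*⇒scale∣ {c} {p} u@(z , h) (b ∷ y) x e =
  let y′ , f = scale∣*⇒scale∣ u y (tail x′) (0∷-scale x′ rest) in (b′ ∷ y′) , ∷-cong b≡cb′ f
  where
  module E = ≡.≡-Reasoning
  b′ = z ℤ.* coeff x 0
  x′ = x -ₚ scaleₚ b′ p
  b≡cb′ : b ≡ c ℤ.* b′
  b≡cb′ = E.begin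
    b                              E.≡⟨ ≡.sym (ℤ.*-identityˡ b) ⟩
    1ℤ ℤ.* b                       E.≡⟨ cong (ℤ._* b) (≡.sym h) ⟩
    z ℤ.* coeff p 0 ℤ.* b          E.≡⟨ ℤ.*-assoc z (coeff p 0) b ⟩
    z ℤ.* (coeff p 0 ℤ.* b)        E.≡⟨ cong (z ℤ.*_) (≡.sym (coeff₀-* p (b ∷ y))) ⟩
    z ℤ.* coeff (p *ₚ (b ∷ y)) 0   E.≡⟨ cong (z ℤ.*_) (at e 0) ⟩
    z ℤ.* coeff (scaleₚ c x) 0     E.≡⟨ cong (z ℤ.*_) (coeff-scale c x 0) ⟩
    z ℤ.* (c ℤ.* coeff x 0)        E.≡⟨ ≡.sym (ℤ.*-assoc z c _) ⟩
    z ℤ.* c ℤ.* coeff x 0          E.≡⟨ cong (ℤ._* coeff x 0) (ℤ.*-comm z c) ⟩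
    c ℤ.* z ℤ.* coeff x 0          E.≡⟨ ℤ.*-assoc c z _ ⟩
    c ℤ.* b′                       E.∎
  scb≋ : scaleₚ b p ≋ (const c *ₚ scaleₚ b′ p)
  scb≋ = ≋-trans (scale-cong b≡cb′ ≋-refl)
    (≋-trans (≋-sym (scale-scale c b′ p)) (≋-sym (const-* c (scaleₚ b′ p))))
  rest : (0ℤ ∷ (p *ₚ y)) ≋ scaleₚ c x′
  rest = begin
    0ℤ ∷ (p *ₚ y)
      ≈⟨ solve 2 (λ s t → t := (s :+ t) :- s) ≋-refl (scaleₚ b p) (0ℤ ∷ (p *ₚ y)) ⟩
    (scaleₚ b p +ₚ (0ℤ ∷ (p *ₚ y))) -ₚ scaleₚ b p
      ≈⟨ +ₚ-cong (≋-sym (*ₚ-∷ʳ p b y)) (negₚ-cong scb≋) ⟩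
    (p *ₚ (b ∷ y)) -ₚ (const c *ₚ scaleₚ b′ p)
      ≈⟨ +ₚ-congʳ (≋-trans e (≋-sym (const-* c x))) ⟩
    (const c *ₚ x) -ₚ (const c *ₚ scaleₚ b′ p)
      ≈⟨ solve 3 (λ c x s → c :* x :- c :* s := c :* (x :- s)) ≋-refl (const c) x (scaleₚ b′ p) ⟩
    const c *ₚ x′
      ≈⟨ const-* c x′ ⟩
    scaleₚ c x′ ∎

-- The passage from divisibility over ℚ to divisibility over ℤ: the constant c divides the quotient
-- too, and is cancelled.
divides-scale : ∀ {c p x} → Unit₀ p → c ≢ 0ℤ → p divides scaleₚ c x → p divides x
divides-scale {c} {p} {x} u c≢0 (y , e) =
  let y′ , f = scale∣*⇒scale∣ u y x (≋-trans (*ₚ-comm p y) e)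
  in y′ , scale-cancel c≢0 (≋-trans (≋-sym (scale-* c y′ p)) (≋-trans (*ₚ-congʳ (≋-sym f)) e))

*ₚ-cancelˡ : ∀ {p y z} → Unit₀ p → (p *ₚ y) ≋ (p *ₚ z) → y ≋ z
*ₚ-cancelˡ {p} {y} {z} u e =
  -- With c = 0, the difference is 0 times some polynomial.
  let _ , f = scale∣*⇒scale∣ {0ℤ} u (y -ₚ z) [] (begin
        p *ₚ (y -ₚ z)           ≈⟨ solve 3 (λ p y z → p :* (y :- z) := p :* y :- p :* z) ≋-refl p y z ⟩
        (p *ₚ y) -ₚ (p *ₚ z)    ≈⟨ +ₚ-congʳ e ⟩
        (p *ₚ z) -ₚ (p *ₚ z)    ≈⟨ -ₚ-inverseʳ (p *ₚ z) ⟩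
        0ₚ                      ∎)
  in -ₚ-zero⇒≋ (≋-trans f (scale-0 _))

divides-X* : ∀ {p r} → Unit₀ p → p divides (X *ₚ r) → p divides r
divides-X* {p} {r} (z , h) ([] , e) = [] , mk≋ λ i → at (≋-trans e (X-* r)) (suc i)
divides-X* {p} {r} (z , h) (b ∷ y , e) = y , ≋-trans (*ₚ-comm y p) (tail-≋ (begin
  0ℤ ∷ (p *ₚ y)                      ≈⟨ +ₚ-congʳ (≋-sym (≋-trans (scale-cong b≡0 (≋-refl {p})) (scale-0 p))) ⟩
  scaleₚ b p +ₚ (0ℤ ∷ (p *ₚ y))      ≈⟨ ≋-sym (*ₚ-∷ʳ p b y) ⟩
  p *ₚ (b ∷ y)                       ≈⟨ ≋-trans (*ₚ-comm p (b ∷ y)) e ⟩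
  X *ₚ r                             ≈⟨ X-* r ⟩
  0ℤ ∷ r                             ∎))
  where
  module E = ≡.≡-Reasoning
  b≡0 : b ≡ 0ℤ
  b≡0 = E.begin
    b                               E.≡⟨ ≡.sym (ℤ.*-identityˡ b) ⟩
    1ℤ ℤ.* b                        E.≡⟨ cong (ℤ._* b) (≡.sym h) ⟩
    z ℤ.* coeff p 0 ℤ.* b           E.≡⟨ ℤ.*-assoc z (coeff p 0) b ⟩
    z ℤ.* (coeff p 0 ℤ.* b)         E.≡⟨ cong (z ℤ.*_) (ℤ.*-comm (coeff p 0) b) ⟩
    z ℤ.* (b ℤ.* coeff p 0)         E.≡⟨ cong (z ℤ.*_) (≡.sym (coeff₀-* (b ∷ y) p)) ⟩
    z ℤ.* coeff ((b ∷ y) *ₚ p) 0    E.≡⟨ cong (z ℤ.*_) (at (≋-trans e (X-* r)) 0) ⟩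
    z ℤ.* 0ℤ                        E.≡⟨ ℤ.*-zeroʳ z ⟩
    0ℤ                              E.∎

X^-suc : ∀ s → X^ (suc s) ≋ (X *ₚ X^ s)
X^-suc s = ≋-sym (X-* (X^ s))

divides-X^* : ∀ {p r} s → Unit₀ p → p divides (X^ s *ₚ r) → p divides r
divides-X^* {r = r} zero u (y , e) = y , ≋-trans e (*ₚ-identityˡ r)
divides-X^* {r = r} (suc s) u (y , e) = divides-X^* s u (divides-X* u
  (y , ≋-trans e (≋-trans (*ₚ-congʳ (X^-suc s)) (*ₚ-assoc X (X^ s) r))))

-- Greatest common divisors up to constants and powers of q

-- Euclid's algorithm that kills constant terms instead of leading terms, whence a gcd up to
-- powers of q; the divisibilities hold over ℚ only.

record PseudoGCD (a b : Poly) : Set where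
  field
    g u v x y : Poly
    s         : ℕ
    c c′      : ℤ
    c≢0       : c ≢ 0ℤ
    c′≢0      : c′ ≢ 0ℤ
    bezout    : (u *ₚ a +ₚ v *ₚ b) ≋ (X^ s *ₚ g)
    g∣a       : (x *ₚ g) ≋ (const c *ₚ a)
    g∣b       : (y *ₚ g) ≋ (const c′ *ₚ b)

pseudoGCD-swap : ∀ {a b} → PseudoGCD a b → PseudoGCD b a
pseudoGCD-swap {a} {b} r = record
  { g = g ; u = v ; v = u ; x = y ; y = x ; s = s ; c = c′ ; c′ = c ; c≢0 = c′≢0 ; c′≢0 = c≢0
  ; bezout = ≋-trans (+ₚ-comm (v *ₚ b) (u *ₚ a)) bezout ; g∣a = g∣b ; g∣b = g∣a }
  where open PseudoGCD r

pseudoGCD-[] : ∀ b → PseudoGCD [] b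
pseudoGCD-[] b = record
  { g = b ; u = 0ₚ ; v = 1ₚ ; x = 0ₚ ; y = 1ₚ ; s = 0 ; c = 1ℤ ; c′ = 1ℤ ; c≢0 = λ () ; c′≢0 = λ ()
  ; bezout = ≋-refl ; g∣a = ≋-sym (*ₚ-zeroʳ 1ₚ) ; g∣b = ≋-refl }

pseudoGCD-resp : ∀ {a a′ b} → a ≋ a′ → PseudoGCD a b → PseudoGCD a′ b
pseudoGCD-resp e r = record
  { g = g ; u = u ; v = v ; x = x ; y = y ; s = s ; c = c ; c′ = c′ ; c≢0 = c≢0 ; c′≢0 = c′≢0
  ; bezout = ≋-trans (+ₚ-congʳ (*ₚ-cong (≋-refl {u}) (≋-sym e))) bezout
  ; g∣a = ≋-trans g∣a (*ₚ-cong (≋-refl {const c}) e) ; g∣b = g∣b }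
  where open PseudoGCD r

-- The factor q is put into the Bézout identity and not into g, so g may lose powers of q. This does
-- no harm once b has an invertible constant coefficient, since no common divisor is then divisible
-- by q.
pseudoGCD-X* : ∀ {a b} → PseudoGCD a b → PseudoGCD (X *ₚ a) b
pseudoGCD-X* {a} {b} r = record
  { g = g ; u = u ; v = X *ₚ v ; x = X *ₚ x ; y = y ; s = suc s ; c = c ; c′ = c′
  ; c≢0 = c≢0 ; c′≢0 = c′≢0
  ; bezout = begin
      u *ₚ (X *ₚ a) +ₚ X *ₚ v *ₚ b
        ≈⟨ solve 5 (λ q u v a b → u :* (q :* a) :+ q :* v :* b := q :* (u :* a :+ v :* b)) ≋-refl X u v a b ⟩
      X *ₚ (u *ₚ a +ₚ v *ₚ b)    ≈⟨ *ₚ-congˡ X bezout ⟩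
      X *ₚ (X^ s *ₚ g)           ≈⟨ *ₚ-assoc X (X^ s) g ⟨
      X *ₚ X^ s *ₚ g             ≈⟨ *ₚ-congʳ (≋-sym (X^-suc s)) ⟩
      X^ (suc s) *ₚ g            ∎
  ; g∣a = begin
      X *ₚ x *ₚ g                ≈⟨ *ₚ-assoc X x g ⟩
      X *ₚ (x *ₚ g)              ≈⟨ *ₚ-congˡ X g∣a ⟩
      X *ₚ (const c *ₚ a)        ≈⟨ solve 3 (λ q c a → q :* (c :* a) := c :* (q :* a)) ≋-refl X (const c) a ⟩
      const c *ₚ (X *ₚ a)        ∎
  ; g∣b = g∣b }
  where open PseudoGCD r

pseudoGCD-step : ∀ {a b r} (α β : ℤ) → α ≢ 0ℤ → (const α *ₚ a) ≋ (const β *ₚ b +ₚ r) →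
  PseudoGCD r b → PseudoGCD a b
pseudoGCD-step {a} {b} {r} α β α≢0 αa≋βb+r G = record
  { g = g ; u = u *ₚ const α ; v = v -ₚ u *ₚ const β
  ; x = const c *ₚ const β *ₚ y +ₚ const c′ *ₚ x ; y = y ; s = s ; c = c ℤ.* c′ ℤ.* α ; c′ = c′
  ; c≢0 = nonZero-* (nonZero-* c≢0 c′≢0) α≢0 ; c′≢0 = c′≢0
  ; bezout = begin
      u *ₚ const α *ₚ a +ₚ (v -ₚ u *ₚ const β) *ₚ b
        ≈⟨ +ₚ-congʳ (≋-trans (*ₚ-assoc u (const α) a) (*ₚ-congˡ u αa≋βb+r)) ⟩
      u *ₚ (const β *ₚ b +ₚ r) +ₚ (v -ₚ u *ₚ const β) *ₚ b
        ≈⟨ solve 5 (λ u v β b r → u :* (β :* b :+ r) :+ (v :- u :* β) :* b := u :* r :+ v :* b) ≋-refl u v (const β) b r ⟩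
      u *ₚ r +ₚ v *ₚ b
        ≈⟨ bezout ⟩
      X^ s *ₚ g ∎
  ; g∣a = begin
      (const c *ₚ const β *ₚ y +ₚ const c′ *ₚ x) *ₚ g
        ≈⟨ solve 6 (λ c β y c′ x g → (c :* β :* y :+ c′ :* x) :* g := c :* β :* (y :* g) :+ c′ :* (x :* g)) ≋-refl (const c) (const β) y (const c′) x g ⟩
      const c *ₚ const β *ₚ (y *ₚ g) +ₚ const c′ *ₚ (x *ₚ g)
        ≈⟨ +ₚ-cong (*ₚ-congˡ (const c *ₚ const β) g∣b) (*ₚ-congˡ (const c′) g∣a) ⟩
      const c *ₚ const β *ₚ (const c′ *ₚ b) +ₚ const c′ *ₚ (const c *ₚ r)
        ≈⟨ solve 5 (λ c β c′ b r → c :* β :* (c′ :* b) :+ c′ :* (c :* r) := c :* c′ :* (β :* b :+ r)) ≋-refl (const c) (const β) (const c′) b r ⟩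
      const c *ₚ const c′ *ₚ (const β *ₚ b +ₚ r)
        ≈⟨ *ₚ-congˡ (const c *ₚ const c′) (≋-sym αa≋βb+r) ⟩
      const c *ₚ const c′ *ₚ (const α *ₚ a)
        ≈⟨ *ₚ-assoc (const c *ₚ const c′) (const α) a ⟨
      const c *ₚ const c′ *ₚ const α *ₚ a
        ≈⟨ *ₚ-congʳ (≋-trans (*ₚ-congʳ {x = const α} (const-homo-* c c′)) (const-homo-* (c ℤ.* c′) α)) ⟩
      const (c ℤ.* c′ ℤ.* α) *ₚ a ∎
  ; g∣b = g∣b }
  where open PseudoGCD G

length-+ₚ : ∀ {n} p r → length p ℕ.≤ n → length r ℕ.≤ n → length (p +ₚ r) ℕ.≤ n
length-+ₚ []      r       _       k       = k
length-+ₚ (a ∷ p) []      h       _       = h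
length-+ₚ (a ∷ p) (b ∷ r) (s≤s h) (s≤s k) = s≤s (length-+ₚ p r h k)

length-negₚ : ∀ p → length (negₚ p) ≡ length p
length-negₚ []      = ≡.refl
length-negₚ (a ∷ p) = cong suc (length-negₚ p)

length-scale : ∀ c p → length (scaleₚ c p) ≡ length p
length-scale c []      = ≡.refl
length-scale c (a ∷ p) = cong suc (length-scale c p)

-- The combination of a + qp and b + qr without constant term, already divided by q: b(a + qp) - a(b
-- + qr) = q(bp - ar).
eliminate : ℤ → ℤ → Poly → Poly → Poly
eliminate a b p r = scaleₚ b p -ₚ scaleₚ a r

length-eliminate : ∀ a b p r → length r ℕ.≤ length p → length (eliminate a b p r) ℕ.≤ length p
length-eliminate a b p r h = length-+ₚ (scaleₚ b p) (negₚ (scaleₚ a r))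
  (ℕ.≤-reflexive (length-scale b p))
  (≡.subst (ℕ._≤ length p) (≡.sym (≡.trans (length-negₚ (scaleₚ a r)) (length-scale a r))) h)

eliminate-≋ : ∀ a b p r →
  (const b *ₚ (a ∷ p)) ≋ (const a *ₚ (b ∷ r) +ₚ X *ₚ eliminate a b p r)
eliminate-≋ a b p r = begin
  const b *ₚ (a ∷ p)
    ≈⟨ const-* b (a ∷ p) ⟩
  (b ℤ.* a) ∷ scaleₚ b p
    ≈⟨ ∷-cong (≡.trans (ℤ.*-comm b a) (≡.sym (ℤ.+-identityʳ _)))
        (solve 2 (λ s t → s := t :+ (s :- t)) ≋-refl (scaleₚ b p) (scaleₚ a r)) ⟩
  scaleₚ a (b ∷ r) +ₚ (0ℤ ∷ eliminate a b p r)
    ≈⟨ +ₚ-cong (≋-sym (const-* a (b ∷ r))) (≋-sym (X-* (eliminate a b p r))) ⟩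
  const a *ₚ (b ∷ r) +ₚ X *ₚ eliminate a b p r ∎

-- Each step strips a constant term that is zero or has been eliminated. The longer list is the one
-- replaced, so the total length drops.
pseudoGCD-bounded : ∀ n a b → length a ℕ.+ length b ℕ.≤ n → PseudoGCD a b
pseudoGCD-bounded n [] b _ = pseudoGCD-[] b
pseudoGCD-bounded n (a ∷ p) [] _ = pseudoGCD-swap (pseudoGCD-[] (a ∷ p))
pseudoGCD-bounded (suc n) (a ∷ p) (b ∷ r) (s≤s h) with a ℤ.≟ 0ℤ | b ℤ.≟ 0ℤ
... | yes ≡.refl | _ = pseudoGCD-resp (X-* p) (pseudoGCD-X* (pseudoGCD-bounded n p (b ∷ r) h))
... | no _ | yes ≡.refl = pseudoGCD-swap (pseudoGCD-resp (X-* r) (pseudoGCD-X*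
  (pseudoGCD-bounded n r (a ∷ p) (≡.subst (ℕ._≤ n) (≡.trans (ℕ.+-suc (length p) (length r))
    (≡.trans (cong suc (ℕ.+-comm (length p) (length r))) (≡.sym (ℕ.+-suc (length r) (length p))))) h))))
... | no a≢0 | no b≢0 with ℕ.≤-total (length r) (length p)
...   | inj₁ r≤p = pseudoGCD-step b a b≢0 (eliminate-≋ a b p r) (pseudoGCD-X*
  (pseudoGCD-bounded n (eliminate a b p r) (b ∷ r)
    (ℕ.≤-trans (ℕ.+-monoˡ-≤ (suc (length r)) (length-eliminate a b p r r≤p)) h)))
...   | inj₂ p≤r = pseudoGCD-swap (pseudoGCD-step a b a≢0 (eliminate-≋ b a r p) (pseudoGCD-X*
  (pseudoGCD-bounded n (eliminate b a r p) (a ∷ p)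
    (ℕ.≤-trans (ℕ.+-monoˡ-≤ (suc (length p)) (length-eliminate b a r p p≤r))
      (≡.subst (ℕ._≤ n) (≡.trans (ℕ.+-suc (length p) (length r))
        (≡.trans (cong suc (ℕ.+-comm (length p) (length r))) (≡.sym (ℕ.+-suc (length r) (length p))))) h)))))

pseudoGCD : ∀ a b → PseudoGCD a b
pseudoGCD a b = pseudoGCD-bounded _ a b ℕ.≤-refl

-- Gauss's lemma

prime∣*⇒∣⊎∣ : ∀ {p} → Prime p → ∀ a b c → a ℤ.* b ≡ + p ℤ.* c →
  (∃ λ k → a ≡ + p ℤ.* k) ⊎ (∃ λ k → b ≡ + p ℤ.* k)
prime∣*⇒∣⊎∣ {p} pr a b c e = Sum.map (quotient a) (quotient b)
  (euclidsLemma ∣ a ∣ ∣ b ∣ pr (ℕ.divides ∣ c ∣ (≡.trans (≡.sym (ℤ.abs-* a b))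
    (≡.trans (cong ∣_∣ e) (≡.trans (ℤ.abs-* (+ p) c) (ℕ.*-comm p ∣ c ∣))))))
  where
  quotient : ∀ k → p ℕ.∣ ∣ k ∣ → ∃ λ l → k ≡ + p ℤ.* l
  quotient k d with ℤ.∣ᵤ⇒∣ {+ p} {k} d
  ... | ℤ.divides l f = l , ≡.trans f (ℤ.*-comm l (+ p))

scale-remainder : ∀ {c a k} f t h → a ≡ c ℤ.* k → (scaleₚ a f +ₚ t) ≋ scaleₚ c h →
  t ≋ scaleₚ c (h -ₚ scaleₚ k f)
scale-remainder {c} {a} {k} f t h a≡ck e = begin
  t
    ≈⟨ solve 2 (λ s t → t := (s :+ t) :- s) ≋-refl (scaleₚ a f) t ⟩
  (scaleₚ a f +ₚ t) -ₚ scaleₚ a f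
    ≈⟨ +ₚ-cong (≋-trans e (≋-sym (const-* c h))) (negₚ-cong (begin
         scaleₚ a f                   ≈⟨ scale-cong a≡ck ≋-refl ⟩
         scaleₚ (c ℤ.* k) f           ≈⟨ scale-scale c k f ⟨
         scaleₚ c (scaleₚ k f)        ≈⟨ const-* c (scaleₚ k f) ⟨
         const c *ₚ scaleₚ k f        ∎)) ⟩
  const c *ₚ h -ₚ const c *ₚ scaleₚ k f
    ≈⟨ solve 3 (λ c x s → c :* x :- c :* s := c :* (x :- s)) ≋-refl (const c) h (scaleₚ k f) ⟩
  const c *ₚ (h -ₚ scaleₚ k f)
    ≈⟨ const-* c _ ⟩
  scaleₚ c (h -ₚ scaleₚ k f) ∎

-- The product of the constant coefficients is divisible by p, hence so is one of them; removing
-- that term and a factor q keeps the product divisible by p, and the removed term can be put back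
-- in the conclusion.
prime-scale : ∀ {p} → Prime p → ∀ f g h → (f *ₚ g) ≋ scaleₚ (+ p) h →
  (∃ λ f′ → f ≋ scaleₚ (+ p) f′) ⊎ (∃ λ g′ → g ≋ scaleₚ (+ p) g′)
prime-scale pr [] g h e = inj₁ ([] , ≋-refl)
prime-scale pr (a ∷ f) [] h e = inj₂ ([] , ≋-refl)
prime-scale {p} pr (a ∷ f) (b ∷ g) h e = Sum.[
    (λ (k , a≡pk) → Sum.map₁ (λ (f′ , i) → (k ∷ f′) , ∷-cong a≡pk i)
      (prime-scale pr f (b ∷ g) (tail (h -ₚ scaleₚ k (b ∷ g)))
        (0∷-scale _ (scale-remainder (b ∷ g) (0ℤ ∷ (f *ₚ (b ∷ g))) h a≡pk e))))
  , (λ (k , b≡pk) → Sum.map₂ (λ (g′ , i) → (k ∷ g′) , ∷-cong b≡pk i)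
      (prime-scale pr (a ∷ f) g (tail (h -ₚ scaleₚ k (a ∷ f)))
        (0∷-scale _ (scale-remainder (a ∷ f) (0ℤ ∷ ((a ∷ f) *ₚ g)) h b≡pk
          (≋-trans (≋-sym (*ₚ-∷ʳ (a ∷ f) b g)) e)))))
  ]′ (prime∣*⇒∣⊎∣ pr a b (coeff h 0)
       (≡.trans (≡.sym (coeff₀-* (a ∷ f) (b ∷ g))) (≡.trans (at e 0) (coeff-scale (+ p) h 0))))

prime≢0 : ∀ {p} → Prime p → + p ≢ 0ℤ
prime≢0 {suc p} _ ()
prime≢0 {zero} pr = ⊥-elim (ℕ.≢-nonZero⁻¹ 0 ⦃ prime⇒nonZero pr ⦄ ≡.refl)

-- Each prime of the constant is cancelled either from h, where it disappears, or from g, where it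
-- is collected in e.
gauss-primes : ∀ ps → All Prime ps → ∀ g h f → (h *ₚ g) ≋ scaleₚ (+ product ps) f →
  ∃₂ λ e g₀ → e ≢ 0ℤ × g ≋ scaleₚ e g₀ × g₀ divides f
gauss-primes [] [] g h f e =
  1ℤ , g , (λ ()) , ≋-sym (scale-1 g) , h , ≋-trans e (scale-1 f)
gauss-primes (p ∷ ps) (pr ∷ prs) g h f e = helper (prime-scale pr h g _ e′)
  where
  c = + product ps
  e′ : (h *ₚ g) ≋ scaleₚ (+ p) (scaleₚ c f)
  e′ = ≋-trans e (≋-trans (scale-cong (ℤ.pos-* p (product ps)) ≋-refl) (≋-sym (scale-scale (+ p) c f)))
  helper : (∃ λ h′ → h ≋ scaleₚ (+ p) h′) ⊎ (∃ λ g′ → g ≋ scaleₚ (+ p) g′) → _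
  helper (inj₁ (h′ , i)) = gauss-primes ps prs g h′ f (scale-cancel (prime≢0 pr)
    (≋-trans (≋-sym (scale-* (+ p) h′ g)) (≋-trans (*ₚ-congʳ (≋-sym i)) e′)))
  helper (inj₂ (g′ , i)) =
    let d , g₀ , d≢0 , k , l = gauss-primes ps prs g′ h f (scale-cancel (prime≢0 pr) (begin
          scaleₚ (+ p) (h *ₚ g′)      ≈⟨ scale-cong ≡.refl (*ₚ-comm h g′) ⟩
          scaleₚ (+ p) (g′ *ₚ h)      ≈⟨ scale-* (+ p) g′ h ⟨
          scaleₚ (+ p) g′ *ₚ h        ≈⟨ *ₚ-congʳ (≋-sym i) ⟩
          g *ₚ h                      ≈⟨ *ₚ-comm g h ⟩
          h *ₚ g                      ≈⟨ e′ ⟩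
          scaleₚ (+ p) (scaleₚ c f)   ∎))
    in + p ℤ.* d , g₀ , nonZero-* (prime≢0 pr) d≢0
       , ≋-trans i (≋-trans (scale-cong ≡.refl k) (scale-scale (+ p) d g₀)) , l

gauss : ∀ c → c ≢ 0ℤ → ∀ g h f → (h *ₚ g) ≋ scaleₚ c f →
  ∃₂ λ e g₀ → e ≢ 0ℤ × g ≋ scaleₚ e g₀ × g₀ divides f
gauss (+ zero)  c≢0 = ⊥-elim (c≢0 ≡.refl)
gauss (+ suc n) c≢0 g h f e = gauss-primes (factors F) (factorsPrime F) g h f
    (≋-trans e (scale-cong (cong +_ (isFactorisation F)) ≋-refl))
  where open PrimeFactorisation ; F = factorise (suc n)
gauss -[1+ n ] c≢0 g h f e = gauss (+ suc n) (λ ()) g (negₚ h) f (begin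
  negₚ h *ₚ g                    ≈⟨ solve 2 (λ h g → :- h :* g := :- (h :* g)) ≋-refl h g ⟩
  negₚ (h *ₚ g)                  ≈⟨ negₚ-cong (≋-trans e (≋-sym (const-* -[1+ n ] f))) ⟩
  negₚ (const -[1+ n ] *ₚ f)     ≈⟨ solve 2 (λ h g → :- (h :* g) := :- h :* g) ≋-refl (const -[1+ n ]) f ⟩
  const (+ suc n) *ₚ f           ≈⟨ const-* (+ suc n) f ⟩
  scaleₚ (+ suc n) f             ∎)

-- Reduced fractions

record Reduction (a b : Poly) : Set where
  field
    g a₀ b₀ : Poly
    a≋      : (a₀ *ₚ g) ≋ a
    b≋      : (b₀ *ₚ g) ≋ b
    coprime : Coprimeₚ a₀ b₀

-- A common divisor divides e q^s. As a divisor of b it has an invertible constant coefficient, so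
-- q^s and e can both be removed and it divides 1 over ℤ.
bezout⇒coprime : ∀ {u v a b s e} → Unit₀ b → e ≢ 0ℤ →
  (u *ₚ a +ₚ v *ₚ b) ≋ (X^ s *ₚ const e) → Coprimeₚ a b
bezout⇒coprime {u} {v} {a} {b} {s} {e} ub e≢0 bez k (x , kx) (y , ky) =
  _divides_.quotient k∣1 , at (_divides_.quotient* k∣1)
  where
  uk : Unit₀ k
  uk = Unit₀-divisor {k} (y , mk≋ ky) ub
  k∣X^e : k divides (X^ s *ₚ const e)
  k∣X^e = u *ₚ x +ₚ v *ₚ y , (begin
    (u *ₚ x +ₚ v *ₚ y) *ₚ k
      ≈⟨ solve 5 (λ g u v a b → (u :* a :+ v :* b) :* g := u :* (a :* g) :+ v :* (b :* g)) ≋-refl k u v x y ⟩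
    u *ₚ (x *ₚ k) +ₚ v *ₚ (y *ₚ k)
      ≈⟨ +ₚ-cong (*ₚ-congˡ u (mk≋ kx)) (*ₚ-congˡ v (mk≋ ky)) ⟩
    u *ₚ a +ₚ v *ₚ b
      ≈⟨ bez ⟩
    X^ s *ₚ const e ∎)
  k∣1 : k divides 1ₚ
  k∣1 = divides-scale {e} uk e≢0
    (divides-resp (∷-cong (≡.sym (ℤ.*-identityʳ e)) ≋-refl) (divides-X^* s uk k∣X^e))

reduction-by : ∀ {a b e g} (G : PseudoGCD a b) → Unit₀ b → e ≢ 0ℤ → PseudoGCD.g G ≋ scaleₚ e g →
  g divides a → g divides b → Reduction a b
reduction-by {a} {b} {e} {g} G ub e≢0 k (a₀ , a₀g≋a) (b₀ , b₀g≋b) = record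
  { g = g ; a₀ = a₀ ; b₀ = b₀ ; a≋ = a₀g≋a ; b≋ = b₀g≋b
  ; coprime = bezout⇒coprime {u} {v} {a₀} {b₀} {s} {e}
      (Unit₀-divisor (g , ≋-trans (*ₚ-comm g b₀) b₀g≋b) ub) e≢0 bez }
  where
  open PseudoGCD G using (u; v; s; bezout)
  bez : (u *ₚ a₀ +ₚ v *ₚ b₀) ≋ (X^ s *ₚ const e)
  bez = *ₚ-cancelˡ (Unit₀-divisor (b₀ , b₀g≋b) ub) (begin
    g *ₚ (u *ₚ a₀ +ₚ v *ₚ b₀)
      ≈⟨ solve 5 (λ g u v a b → g :* (u :* a :+ v :* b) := u :* (a :* g) :+ v :* (b :* g)) ≋-refl g u v a₀ b₀ ⟩
    u *ₚ (a₀ *ₚ g) +ₚ v *ₚ (b₀ *ₚ g)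
      ≈⟨ +ₚ-cong (*ₚ-congˡ u a₀g≋a) (*ₚ-congˡ v b₀g≋b) ⟩
    u *ₚ a +ₚ v *ₚ b
      ≈⟨ bezout ⟩
    X^ s *ₚ PseudoGCD.g G
      ≈⟨ *ₚ-congˡ (X^ s) (≋-trans k (≋-sym (const-* e g))) ⟩
    X^ s *ₚ (const e *ₚ g)
      ≈⟨ solve 3 (λ x e g → x :* (e :* g) := g :* (x :* e)) ≋-refl (X^ s) (const e) g ⟩
    g *ₚ (X^ s *ₚ const e) ∎)

-- The pseudo-gcd divides b only up to a constant. Gauss's lemma replaces it by g₀ dividing b over
-- ℤ; then g₀ has an invertible constant coefficient, and `divides-scale` makes it divide a as well.
reduction-from : ∀ {a b} → Unit₀ b → PseudoGCD a b → Reduction a b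
reduction-from {a} {b} ub G = from-gauss (gauss c′ c′≢0 g y b (≋-trans g∣b (const-* c′ b)))
  where
  open PseudoGCD G
  from-gauss : (∃₂ λ e g₀ → e ≢ 0ℤ × g ≋ scaleₚ e g₀ × g₀ divides b) → Reduction a b
  from-gauss (e , g₀ , e≢0 , k , g₀∣b) = reduction-by G ub e≢0 k
    (divides-scale (Unit₀-divisor g₀∣b ub) c≢0 (x *ₚ const e , (begin
      x *ₚ const e *ₚ g₀      ≈⟨ *ₚ-assoc x (const e) g₀ ⟩
      x *ₚ (const e *ₚ g₀)    ≈⟨ *ₚ-congˡ x (≋-trans (const-* e g₀) (≋-sym k)) ⟩
      x *ₚ g                  ≈⟨ g∣a ⟩
      const c *ₚ a            ≈⟨ const-* c a ⟩
      scaleₚ c a              ∎)))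
    g₀∣b

reduction : ∀ a b → Unit₀ b → Reduction a b
reduction a b ub = reduction-from ub (pseudoGCD a b)

-- The derivation, powers of q and divisors of q^n - 1

-- The derivation q d/dq.
θ : Poly → Poly
θ []      = []
θ (a ∷ p) = 0ℤ ∷ (p +ₚ θ p)

coeff-θ : ∀ p i → coeff (θ p) i ≡ + i ℤ.* coeff p i
coeff-θ []      i       = ≡.sym (ℤ.*-zeroʳ (+ i))
coeff-θ (a ∷ p) zero    = ≡.refl
coeff-θ (a ∷ p) (suc i) = ≡.trans (coeff-+ p (θ p) i)
  (≡.trans (cong (ℤ._+_ (coeff p i)) (coeff-θ p i)) (≡.sym (ℤ.suc-* (+ i) (coeff p i))))

θ-cong : ∀ {p r} → p ≋ r → θ p ≋ θ r
θ-cong {p} {r} e = mk≋ λ i → ≡.trans (coeff-θ p i)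
  (≡.trans (cong (+ i ℤ.*_) (at e i)) (≡.sym (coeff-θ r i)))

θ-+ : ∀ p r → θ (p +ₚ r) ≋ (θ p +ₚ θ r)
θ-+ p r = mk≋ λ i → ≡.trans (coeff-θ (p +ₚ r) i) (≡.trans (cong (+ i ℤ.*_) (coeff-+ p r i))
  (≡.trans (ℤ.*-distribˡ-+ (+ i) _ _)
  (≡.sym (≡.trans (coeff-+ (θ p) (θ r) i) (cong₂ ℤ._+_ (coeff-θ p i) (coeff-θ r i))))))

θ-scale : ∀ c p → θ (scaleₚ c p) ≋ scaleₚ c (θ p)
θ-scale c []      = ≋-refl
θ-scale c (a ∷ p) = ∷-cong (≡.sym (ℤ.*-zeroʳ c))
  (≋-trans (+ₚ-congˡ {scaleₚ c p} (θ-scale c p)) (≋-sym (scale-+ c p (θ p))))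

θ-* : ∀ p r → θ (p *ₚ r) ≋ (θ p *ₚ r +ₚ p *ₚ θ r)
θ-* []      r = ≋-refl
θ-* (a ∷ p) r = begin
  θ (scaleₚ a r +ₚ (0ℤ ∷ (p *ₚ r)))
    ≈⟨ ≋-trans (θ-+ (scaleₚ a r) _) (+ₚ-cong (θ-scale a r) (shift (p *ₚ r))) ⟩
  scaleₚ a (θ r) +ₚ X *ₚ (p *ₚ r +ₚ θ (p *ₚ r))
    ≈⟨ +ₚ-congˡ {scaleₚ a (θ r)} (*ₚ-congˡ X (+ₚ-congˡ {p *ₚ r} (θ-* p r))) ⟩
  scaleₚ a (θ r) +ₚ X *ₚ (p *ₚ r +ₚ (θ p *ₚ r +ₚ p *ₚ θ r))
    ≈⟨ solve 6 (λ s q p r tp tr → s :+ q :* (p :* r :+ (tp :* r :+ p :* tr))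
         := q :* (p :+ tp) :* r :+ (s :+ q :* (p :* tr))) ≋-refl (scaleₚ a (θ r)) X p r (θ p) (θ r) ⟩
  X *ₚ (p +ₚ θ p) *ₚ r +ₚ (scaleₚ a (θ r) +ₚ X *ₚ (p *ₚ θ r))
    ≈⟨ +ₚ-cong (*ₚ-congʳ {r} (X-* (p +ₚ θ p))) (+ₚ-congˡ {scaleₚ a (θ r)} (X-* (p *ₚ θ r))) ⟩
  θ (a ∷ p) *ₚ r +ₚ (a ∷ p) *ₚ θ r ∎
  where
  shift : ∀ p → θ (0ℤ ∷ p) ≋ (X *ₚ (p +ₚ θ p))
  shift p = ≋-sym (X-* (p +ₚ θ p))

θ-X^ : ∀ n → θ (X^ n) ≋ scaleₚ (+ n) (X^ n)
θ-X^ zero    = ≋-refl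
θ-X^ (suc n) = ∷-cong (≡.sym (ℤ.*-zeroʳ (+ suc n))) (begin
  X^ n +ₚ θ (X^ n)                     ≈⟨ +ₚ-cong (≋-sym (scale-1 (X^ n))) (θ-X^ n) ⟩
  scaleₚ 1ℤ (X^ n) +ₚ scaleₚ (+ n) (X^ n)    ≈⟨ +-scale 1ℤ (+ n) (X^ n) ⟨
  scaleₚ (+ suc n) (X^ n)              ∎)

X^-+ : ∀ a b → X^ (a ℕ.+ b) ≋ (X^ a *ₚ X^ b)
X^-+ zero    b = ≋-sym (*ₚ-identityˡ (X^ b))
X^-+ (suc a) b = ≋-trans (∷-cong ≡.refl (X^-+ a b)) (≋-sym (0∷-* (X^ a) (X^ b)))

X^-1-+ : ∀ a b → (X^ (a ℕ.+ b) -ₚ 1ₚ) ≋ (X^ a *ₚ (X^ b -ₚ 1ₚ) +ₚ (X^ a -ₚ 1ₚ))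
X^-1-+ a b = ≋-trans (+ₚ-congʳ {negₚ 1ₚ} (X^-+ a b))
  (solve 2 (λ x y → x :* y :- con 1ℤ := x :* (y :- con 1ℤ) :+ (x :- con 1ℤ)) ≋-refl (X^ a) (X^ b))

divides-refl : ∀ {p} → p divides p
divides-refl {p} = 1ₚ , *ₚ-identityˡ p

divides-trans : ∀ {p r s} → p divides r → r divides s → p divides s
divides-trans {p} (x , e) (y , f) = y *ₚ x , ≋-trans (*ₚ-assoc y x p) (≋-trans (*ₚ-congˡ y e) f)

divides-+ : ∀ {p r s} → p divides r → p divides s → p divides (r +ₚ s)
divides-+ {p} (x , e) (y , f) = x +ₚ y , ≋-trans (*ₚ-distribʳ p x y) (+ₚ-cong e f)

divides-*ˡ : ∀ {p r} s → p divides r → p divides (s *ₚ r)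
divides-*ˡ {p} s (x , e) = s *ₚ x , ≋-trans (*ₚ-assoc s x p) (*ₚ-congˡ s e)

divides-*ʳ : ∀ {p r} s → p divides r → p divides (r *ₚ s)
divides-*ʳ {r = r} s d = divides-resp (*ₚ-comm s r) (divides-*ˡ s d)

divides-* : ∀ {p p′ r r′} → p divides r → p′ divides r′ → (p *ₚ p′) divides (r *ₚ r′)
divides-* {p} {p′} (x , e) (y , f) = x *ₚ y , ≋-trans
  (solve 4 (λ x y p p′ → x :* y :* (p :* p′) := x :* p :* (y :* p′)) ≋-refl x y p p′) (*ₚ-cong e f)

divides-neg : ∀ {p r} → p divides r → p divides (negₚ r)
divides-neg {p} (x , e) = negₚ x ,
  ≋-trans (solve 2 (λ x p → :- x :* p := :- (x :* p)) ≋-refl x p) (negₚ-cong e)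

divides-0 : ∀ {p} → p divides 0ₚ
divides-0 = 0ₚ , ≋-refl

X^-1-multiple : ∀ a b → (X^ a -ₚ 1ₚ) divides (X^ (b ℕ.* a) -ₚ 1ₚ)
X^-1-multiple a zero    = divides-resp (≋-sym (-ₚ-inverseʳ 1ₚ)) divides-0
X^-1-multiple a (suc b) = divides-resp (≋-sym (X^-1-+ a (b ℕ.* a)))
  (divides-+ (divides-*ˡ (X^ a) (X^-1-multiple a b)) divides-refl)

X^-1-divides : ∀ {a b} → a ∣ b → (X^ a -ₚ 1ₚ) divides (X^ b -ₚ 1ₚ)
X^-1-divides {a} (ℕ.divides k ≡.refl) = X^-1-multiple a k

Unit₀-X^-1 : ∀ {n} → 1 ≤ n → Unit₀ (X^ n -ₚ 1ₚ)
Unit₀-X^-1 (s≤s _) = -[1+ 0 ] , ≡.refl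

-- Coprimality over ℚ.
record Cop (p r : Poly) : Set where
  constructor cop
  field
    {u v}  : Poly
    {c}    : ℤ
    c≢0    : c ≢ 0ℤ
    bezout : (u *ₚ p +ₚ v *ₚ r) ≋ const c

Cop-sym : ∀ {p r} → Cop p r → Cop r p
Cop-sym {p} {r} (cop {u} {v} c≢0 e) = cop {u = v} {u} c≢0 (≋-trans (+ₚ-comm (v *ₚ r) (u *ₚ p)) e)

Cop-1 : ∀ {p} → Cop p 1ₚ
Cop-1 = cop {u = 0ₚ} {1ₚ} {1ℤ} (λ ()) (*ₚ-identityˡ 1ₚ)

Cop-* : ∀ {p r s} → Cop p r → Cop p s → Cop p (r *ₚ s)
Cop-* {p} {r} {s} (cop {u} {v} {b} b≢0 e) (cop {x} {y} {c} c≢0 f) =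
  cop {u = u *ₚ (x *ₚ p +ₚ y *ₚ s) +ₚ v *ₚ r *ₚ x} {v *ₚ y} (nonZero-* b≢0 c≢0) (begin
    (u *ₚ (x *ₚ p +ₚ y *ₚ s) +ₚ v *ₚ r *ₚ x) *ₚ p +ₚ v *ₚ y *ₚ (r *ₚ s)
      ≈⟨ solve 7 (λ u v x y p r s → (u :* (x :* p :+ y :* s) :+ v :* r :* x) :* p :+ v :* y :* (r :* s)
           := (u :* p :+ v :* r) :* (x :* p :+ y :* s)) ≋-refl u v x y p r s ⟩
    (u *ₚ p +ₚ v *ₚ r) *ₚ (x *ₚ p +ₚ y *ₚ s)
      ≈⟨ *ₚ-cong e f ⟩
    const b *ₚ const c
      ≈⟨ const-homo-* b c ⟩
    const (b ℤ.* c) ∎)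

Cop-divisor : ∀ {p r s} → Cop p r → s divides r → Cop p s
Cop-divisor {p} {r} {s} (cop {u} {v} c≢0 e) (x , f) = cop {u = u} {v *ₚ x} c≢0
  (≋-trans (+ₚ-congˡ {u *ₚ p} (≋-trans (*ₚ-assoc v x s) (*ₚ-congˡ v f))) e)

Cop-+-multiple : ∀ {p r s} → Cop p r → p divides s → Cop p (r +ₚ s)
Cop-+-multiple {p} {r} {s} (cop {u} {v} c≢0 e) (x , f) = cop {u = u -ₚ v *ₚ x} {v} c≢0 (begin
  (u -ₚ v *ₚ x) *ₚ p +ₚ v *ₚ (r +ₚ s)
    ≈⟨ +ₚ-congˡ {(u -ₚ v *ₚ x) *ₚ p} (*ₚ-congˡ v (+ₚ-congˡ {r} (≋-sym f))) ⟩
  (u -ₚ v *ₚ x) *ₚ p +ₚ v *ₚ (r +ₚ x *ₚ p)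
    ≈⟨ solve 5 (λ u v x p r → (u :- v :* x) :* p :+ v :* (r :+ x :* p) := u :* p :+ v :* r) ≋-refl u v x p r ⟩
  u *ₚ p +ₚ v *ₚ r
    ≈⟨ e ⟩
  const _ ∎)

Cop-resp : ∀ {p r s} → r ≋ s → Cop p r → Cop p s
Cop-resp {s = s} e h = Cop-divisor h (1ₚ , ≋-trans (*ₚ-identityˡ s) (≋-sym e))

-- Bézout over ℚ only yields that p divides c s; the invertible constant coefficient of p removes c.
-- This is why coprimality over ℚ is enough throughout.
Cop-cancel : ∀ {p r s} → Unit₀ p → Cop p r → p divides (r *ₚ s) → p divides s
Cop-cancel {p} {r} {s} up (cop {u} {v} {c} c≢0 e) (x , f) = divides-scale up c≢0
  (u *ₚ s +ₚ v *ₚ x , (begin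
    (u *ₚ s +ₚ v *ₚ x) *ₚ p
      ≈⟨ solve 5 (λ u s v x p → (u :* s :+ v :* x) :* p := u :* s :* p :+ v :* (x :* p)) ≋-refl u s v x p ⟩
    u *ₚ s *ₚ p +ₚ v *ₚ (x *ₚ p)
      ≈⟨ +ₚ-congˡ {u *ₚ s *ₚ p} (*ₚ-congˡ v f) ⟩
    u *ₚ s *ₚ p +ₚ v *ₚ (r *ₚ s)
      ≈⟨ solve 5 (λ u s v r p → u :* s :* p :+ v :* (r :* s) := (u :* p :+ v :* r) :* s) ≋-refl u s v r p ⟩
    (u *ₚ p +ₚ v *ₚ r) *ₚ s
      ≈⟨ ≋-trans (*ₚ-congʳ {s} e) (const-* c s) ⟩
    scaleₚ c s ∎))

-- Cyclotomic polynomials and their coprimality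

module _ (Φ : ℕ → Poly) where

  prod-filter-split : ∀ {P Q R : ℕ → Set} (P? : ∀ i → Dec (P i)) (Q? : ∀ i → Dec (Q i)) (R? : ∀ i → Dec (R i)) →
    (∀ i → Q i → P i × ¬ R i) → (∀ i → R i → P i) → (∀ i → P i → ¬ Q i → R i) → ∀ xs →
    prodₚ (map Φ (filter P? xs)) ≋ (prodₚ (map Φ (filter Q? xs)) *ₚ prodₚ (map Φ (filter R? xs)))
  prod-filter-split P? Q? R? Q⊆ R⊆ ⊆R []       = ≋-sym (*ₚ-identityˡ 1ₚ)
  prod-filter-split P? Q? R? Q⊆ R⊆ ⊆R (i ∷ xs) with P? i | Q? i | R? i | prod-filter-split P? Q? R? Q⊆ R⊆ ⊆R xs
  ... | yes _ | yes _ | no  _ | ih = ≋-trans (*ₚ-congˡ (Φ i) ih) (≋-sym (*ₚ-assoc (Φ i) (prodₚ (map Φ (filter Q? xs))) (prodₚ (map Φ (filter R? xs)))))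
  ... | yes _ | no  _ | yes _ | ih = ≋-trans (*ₚ-congˡ (Φ i) ih)
    (solve 3 (λ x y z → x :* (y :* z) := y :* (x :* z)) ≋-refl (Φ i)
      (prodₚ (map Φ (filter Q? xs))) (prodₚ (map Φ (filter R? xs))))
  ... | no  _ | no  _ | no  _ | ih = ih
  ... | _     | yes q | yes r | _  = ⊥-elim (proj₂ (Q⊆ i q) r)
  ... | yes p | no ¬q | no ¬r | _  = ⊥-elim (¬r (⊆R i p ¬q))
  ... | no ¬p | yes q | no  _ | _  = ⊥-elim (¬p (proj₁ (Q⊆ i q)))
  ... | no ¬p | no  _ | yes r | _  = ⊥-elim (¬p (R⊆ i r))

  ∈⇒divides : ∀ {i xs} → i ∈ xs → Φ i divides prodₚ (map Φ xs)
  ∈⇒divides {xs = i ∷ xs} (here ≡.refl) = divides-*ʳ (prodₚ (map Φ xs)) divides-refl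
  ∈⇒divides {xs = j ∷ xs} (there h)     = divides-*ˡ (Φ j) (∈⇒divides h)

∈-upTo : ∀ {i n} → 1 ≤ i → i ≤ n → i ∈ applyUpTo suc n
∈-upTo {suc i} (s≤s _) i<n = ∈-applyUpTo⁺ suc i<n

-- Numbers above g do not divide g. Thus the divisors of g and of a larger m can be filtered out of
-- the same list.
divisors-extend : ∀ g r → 1 ≤ g → filter (_∣? g) (applyUpTo suc (r ℕ.+ g)) ≡ divisors g
divisors-extend g zero    1≤g = ≡.refl
divisors-extend g (suc r) 1≤g =
  ≡.trans (cong (filter (_∣? g)) (≡.sym (applyUpTo-∷ʳ suc (r ℕ.+ g))))
  (≡.trans (filter-++ (_∣? g) (applyUpTo suc (r ℕ.+ g)) _)
  (≡.trans (cong (filter (_∣? g) (applyUpTo suc (r ℕ.+ g)) ++_)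
      (filter-reject (_∣? g) (λ h → ℕ.<-irrefl ≡.refl (ℕ.≤-trans (s≤s (ℕ.m≤n+m g r)) (ℕ.∣⇒≤ ⦃ ℕ.>-nonZero 1≤g ⦄ h)))))
  (≡.trans (++-identityʳ _) (divisors-extend g r 1≤g))))

module Cyclotomic (Φ : ℕ → Poly) (isCyclotomic : IsCyclotomicFamily Φ) where

  Φ-divides : ∀ {m n} → 1 ≤ m → 1 ≤ n → m ∣ n → Φ m divides (X^ n -ₚ 1ₚ)
  Φ-divides {m} {n} 1≤m 1≤n m∣n = divides-resp (mk≋ (isCyclotomic n 1≤n))
    (∈⇒divides Φ (∈-filter⁺ (_∣? n) (∈-upTo 1≤m (ℕ.∣⇒≤ ⦃ ℕ.>-nonZero 1≤n ⦄ m∣n)) m∣n))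

  Unit₀-Φ : ∀ {n} → 1 ≤ n → Unit₀ (Φ n)
  Unit₀-Φ 1≤n = Unit₀-divisor (Φ-divides 1≤n 1≤n ℕ.∣-refl) (Unit₀-X^-1 1≤n)

  -- The divisors of m are those of g and the rest, and m belongs to the rest because m > g.
  X^-1-factor : ∀ {g m} → 1 ≤ g → g < m → g ∣ m → ∃ λ w → (Φ m *ₚ (w *ₚ (X^ g -ₚ 1ₚ))) ≋ (X^ m -ₚ 1ₚ)
  X^-1-factor {g} {m} 1≤g g<m g∣m = rearrange (∈⇒divides Φ m∈rest)
    where
    1≤m = ℕ.≤-trans 1≤g (ℕ.<⇒≤ g<m)
    Rest? : ∀ i → Dec ((i ∣ m) × ¬ (i ∣ g))
    Rest? i = (i ∣? m) ×-dec ¬? (i ∣? g)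
    rest = filter Rest? (applyUpTo suc m)
    m∈rest : m ∈ rest
    m∈rest = ∈-filter⁺ Rest? (∈-upTo 1≤m ℕ.≤-refl)
      (ℕ.∣-refl , λ m∣g → ℕ.<⇒≱ g<m (ℕ.∣⇒≤ ⦃ ℕ.>-nonZero 1≤g ⦄ m∣g))
    divisors-g : filter (_∣? g) (applyUpTo suc m) ≡ divisors g
    divisors-g = ≡.trans (cong (λ k → filter (_∣? g) (applyUpTo suc k)) (≡.sym (ℕ.m∸n+n≡m (ℕ.<⇒≤ g<m))))
      (divisors-extend g (m ℕ.∸ g) 1≤g)
    rearrange : Φ m divides prodₚ (map Φ rest) → ∃ λ w → (Φ m *ₚ (w *ₚ (X^ g -ₚ 1ₚ))) ≋ (X^ m -ₚ 1ₚ)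
    rearrange (w , e) = w , (begin
      Φ m *ₚ (w *ₚ (X^ g -ₚ 1ₚ))
        ≈⟨ solve 3 (λ f w x → f :* (w :* x) := x :* (w :* f)) ≋-refl (Φ m) w (X^ g -ₚ 1ₚ) ⟩
      (X^ g -ₚ 1ₚ) *ₚ (w *ₚ Φ m)
        ≈⟨ *ₚ-cong (≋-sym (mk≋ {prodₚ (map Φ (divisors g))} {X^ g -ₚ 1ₚ} (isCyclotomic g 1≤g))) e ⟩
      prodₚ (map Φ (divisors g)) *ₚ prodₚ (map Φ rest)
        ≈⟨ *ₚ-congʳ {prodₚ (map Φ rest)} (≋-reflexive (cong (λ xs → prodₚ (map Φ xs)) (≡.sym divisors-g))) ⟩
      prodₚ (map Φ (filter (_∣? g) (applyUpTo suc m))) *ₚ prodₚ (map Φ rest)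
        ≈⟨ prod-filter-split Φ (_∣? m) (_∣? g) Rest? (λ i i∣g → ℕ.∣-trans i∣g g∣m , λ (_ , ∤) → ∤ i∣g)
             (λ _ → proj₁) (λ _ → _,_) (applyUpTo suc m) ⟨
      prodₚ (map Φ (divisors m))
        ≈⟨ mk≋ (isCyclotomic m 1≤m) ⟩
      X^ m -ₚ 1ₚ ∎)

  -- X^m - 1 is squarefree because θ (X^m - 1) = m X^m.
  Cop-Φ-proper : ∀ {g m} → 1 ≤ g → g < m → g ∣ m → Cop (Φ m) (X^ g -ₚ 1ₚ)
  Cop-Φ-proper {g} {m} 1≤g g<m g∣m = from (X^-1-factor 1≤g g<m g∣m)
    where
    B = X^ g -ₚ 1ₚ ; A = Φ m
    from : (∃ λ w → (A *ₚ (w *ₚ B)) ≋ (X^ m -ₚ 1ₚ)) → Cop A B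
    from (w , e) = cop {u = θ (w *ₚ B)} {θ A *ₚ w -ₚ const (+ m) *ₚ (A *ₚ w)} {+ m}
      (λ h → ℕ.<⇒≢ (ℕ.≤-trans (s≤s z≤n) g<m) (≡.sym (ℤ.+-injective h))) (begin
        θ (w *ₚ B) *ₚ A +ₚ (θ A *ₚ w -ₚ const (+ m) *ₚ (A *ₚ w)) *ₚ B
          ≈⟨ solve 6 (λ A w B c tA tw → tw :* A :+ (tA :* w :- c :* (A :* w)) :* B
               := (tA :* (w :* B) :+ A :* tw) :- c :* (A :* (w :* B))) ≋-refl A w B (const (+ m)) (θ A) (θ (w *ₚ B)) ⟩
        (θ A *ₚ (w *ₚ B) +ₚ A *ₚ θ (w *ₚ B)) -ₚ const (+ m) *ₚ (A *ₚ (w *ₚ B))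
          ≈⟨ +ₚ-cong (≋-trans (≋-sym (θ-* A (w *ₚ B))) (θ-cong e)) (negₚ-cong (*ₚ-congˡ (const (+ m)) e)) ⟩
        θ (X^ m -ₚ 1ₚ) -ₚ const (+ m) *ₚ (X^ m -ₚ 1ₚ)
          ≈⟨ +ₚ-congʳ {negₚ (const (+ m) *ₚ (X^ m -ₚ 1ₚ))} (begin
               θ (X^ m -ₚ 1ₚ)             ≈⟨ θ-+ (X^ m) (negₚ 1ₚ) ⟩
               θ (X^ m) +ₚ θ (negₚ 1ₚ)    ≈⟨ +ₚ-cong (θ-X^ m) 0∷[]≋0 ⟩
               scaleₚ (+ m) (X^ m) +ₚ 0ₚ  ≈⟨ ≋-trans (+ₚ-identityʳ (scaleₚ (+ m) (X^ m))) (≋-sym (const-* (+ m) (X^ m))) ⟩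
               const (+ m) *ₚ X^ m        ∎) ⟩
        const (+ m) *ₚ X^ m -ₚ const (+ m) *ₚ (X^ m -ₚ 1ₚ)
          ≈⟨ solve 2 (λ c x → c :* x :- c :* (x :- con 1ℤ) := c) ≋-refl (const (+ m)) (X^ m) ⟩
        const (+ m) ∎)

  -- The gcd g of m and k is a proper divisor of m. By Bézout's identity, g + yk = xm or g + xm =
  -- yk, so X^g - 1 is a multiple of X^k - 1 modulo X^m - 1, and coprimality passes from X^g - 1 to
  -- X^k - 1.
  Cop-Φ-X^-1 : ∀ {m k} → 1 ≤ m → ¬ m ∣ k → Cop (Φ m) (X^ k -ₚ 1ₚ)
  Cop-Φ-X^-1 {m} {k} 1≤m m∤k with Bézout.lemma m k
  ... | Bézout.result g (GCD.is (g∣m , g∣k) _) b = from b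
    where
    1≤g : 1 ≤ g
    1≤g = ℕ.n≢0⇒n>0 λ { ≡.refl → ℕ.<⇒≢ 1≤m (≡.sym (ℕ.0∣⇒≡0 g∣m)) }
    base : Cop (Φ m) (X^ g -ₚ 1ₚ)
    base = Cop-Φ-proper 1≤g (ℕ.≤∧≢⇒< (ℕ.∣⇒≤ ⦃ ℕ.>-nonZero 1≤m ⦄ g∣m) (λ { ≡.refl → m∤k g∣k })) g∣m
    multiple : ∀ b → Φ m divides (X^ (b ℕ.* m) -ₚ 1ₚ)
    multiple b = divides-trans (Φ-divides 1≤m 1≤m ℕ.∣-refl) (X^-1-multiple m b)
    from : Bézout.Identity g m k → Cop (Φ m) (X^ k -ₚ 1ₚ)
    from (Bézout.+- x y eq) = Cop-divisor
      (Cop-resp (begin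
          (X^ g -ₚ 1ₚ) +ₚ negₚ (X^ (x ℕ.* m) -ₚ 1ₚ)
            ≈⟨ +ₚ-congˡ {X^ g -ₚ 1ₚ} (negₚ-cong (≋-trans (≋-reflexive (cong (λ i → X^ i -ₚ 1ₚ) (≡.sym eq))) (X^-1-+ g (y ℕ.* k)))) ⟩
          (X^ g -ₚ 1ₚ) +ₚ negₚ (X^ g *ₚ (X^ (y ℕ.* k) -ₚ 1ₚ) +ₚ (X^ g -ₚ 1ₚ))
            ≈⟨ solve 2 (λ x y → y :+ :- (x :+ y) := :- x) ≋-refl (X^ g *ₚ (X^ (y ℕ.* k) -ₚ 1ₚ)) (X^ g -ₚ 1ₚ) ⟩
          negₚ (X^ g *ₚ (X^ (y ℕ.* k) -ₚ 1ₚ)) ∎)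
        (Cop-+-multiple base (divides-neg (multiple x))))
      (divides-neg (divides-*ˡ (X^ g) (X^-1-multiple k y)))
    from (Bézout.-+ x y eq) = Cop-divisor
      (Cop-resp (≋-trans (+ₚ-comm (X^ g -ₚ 1ₚ) (X^ g *ₚ (X^ (x ℕ.* m) -ₚ 1ₚ)))
          (≋-trans (≋-sym (X^-1-+ g (x ℕ.* m))) (≋-reflexive (cong (λ i → X^ i -ₚ 1ₚ) eq))))
        (Cop-+-multiple base (divides-*ˡ (X^ g) (multiple x))))
      (X^-1-multiple k y)

  Cop-Φ-Φ : ∀ {a b} → 1 ≤ a → 1 ≤ b → a ≢ b → Cop (Φ a) (Φ b)
  Cop-Φ-Φ {a} {b} 1≤a 1≤b a≢b with a ∣? b
  ... | no a∤b  = Cop-divisor (Cop-Φ-X^-1 1≤a a∤b) (Φ-divides 1≤b 1≤b ℕ.∣-refl)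
  ... | yes a∣b = Cop-sym (Cop-divisor (Cop-Φ-X^-1 1≤b (λ b∣a → a≢b (ℕ.∣-antisym a∣b b∣a)))
    (Φ-divides 1≤a 1≤a ℕ.∣-refl))

-- Reduced numerators and divisibility by [n]Φ_n

X^-1-qint : ∀ n → (X^ n -ₚ 1ₚ) ≋ ((X^ 1 -ₚ 1ₚ) *ₚ qint n)
X^-1-qint zero    = ≋-trans (-ₚ-inverseʳ 1ₚ) (≋-sym (*ₚ-zeroʳ (X^ 1 -ₚ 1ₚ)))
X^-1-qint (suc n) = begin
  X^ (1 ℕ.+ n) -ₚ 1ₚ
    ≈⟨ X^-1-+ 1 n ⟩
  X *ₚ (X^ n -ₚ 1ₚ) +ₚ (X -ₚ 1ₚ)
    ≈⟨ +ₚ-cong (*ₚ-congˡ X (X^-1-qint n)) (≋-refl {X -ₚ 1ₚ}) ⟩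
  X *ₚ ((X -ₚ 1ₚ) *ₚ qint n) +ₚ (X -ₚ 1ₚ)
    ≈⟨ solve 2 (λ x y → x :* ((x :- con 1ℤ) :* y) :+ (x :- con 1ℤ) := (x :- con 1ℤ) :* (con 1ℤ :+ x :* y)) ≋-refl X (qint n) ⟩
  (X -ₚ 1ₚ) *ₚ (1ₚ +ₚ X *ₚ qint n)
    ≈⟨ *ₚ-congˡ (X -ₚ 1ₚ) (+ₚ-cong (≋-refl {1ₚ}) (X-* (qint n))) ⟩
  (X -ₚ 1ₚ) *ₚ qint (suc n) ∎

-- The fractions a₀/b₀ and x/s are equal, so x b₀ = s a₀; I divides the left side and is prime to s.
vanishing-numerator : ∀ {a b a₀ b₀ g I s x} → Unit₀ b → (a₀ *ₚ g) ≋ a → (b₀ *ₚ g) ≋ b →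
  Unit₀ I → Cop I s → (a *ₚ s) ≋ (x *ₚ b) → I divides x → I divides a₀
vanishing-numerator {a} {b} {a₀} {b₀} {g} {I} {s} {x} ub a≋ b≋ uI I⊥s as≋xb I∣x =
  Cop-cancel uI I⊥s (divides-resp xb₀≋sa₀ (divides-*ʳ b₀ I∣x))
  where
  xb₀≋sa₀ : (x *ₚ b₀) ≋ (s *ₚ a₀)
  xb₀≋sa₀ = *ₚ-cancelˡ {g} (Unit₀-divisor (b₀ , b≋) ub) (begin
    g *ₚ (x *ₚ b₀)    ≈⟨ solve 3 (λ g x b → g :* (x :* b) := x :* (b :* g)) ≋-refl g x b₀ ⟩
    x *ₚ (b₀ *ₚ g)    ≈⟨ *ₚ-congˡ x b≋ ⟩
    x *ₚ b            ≈⟨ as≋xb ⟨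
    a *ₚ s            ≈⟨ *ₚ-cong (≋-sym a≋) (≋-refl {s}) ⟩
    a₀ *ₚ g *ₚ s      ≈⟨ solve 3 (λ a g s → a :* g :* s := g :* (s :* a)) ≋-refl a₀ g s ⟩
    g *ₚ (s *ₚ a₀)    ∎)

-- The gcd found by `reduction` is not explicit, so divisibility is asked for whatever common factor
-- g has been cancelled.
≡0mod-reduced : ∀ {a b P} → Unit₀ b →
  (∀ a₀ b₀ g → (a₀ *ₚ g) ≋ a → (b₀ *ₚ g) ≋ b → P divides a₀) → (a , b) ≡0mod P
≡0mod-reduced {a} {b} {P} ub h = from (reduction a b ub)
  where
  from : Reduction a b → (a , b) ≡0mod P
  from record { g = g ; a₀ = a₀ ; b₀ = b₀ ; a≋ = a≋ ; b≋ = b≋ ; coprime = coprime } =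
    a₀ , b₀ , b₀≉0 , at ab₀≋a₀b , coprime , _divides_.quotient P∣a₀ , at (_divides_.quotient* P∣a₀)
    where
    P∣a₀ : P divides a₀
    P∣a₀ = h a₀ b₀ g a≋ b≋
    b₀≉0 : ¬ (b₀ ≈ 0ₚ)
    b₀≉0 e with Unit₀-resp {b₀} {0ₚ} (mk≋ e) (Unit₀-divisor (g , ≋-trans (*ₚ-comm g b₀) b≋) ub)
    ... | z , f with ≡.trans (≡.sym (ℤ.*-zeroʳ z)) f
    ...   | ()
    ab₀≋a₀b : (a *ₚ b₀) ≋ (a₀ *ₚ b)
    ab₀≋a₀b = begin
      a *ₚ b₀           ≈⟨ *ₚ-cong (≋-sym a≋) (≋-refl {b₀}) ⟩
      a₀ *ₚ g *ₚ b₀     ≈⟨ solve 3 (λ a g b → a :* g :* b := a :* (b :* g)) ≋-refl a₀ g b₀ ⟩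
      a₀ *ₚ (b₀ *ₚ g)   ≈⟨ *ₚ-congˡ a₀ b≋ ⟩
      a₀ *ₚ b           ∎

module CyclotomicProduct (Φ : ℕ → Poly) (isCyclotomic : IsCyclotomicFamily Φ) where
  open Cyclotomic Φ isCyclotomic

  Cop-prod : ∀ {m xs} → 1 ≤ m → All (1 ≤_) xs → All (m ≢_) xs → Cop (Φ m) (prodₚ (map Φ xs))
  Cop-prod 1≤m []           []           = Cop-1
  Cop-prod 1≤m (1≤x ∷ 1≤xs) (m≢x ∷ m≢xs) = Cop-* (Cop-Φ-Φ 1≤m 1≤x m≢x) (Cop-prod 1≤m 1≤xs m≢xs)

  prod-divides : ∀ {xs p} → Unique xs → All (1 ≤_) xs → All (λ m → Φ m divides p) xs →
    prodₚ (map Φ xs) divides p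
  prod-divides {[]} {p} [] [] [] = p , *ₚ-identityʳ p
  prod-divides {m ∷ xs} {p} (m∉xs ∷ uniq) (1≤m ∷ 1≤xs) (Φm∣p ∷ Φ∣p) = from (prod-divides uniq 1≤xs Φ∣p)
    where
    Π = prodₚ (map Φ xs)
    from : Π divides p → (Φ m *ₚ Π) divides p
    from (w , e) = divides-resp e (divides-* (Cop-cancel (Unit₀-Φ 1≤m) (Cop-prod 1≤m 1≤xs m∉xs)
      (divides-resp (≋-trans (≋-sym e) (*ₚ-comm w Π)) Φm∣p)) divides-refl)

  X^-1-divides-by-Φ : ∀ {n p} → 1 ≤ n → (∀ m → 1 ≤ m → m ∣ n → Φ m divides p) → (X^ n -ₚ 1ₚ) divides p
  X^-1-divides-by-Φ {n} {p} 1≤n h = from (prod-divides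
      (Unique.filter⁺ (_∣? n) (Unique.applyUpTo⁺₁ suc n (λ i<j _ e → ℕ.<⇒≢ i<j (ℕ.suc-injective e))))
      (All.tabulate 1≤divisor)
      (All.tabulate (λ m∈ → h _ (1≤divisor m∈) (proj₂ (∈-filter⁻ (_∣? n) {xs = applyUpTo suc n} m∈)))))
    where
    1≤divisor : ∀ {m} → m ∈ divisors n → 1 ≤ m
    1≤divisor m∈ with ∈-applyUpTo⁻ suc (proj₁ (∈-filter⁻ (_∣? n) {xs = applyUpTo suc n} m∈))
    ... | _ , _ , ≡.refl = s≤s z≤n
    from : prodₚ (map Φ (divisors n)) divides p → (X^ n -ₚ 1ₚ) divides p
    from (w , e) = w , ≋-trans (*ₚ-congˡ w (≋-sym (mk≋ {prodₚ (map Φ (divisors n))} {X^ n -ₚ 1ₚ} (isCyclotomic n 1≤n)))) e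

  -- Multiplication by q - 1 turns [n] into q^n - 1, whose cyclotomic factorisation is given, and
  -- supplies the factor Φ_1. Of the two factors Φ_n of p, one is set aside and the other stays in
  -- t, so that all Φ_m with m dividing n divide t.
  [n]Φₙ-divides : ∀ {n p} → 1 < n → (Φ n *ₚ Φ n) divides p →
    (∀ m → 1 < m → m < n → m ∣ n → Φ m divides p) → (qint n *ₚ Φ n) divides p
  [n]Φₙ-divides {n} {p} 1<n (y , e) h = from (X^-1-divides-by-Φ 1≤n Φ∣t)
    where
    1≤n = ℕ.<⇒≤ 1<n
    x = X^ 1 -ₚ 1ₚ
    t = Φ n *ₚ (y *ₚ x)
    Φn*t : (x *ₚ p) ≋ (Φ n *ₚ t)
    Φn*t = ≋-trans (*ₚ-congˡ x (≋-sym e))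
      (solve 3 (λ x y f → x :* (y :* (f :* f)) := f :* (f :* (y :* x))) ≋-refl x y (Φ n))
    Φ∣t : ∀ m → 1 ≤ m → m ∣ n → Φ m divides t
    Φ∣t m 1≤m m∣n with m ℕ.≟ n | m ℕ.≟ 1
    ... | yes ≡.refl | _          = divides-*ʳ (y *ₚ x) divides-refl
    ... | no _       | yes ≡.refl = divides-*ˡ (Φ n) (divides-*ˡ y (Φ-divides 1≤m 1≤m ℕ.∣-refl))
    ... | no m≢n     | no m≢1     = Cop-cancel (Unit₀-Φ 1≤m) (Cop-Φ-Φ 1≤m 1≤n m≢n)
      (divides-resp Φn*t (divides-*ˡ x (h m (ℕ.≤∧≢⇒< 1≤m (λ e → m≢1 (≡.sym e)))
        (ℕ.≤∧≢⇒< (ℕ.∣⇒≤ ⦃ ℕ.>-nonZero 1≤n ⦄ m∣n) m≢n) m∣n)))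
    from : (X^ n -ₚ 1ₚ) divides t → (qint n *ₚ Φ n) divides p
    from (w , f) = w , *ₚ-cancelˡ {x} (Unit₀-X^-1 {1} (s≤s z≤n)) (begin
      x *ₚ (w *ₚ (qint n *ₚ Φ n))
        ≈⟨ solve 4 (λ x w q f → x :* (w :* (q :* f)) := w :* (x :* q) :* f) ≋-refl x w (qint n) (Φ n) ⟩
      w *ₚ (x *ₚ qint n) *ₚ Φ n
        ≈⟨ *ₚ-cong (≋-trans (*ₚ-congˡ w (≋-sym (X^-1-qint n))) f) (≋-refl {Φ n}) ⟩
      t *ₚ Φ n
        ≈⟨ *ₚ-comm t (Φ n) ⟩
      Φ n *ₚ t
        ≈⟨ Φn*t ⟨
      x *ₚ p ∎)

-- Quotients and localisations of ℤ[q]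

module Quotient (I : Poly) where

  infix 4 _≡ᴵ_
  record _≡ᴵ_ (p r : Poly) : Set where
    constructor mk≡
    field difference : I divides (p -ₚ r)
  open _≡ᴵ_ public

  ≋⇒≡ᴵ : ∀ {p r} → p ≋ r → p ≡ᴵ r
  ≋⇒≡ᴵ {p} {r} e = mk≡ (divides-resp
    (≋-trans (≋-sym (-ₚ-inverseʳ r)) (+ₚ-cong (≋-sym e) (≋-refl {negₚ r}))) divides-0)

  quotientRing : CommutativeRing 0ℓ 0ℓ
  quotientRing = record
    { Carrier = Poly ; _≈_ = _≡ᴵ_ ; _+_ = _+ₚ_ ; _*_ = _*ₚ_ ; -_ = negₚ ; 0# = 0ₚ ; 1# = 1ₚ
    ; isCommutativeRing = record
      { isRing = record
        { +-isAbelianGroup = record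
          { isGroup = record
            { isMonoid = record
              { isSemigroup = record
                { isMagma = record
                  { isEquivalence = record
                    { refl  = ≋⇒≡ᴵ ≋-refl
                    ; sym   = λ {p} {r} (mk≡ d) → mk≡ (divides-resp
                        (solve 2 (λ p r → :- (p :- r) := r :- p) ≋-refl p r) (divides-neg d))
                    ; trans = λ {p} {r} {s} (mk≡ d) (mk≡ e) → mk≡ (divides-resp
                        (solve 3 (λ p r s → (p :- r) :+ (r :- s) := p :- s) ≋-refl p r s) (divides-+ d e)) }
                  ; ∙-cong = λ {p} {p′} {r} {r′} (mk≡ d) (mk≡ e) → mk≡ (divides-resp
                      (solve 4 (λ p p′ r r′ → (p :- p′) :+ (r :- r′) := (p :+ r) :- (p′ :+ r′)) ≋-refl p p′ r r′)
                      (divides-+ d e)) }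
                ; assoc = λ p r s → ≋⇒≡ᴵ (+ₚ-assoc p r s) }
              ; identity = (λ p → ≋⇒≡ᴵ (+ₚ-identityˡ p)) , (λ p → ≋⇒≡ᴵ (+ₚ-identityʳ p)) }
            ; inverse = (λ p → ≋⇒≡ᴵ (negₚ-inverseˡ p)) , (λ p → ≋⇒≡ᴵ (negₚ-inverseʳ p))
            ; ⁻¹-cong = λ {p} {r} (mk≡ d) → mk≡ (divides-resp
                (solve 2 (λ p r → :- (p :- r) := :- p :- :- r) ≋-refl p r) (divides-neg d)) }
          ; comm = λ p r → ≋⇒≡ᴵ (+ₚ-comm p r) }
        ; *-cong = λ {p} {p′} {r} {r′} (mk≡ d) (mk≡ e) → mk≡ (divides-resp
            (solve 4 (λ p p′ r r′ → (p :- p′) :* r :+ p′ :* (r :- r′) := p :* r :- p′ :* r′) ≋-refl p p′ r r′)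
            (divides-+ (divides-*ʳ r d) (divides-*ˡ p′ e)))
        ; *-assoc = λ p r s → ≋⇒≡ᴵ (*ₚ-assoc p r s)
        ; *-identity = (λ p → ≋⇒≡ᴵ (*ₚ-identityˡ p)) , (λ p → ≋⇒≡ᴵ (*ₚ-identityʳ p))
        ; distrib = (λ p r s → ≋⇒≡ᴵ (*ₚ-distribˡ p r s)) , (λ p r s → ≋⇒≡ᴵ (*ₚ-distribʳ p r s)) }
      ; *-comm = λ p r → ≋⇒≡ᴵ (*ₚ-comm p r) } }

-- The localisation at S of ℤ[q]/I, with the relation f ⇝ x that the fraction f, whose
-- denominator need not lie in S, has the value x there.
record Specialisation (I : Poly) (S : Poly → Set) : Set₁ where
  field K : CommutativeRing 0ℓ 0ℓ
  open CommutativeRing K using (Carrier; 0#; 1#; _+_; _*_; -_) renaming (_≈_ to _∼_)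
  infix 4 _⇝_
  field
    ι       : Poly → Carrier
    ι-mod   : ∀ {p r} → I divides (p -ₚ r) → ι p ∼ ι r
    ι-+     : ∀ p r → ι (p +ₚ r) ∼ ι p + ι r
    ι-*     : ∀ p r → ι (p *ₚ r) ∼ ι p * ι r
    ι-neg   : ∀ p → ι (negₚ p) ∼ - ι p
    ι-0     : ι 0ₚ ∼ 0#
    ι-1     : ι 1ₚ ∼ 1#
    ι-inv   : ∀ {s} → S s → ∃ λ x → ι s * x ∼ 1#
    _⇝_     : Frac → Carrier → Set
    ⇝-resp  : ∀ {p p′ r r′ x x′} → p ≋ p′ → r ≋ r′ → x ∼ x′ → (p , r) ⇝ x → (p′ , r′) ⇝ x′
    ⇝-+     : ∀ {f g x y} → f ⇝ x → g ⇝ y → (f +f g) ⇝ (x + y)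
    ⇝-*     : ∀ {p p′ r r′ x y} → (p , r) ⇝ x → (p′ , r′) ⇝ y → (p *ₚ p′ , r *ₚ r′) ⇝ (x * y)
    ⇝-intro : ∀ {p r s t x} → S s → (p *ₚ s) ≋ (t *ₚ r) → ι s * x ∼ ι t → (p , r) ⇝ x
    ⇝-0     : ∀ {p r} → (p , r) ⇝ 0# → ∃₂ λ s t → S s × (p *ₚ s) ≋ (t *ₚ r) × I divides t

-- A fraction has the value x if it equals some a/s with s in S whose class is x. That equality is
-- by cross multiplication in ℤ[q] itself, not modulo I: this allows factors that vanish modulo I to
-- cancel beforehand.
specialisation : ∀ {I} {S : Poly → Set} → Unit₀ I → S 1ₚ → (∀ {s t} → S s → S t → S (s *ₚ t)) →
  (∀ {s} → S s → Cop I s) → Specialisation I S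
specialisation {I} {S} uI S-1 S-* S⇒Cop = record
  { K = K
  ; ι = ι
  ; ι-mod = λ {p} {r} d → mk≃ (Q.*-congʳ {1ₚ} {p} {r} (mk≡ d))
  ; ι-+ = λ p r → mk≃ (≋⇒≡ᴵ (solve 2 (λ p r → (p :+ r) :* (con 1ℤ :* con 1ℤ)
      := (p :* con 1ℤ :+ r :* con 1ℤ) :* con 1ℤ) ≋-refl p r))
  ; ι-* = λ p r → mk≃ (≋⇒≡ᴵ (solve 2 (λ p r → (p :* r) :* (con 1ℤ :* con 1ℤ)
      := p :* r :* con 1ℤ) ≋-refl p r))
  ; ι-neg = λ p → K.refl
  ; ι-0 = K.refl
  ; ι-1 = K.refl
  ; ι-inv = λ {s} h → 1ₚ / s [ h ] , mk≃ (≋⇒≡ᴵ (solve 1 (λ s → s :* con 1ℤ :* con 1ℤ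
      := con 1ℤ :* (con 1ℤ :* s)) ≋-refl s))
  ; _⇝_ = _⇝_
  ; ⇝-resp = λ e f g → λ { (a / s [ h ] , k , l) → (a / s [ h ]) ,
      ≋-trans (*ₚ-cong (≋-sym e) (≋-refl {s})) (≋-trans k (*ₚ-congˡ a f)) , K.trans l g }
  ; ⇝-+ = λ { {p , r} {p′ , r′} (a / s [ h ] , k , l) (b / t [ h′ ] , k′ , l′) →
      (a / s [ h ]) K.+ (b / t [ h′ ]) , (begin
        (p *ₚ r′ +ₚ p′ *ₚ r) *ₚ (s *ₚ t)
          ≈⟨ solve 6 (λ p r p′ r′ s t → (p :* r′ :+ p′ :* r) :* (s :* t)
               := (p :* s) :* (r′ :* t) :+ (p′ :* t) :* (r :* s)) ≋-refl p r p′ r′ s t ⟩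
        (p *ₚ s) *ₚ (r′ *ₚ t) +ₚ (p′ *ₚ t) *ₚ (r *ₚ s)
          ≈⟨ +ₚ-cong (*ₚ-cong k (≋-refl {r′ *ₚ t})) (*ₚ-cong k′ (≋-refl {r *ₚ s})) ⟩
        (a *ₚ r) *ₚ (r′ *ₚ t) +ₚ (b *ₚ r′) *ₚ (r *ₚ s)
          ≈⟨ solve 6 (λ a r b r′ s t → (a :* r) :* (r′ :* t) :+ (b :* r′) :* (r :* s)
               := (a :* t :+ b :* s) :* (r :* r′)) ≋-refl a r b r′ s t ⟩
        (a *ₚ t +ₚ b *ₚ s) *ₚ (r *ₚ r′) ∎) , K.+-cong l l′ }
  ; ⇝-* = λ { {p} {p′} {r} {r′} (a / s [ h ] , k , l) (b / t [ h′ ] , k′ , l′) →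
      (a / s [ h ]) K.* (b / t [ h′ ]) , (begin
        p *ₚ p′ *ₚ (s *ₚ t)
          ≈⟨ solve 4 (λ p p′ s t → p :* p′ :* (s :* t) := p :* s :* (p′ :* t)) ≋-refl p p′ s t ⟩
        p *ₚ s *ₚ (p′ *ₚ t)
          ≈⟨ *ₚ-cong k k′ ⟩
        a *ₚ r *ₚ (b *ₚ r′)
          ≈⟨ solve 4 (λ a r b r′ → a :* r :* (b :* r′) := a :* b :* (r :* r′)) ≋-refl a r b r′ ⟩
        a *ₚ b *ₚ (r *ₚ r′) ∎) , K.*-cong l l′ }
  ; ⇝-intro = λ { {s = s} {t} {b / u [ h′ ]} h k (mk≃ l) → t / s [ h ] , k ,
      mk≃ (Q.trans (≋⇒≡ᴵ (solve 2 (λ t u → t :* u := t :* (con 1ℤ :* u)) ≋-refl t u))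
        (Q.trans (Q.sym l) (≋⇒≡ᴵ (solve 2 (λ s b → s :* b :* con 1ℤ := b :* s) ≋-refl s b)))) }
  ; ⇝-0 = λ { (a / s [ h ] , k , mk≃ (mk≡ l)) → s , a , h , k ,
      divides-resp (solve 2 (λ a s → a :* con 1ℤ :- con 0ℤ :* s := a) ≋-refl a s) l } }
  where
  open Quotient I
  module Q = CommutativeRing quotientRing
  open Fractions quotientRing S
  S-cancel : ∀ {s x y} → S s → (s *ₚ x) ≡ᴵ (s *ₚ y) → x ≡ᴵ y
  S-cancel {s} {x} {y} h (mk≡ d) = mk≡ (Cop-cancel uI (S⇒Cop h)
    (divides-resp (solve 3 (λ s x y → s :* x :- s :* y := s :* (x :- y)) ≋-refl s x y) d))
  K = fractionRing S-1 S-* S-cancel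
  module K = CommutativeRing K
  ι : Poly → K.Carrier
  ι p = p / 1ₚ [ S-1 ]
  _⇝_ : Frac → K.Carrier → Set
  (p , r) ⇝ x = ∃ λ f → (p *ₚ den f) ≋ (num f *ₚ r) × f ≃ x

-- Values of the summands, block by block

1-X^-multiple : ∀ {k m} → m ∣ k → (1ₚ -ₚ X^ m) divides (1ₚ -ₚ X^ k)
1-X^-multiple {k} {m} m∣k = from (X^-1-divides m∣k)
  where
  from : (X^ m -ₚ 1ₚ) divides (X^ k -ₚ 1ₚ) → (1ₚ -ₚ X^ m) divides (1ₚ -ₚ X^ k)
  from (w , e) = w , (begin
    w *ₚ (1ₚ -ₚ X^ m)        ≈⟨ solve 2 (λ w x → w :* (con 1ℤ :- x) := :- (w :* (x :- con 1ℤ))) ≋-refl w (X^ m) ⟩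
    negₚ (w *ₚ (X^ m -ₚ 1ₚ))  ≈⟨ negₚ-cong e ⟩
    negₚ (X^ k -ₚ 1ₚ)         ≈⟨ solve 1 (λ x → :- (x :- con 1ℤ) := con 1ℤ :- x) ≋-refl (X^ k) ⟩
    1ₚ -ₚ X^ k               ∎)

module ∏ₚ = RingSums ℤ[q]

poch-+ : ∀ a b i h → poch a b (i ℕ.+ h) ≋ (poch a b h *ₚ ∏ₚ.∏ i (λ l → 1ₚ -ₚ X^ (a ℕ.+ b ℕ.* (l ℕ.+ h))))
poch-+ a b zero    h = ≋-sym (*ₚ-identityʳ (poch a b h))
poch-+ a b (suc i) h = ≋-trans (*ₚ-congʳ {1ₚ -ₚ X^ (a ℕ.+ b ℕ.* (i ℕ.+ h))} (poch-+ a b i h))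
  (*ₚ-assoc (poch a b h) (∏ₚ.∏ i (λ l → 1ₚ -ₚ X^ (a ℕ.+ b ℕ.* (l ℕ.+ h)))) _)

module Evaluation {I : Poly} {S : Poly → Set} (𝒦 : Specialisation I S)
  (S-1 : S 1ₚ) (S-* : ∀ {s t} → S s → S t → S (s *ₚ t))
  (d m′ N : ℕ) (2≤d : 2 ≤ d) (1≤m′ : 1 ≤ m′) (N<m : N < suc m′) (m∣1+dN : suc m′ ∣ 1 ℕ.+ d ℕ.* N)
  (m⊥d : ∀ {k} → suc m′ ∣ d ℕ.* k → suc m′ ∣ k)
  (S-X^ : ∀ {k} → ¬ suc m′ ∣ k → S (1ₚ -ₚ X^ k)) where

  open Specialisation 𝒦
  open CommutativeRing K using (Carrier; 0#; 1#; _+_; _*_; -_; _-_; +-cong; *-cong; *-congˡ; *-congʳ;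
    *-assoc; *-identityˡ; *-identityʳ; +-identityˡ; +-identityʳ; +-assoc; *-commutativeSemigroup; semiring)
    renaming (_≈_ to _∼_; refl to ∼-refl; sym to ∼-sym; trans to ∼-trans; reflexive to ∼-reflexive)
  open Exp semiring using (_^_)
  open import Algebra.Properties.CommutativeSemigroup *-commutativeSemigroup using (x∙yz≈y∙xz)
  open RingSums K

  m : ℕ
  m = suc m′

  ∤-shift : ∀ {h} → m ∣ h → ∀ l → ¬ m ∣ suc l → ¬ m ∣ d ℕ.+ d ℕ.* (l ℕ.+ h)
  ∤-shift {h} m∣h l m∤ m∣ = m∤ (ℕ.∣m+n∣m⇒∣n (≡.subst (m ∣_) (ℕ.+-comm (suc l) h)
    (m⊥d (≡.subst (m ∣_) (≡.sym (ℕ.*-suc d (l ℕ.+ h))) m∣))) m∣h)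

  ι-≋ : ∀ {p r} → p ≋ r → ι p ∼ ι r
  ι-≋ {p} {r} e = ι-mod (Quotient._≡ᴵ_.difference (Quotient.≋⇒≡ᴵ I e))

  ⇝-ι : ∀ p → (p , 1ₚ) ⇝ ι p
  ⇝-ι p = ⇝-intro S-1 ≋-refl (∼-trans (*-congʳ ι-1) (*-identityˡ (ι p)))

  ⇝-cong : ∀ {f x y} → x ∼ y → f ⇝ x → f ⇝ y
  ⇝-cong = ⇝-resp ≋-refl ≋-refl

  ⇝-^ : ∀ {p r x} n → (p , r) ⇝ x → (p ^ₚ n , r ^ₚ n) ⇝ x ^ n
  ⇝-^ zero    h = ⇝-cong ι-1 (⇝-ι 1ₚ)
  ⇝-^ (suc n) h = ⇝-* h (⇝-^ n h)

  a Q t : Carrier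
  a = ι (X^ 1)
  Q = ι (X^ d)
  t = ι (X^ (d ℕ.∸ 2))

  private
    inverse : ∀ k → Dec (m ∣ suc k) → Carrier
    -- A default value: here 1 - q^(d(k+1)) is divisible by 1 - q^m, and `inv-correct` excludes such
    -- k.
    inverse k (yes _)  = 0#
    inverse k (no m∤k) = proj₁ (ι-inv (S-X^ (λ h → m∤k (m⊥d {suc k} h))))

  inv : ℕ → Carrier
  inv k = inverse k (m ∣? suc k)

  open WellPoisedBlock K a Q t N inv

  ι-X^-+ : ∀ k l → ι (X^ (k ℕ.+ l)) ∼ ι (X^ k) * ι (X^ l)
  ι-X^-+ k l = ∼-trans (ι-≋ (X^-+ k l)) (ι-* (X^ k) (X^ l))

  ι-1-X^ : ∀ k → ι (1ₚ -ₚ X^ k) ∼ 1# - ι (X^ k)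
  ι-1-X^ k = ∼-trans (ι-+ 1ₚ (negₚ (X^ k))) (+-cong ι-1 (ι-neg (X^ k)))

  -- Makes the offset h of a block invisible, hence all blocks alike. Modulo Φ_m it is applied to
  -- the multiples h of m; modulo Φ_n², where q^n is not 1, only to h = 0.
  ι-shift : ∀ {h} → I divides (X^ h -ₚ 1ₚ) → ∀ b l → ι (X^ (b ℕ.* (l ℕ.+ h))) ∼ ι (X^ b) ^ l
  ι-shift {h} I∣ b zero    = ∼-trans (ι-mod (divides-trans I∣ (X^-1-multiple h b))) ι-1
  ι-shift {h} I∣ b (suc l) = ∼-trans (∼-reflexive (cong (λ k → ι (X^ k)) (ℕ.*-suc b (l ℕ.+ h))))
    (∼-trans (ι-X^-+ b (b ℕ.* (l ℕ.+ h))) (*-congˡ (ι-shift I∣ b l)))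

  I∣X^0-1 : I divides (X^ 0 -ₚ 1ₚ)
  I∣X^0-1 = divides-resp (≋-sym (-ₚ-inverseʳ 1ₚ)) divides-0

  ι-X^ : ∀ b l → ι (X^ (b ℕ.* l)) ∼ ι (X^ b) ^ l
  ι-X^ b l = ∼-trans (∼-reflexive (cong (λ k → ι (X^ (b ℕ.* k))) (≡.sym (ℕ.+-identityʳ l)))) (ι-shift I∣X^0-1 b l)

  taa : t * a * a ∼ Q
  taa = ∼-trans (*-assoc t a a) (∼-trans (*-congˡ (∼-sym (ι-X^-+ 1 1)))
    (∼-trans (∼-sym (ι-X^-+ (d ℕ.∸ 2) 2)) (∼-reflexive (cong (λ k → ι (X^ k)) (ℕ.m∸n+n≡m 2≤d)))))

  inv-correct : ∀ k → ¬ m ∣ suc k → (1# - Q * Q ^ k) * inv k ∼ 1#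
  inv-correct k m∤k with m ∣? suc k
  ... | yes m∣k = ⊥-elim (m∤k m∣k)
  ... | no _    = ∼-trans (*-congʳ (∼-sym (∼-trans (ι-1-X^ (d ℕ.* suc k)) (1-cong (ι-X^ d (suc k))))))
    (proj₂ (ι-inv _))

  module _ {h : ℕ} (m∣h : m ∣ h) (I∣X^h-1 : I divides (X^ h -ₚ 1ₚ)) where

    σ-value : ∀ l → ¬ m ∣ suc l →
      (1ₚ -ₚ X^ (1 ℕ.+ d ℕ.* (l ℕ.+ h)) , 1ₚ -ₚ X^ (d ℕ.+ d ℕ.* (l ℕ.+ h))) ⇝ σ l
    σ-value l m∤ = ⇝-intro {t = 1ₚ -ₚ X^ (1 ℕ.+ d ℕ.* (l ℕ.+ h))}
      (S-X^ (∤-shift m∣h l m∤))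
      ≋-refl
      (∼-trans (*-congʳ (∼-trans (ι-1-X^ (d ℕ.+ d ℕ.* (l ℕ.+ h))) (1-cong (∼-trans (ι-X^-+ d (d ℕ.* (l ℕ.+ h))) (*-congˡ (ι-shift I∣X^h-1 d l))))))
      (∼-trans (x∙yz≈y∙xz _ _ _) (∼-trans (*-congˡ (inv-correct l m∤)) (∼-trans (*-identityʳ _)
      (∼-sym (∼-trans (ι-1-X^ (1 ℕ.+ d ℕ.* (l ℕ.+ h))) (1-cong (∼-trans (ι-X^-+ 1 (d ℕ.* (l ℕ.+ h))) (*-congˡ (ι-shift I∣X^h-1 d l))))))))))

    poch-value : ∀ {C} → (poch 1 d h , poch d d h) ⇝ C → ∀ i → i < m →
      (poch 1 d (i ℕ.+ h) , poch d d (i ℕ.+ h)) ⇝ C * ∏ i σ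
    poch-value hC zero    _   = ⇝-cong (∼-sym (*-identityʳ _)) hC
    poch-value hC (suc i) i<m = ⇝-cong (*-assoc _ _ _)
      (⇝-* (poch-value hC i (ℕ.<⇒≤ i<m)) (σ-value i (ℕ.>⇒∤ i<m)))

    -- The inverse of 1 - q, which lies in S because m > 1.
    ω : Carrier
    ω = proj₁ (ι-inv (S-X^ {1} (ℕ.>⇒∤ (s≤s 1≤m′))))

    qint-value : ∀ i → ι (qint (2 ℕ.* d ℕ.* (i ℕ.+ h) ℕ.+ 1)) ∼ ω * (1# - a * Q ^ i * Q ^ i)
    qint-value i = invertible-cancelˡ (ω , ω-inverse) (∼-trans (∼-sym (ι-* (1ₚ -ₚ X^ 1) (qint n)))
      (∼-trans (ι-≋ qint-identity) (∼-trans (ι-1-X^ n) (∼-trans (1-cong exponent)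
      (∼-sym (∼-trans (∼-sym (*-assoc _ _ _)) (∼-trans (*-congʳ ω-inverse) (*-identityˡ _))))))))
      where
      k = i ℕ.+ h
      n = 2 ℕ.* d ℕ.* k ℕ.+ 1
      ω-inverse : ι (1ₚ -ₚ X^ 1) * ω ∼ 1#
      ω-inverse = proj₂ (ι-inv (S-X^ {1} (ℕ.>⇒∤ (s≤s 1≤m′))))
      n≡ : n ≡ 1 ℕ.+ d ℕ.* k ℕ.+ d ℕ.* k
      n≡ = ≡.trans (ℕ.+-comm (2 ℕ.* d ℕ.* k) 1) (cong suc (≡.trans (ℕ.*-assoc 2 d k)
        (cong (d ℕ.* k ℕ.+_) (ℕ.+-identityʳ (d ℕ.* k)))))
      exponent : ι (X^ n) ∼ a * Q ^ i * Q ^ i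
      exponent = ∼-trans (∼-reflexive (cong (λ k → ι (X^ k)) n≡))
        (∼-trans (ι-X^-+ (1 ℕ.+ d ℕ.* k) (d ℕ.* k)) (*-cong
          (∼-trans (ι-X^-+ 1 (d ℕ.* k)) (*-congˡ (ι-shift I∣X^h-1 d i))) (ι-shift I∣X^h-1 d i)))
      qint-identity : ((1ₚ -ₚ X^ 1) *ₚ qint n) ≋ (1ₚ -ₚ X^ n)
      qint-identity = begin
        (1ₚ -ₚ X^ 1) *ₚ qint n           ≈⟨ solve 2 (λ x y → (con 1ℤ :- x) :* y := :- ((x :- con 1ℤ) :* y)) ≋-refl (X^ 1) (qint n) ⟩
        negₚ ((X^ 1 -ₚ 1ₚ) *ₚ qint n)    ≈⟨ negₚ-cong (≋-sym (X^-1-qint n)) ⟩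
        negₚ (X^ n -ₚ 1ₚ)                ≈⟨ solve 1 (λ x → :- (x :- con 1ℤ) := con 1ℤ :- x) ≋-refl (X^ n) ⟩
        1ₚ -ₚ X^ n                       ∎

    term-value : ∀ {C} → (poch 1 d h , poch d d h) ⇝ C → ∀ i → i < m →
      term d (i ℕ.+ h) ⇝ ω * C ^ 4 * ((1# - a * Q ^ i * Q ^ i) * τ i)
    term-value {C} hC i i<m = ⇝-resp ≋-refl
      (≋-trans (*ₚ-identityʳ (1ₚ *ₚ poch d d k ^ₚ 4)) (*ₚ-identityˡ (poch d d k ^ₚ 4)))
      (block-term i (qint-value i) (ι-shift I∣X^h-1 (d ℕ.∸ 2) i) C)
      (⇝-* (⇝-* (⇝-ι (qint (2 ℕ.* d ℕ.* k ℕ.+ 1))) (⇝-^ 4 (poch-value hC i i<m))) (⇝-ι (X^ ((d ℕ.∸ 2) ℕ.* k))))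
      where k = i ℕ.+ h

    sum-value : ∀ {C x} → (poch 1 d h , poch d d h) ⇝ C → sumf h (term d) ⇝ x → ∀ i → i ≤ m →
      sumf (i ℕ.+ h) (term d) ⇝ x + ∑ i (λ k → ω * C ^ 4 * ((1# - a * Q ^ k * Q ^ k) * τ k))
    sum-value hC hx zero    _   = ⇝-cong (∼-sym (+-identityʳ _)) hx
    sum-value hC hx (suc i) i<m = ⇝-cong (+-assoc _ _ _)
      (⇝-+ (sum-value hC hx i (ℕ.<⇒≤ i<m)) (term-value hC i i<m))

    -- Across a whole block only the last denominator factor, 1 - q^(d(m+h)), is outside S; it is s
    -- (1 - q^m) with s in S. The numerator factor of index N, with exponent 1 + d(N + h) divisible
    -- by m, supplies a matching 1 - q^m, so the quotient still has a value.
    poch-block : (∀ k → 1 ≤ k → ∃ λ s → S s × (s *ₚ (1ₚ -ₚ X^ m)) ≋ (1ₚ -ₚ X^ (k ℕ.* m))) →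
      ∀ {C} → (poch 1 d h , poch d d h) ⇝ C → ∃ λ C′ → (poch 1 d (m ℕ.+ h) , poch d d (m ℕ.+ h)) ⇝ C′
    poch-block S-quotient {C} hC = from numerator (last m∣last)
      where
      factor : ℕ → ℕ → Poly
      factor b l = 1ₚ -ₚ X^ (b ℕ.+ d ℕ.* (l ℕ.+ h))
      m∣last : m ∣ d ℕ.+ d ℕ.* (m′ ℕ.+ h)
      m∣last = ≡.subst (m ∣_) (ℕ.*-suc d (m′ ℕ.+ h)) (ℕ.∣n⇒∣m*n d (ℕ.∣m∣n⇒∣m+n ℕ.∣-refl m∣h))
      last : m ∣ d ℕ.+ d ℕ.* (m′ ℕ.+ h) → ∃ λ s → S s × (s *ₚ (1ₚ -ₚ X^ m)) ≋ factor d m′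
      last (ℕ.divides k e) = from′ (S-quotient k 1≤k)
        where
        1≤k : 1 ≤ k
        1≤k = ℕ.n≢0⇒n>0 λ { ≡.refl → ℕ.<⇒≢ (ℕ.≤-trans (ℕ.≤-trans (s≤s z≤n) 2≤d) (ℕ.m≤m+n d _)) (≡.sym e) }
        from′ : (∃ λ s → S s × (s *ₚ (1ₚ -ₚ X^ m)) ≋ (1ₚ -ₚ X^ (k ℕ.* m))) → _
        from′ (s , hs , f) = s , hs , ≋-trans f (≋-reflexive (cong (λ i → 1ₚ -ₚ X^ i) (≡.sym e)))
      numerator : (1ₚ -ₚ X^ m) divides ∏ₚ.∏ m (factor 1)
      numerator = divides-resp (≋-sym (proj₂ split)) (divides-*ʳ (proj₁ split) (1-X^-multiple
          (≡.subst (m ∣_) (cong suc (≡.sym (ℕ.*-distribˡ-+ d N h))) (ℕ.∣m∣n⇒∣m+n m∣1+dN (ℕ.∣n⇒∣m*n d m∣h)))))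
        where
        split : ∃ λ x → ∏ₚ.∏ m (factor 1) ≋ (factor 1 N *ₚ x)
        split = ∏ₚ.∏-factor m N N<m ≋-refl
      S-∏ : ∀ i → i < m → S (∏ₚ.∏ i (factor d))
      S-∏ zero    _   = S-1
      S-∏ (suc i) i<m = S-* (S-∏ i (ℕ.<⇒≤ i<m)) (S-X^ (∤-shift m∣h i (ℕ.>⇒∤ i<m)))
      from : (1ₚ -ₚ X^ m) divides ∏ₚ.∏ m (factor 1) → (∃ λ s → S s × (s *ₚ (1ₚ -ₚ X^ m)) ≋ factor d m′) →
        ∃ λ C′ → (poch 1 d (m ℕ.+ h) , poch d d (m ℕ.+ h)) ⇝ C′
      from (w , e) (s , hs , f) = _ , ⇝-resp (≋-sym (poch-+ 1 d m h)) (≋-sym (poch-+ d d m h)) ∼-refl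
        (⇝-* hC (⇝-intro {s = Π *ₚ s} {t = w} S-Πs (begin
            ∏ₚ.∏ m (factor 1) *ₚ (Π *ₚ s)
              ≈⟨ *ₚ-cong (≋-sym e) (≋-refl {Π *ₚ s}) ⟩
            w *ₚ (1ₚ -ₚ X^ m) *ₚ (Π *ₚ s)
              ≈⟨ solve 4 (λ w x p s → w :* x :* (p :* s) := w :* (p :* (s :* x))) ≋-refl w (1ₚ -ₚ X^ m) Π s ⟩
            w *ₚ (Π *ₚ (s *ₚ (1ₚ -ₚ X^ m)))
              ≈⟨ *ₚ-congˡ w (*ₚ-congˡ Π f) ⟩
            w *ₚ ∏ₚ.∏ m (factor d) ∎)
          (∼-trans (x∙yz≈y∙xz _ _ _) (∼-trans (*-congˡ (proj₂ (ι-inv S-Πs))) (*-identityʳ (ι w))))))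
        where
        Π = ∏ₚ.∏ m′ (factor d)
        S-Πs : S (Π *ₚ s)
        S-Πs = S-* (S-∏ m′ ℕ.≤-refl) hs

  1≤N : 1 ≤ N
  1≤N = ℕ.n≢0⇒n>0 λ { ≡.refl → ℕ.>⇒∤ (s≤s 1≤m′) (≡.subst (λ k → m ∣ 1 ℕ.+ k) (ℕ.*-zeroʳ d) m∣1+dN) }

  module _ (I∣[1-y]² : I divides ((1ₚ -ₚ X^ (1 ℕ.+ d ℕ.* N)) *ₚ (1ₚ -ₚ X^ (1 ℕ.+ d ℕ.* N))))
    (i : ℕ) (i<N : i < N)
    (I∣ : I divides ((1ₚ -ₚ X^ (1 ℕ.+ d ℕ.* N)) *ₚ (1ₚ -ₚ X^ (d ℕ.* (N ℕ.+ suc i))))) where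

    private
      ι-0-mod : ∀ {p r} → I divides (p *ₚ r) → ι p * ι r ∼ 0#
      ι-0-mod {p} {r} (w , e) = ∼-trans (∼-sym (ι-* p r))
        (∼-trans (ι-mod (w , ≋-trans e (≋-sym (+ₚ-identityʳ (p *ₚ r))))) ι-0)

      1-y : 1# - y ∼ ι (1ₚ -ₚ X^ (1 ℕ.+ d ℕ.* N))
      1-y = ∼-sym (∼-trans (ι-1-X^ (1 ℕ.+ d ℕ.* N)) (1-cong (∼-trans (ι-X^-+ 1 (d ℕ.* N)) (*-congˡ (ι-X^ d N)))))

      1-Q^ : 1# - Q ^ N * (Q * Q ^ i) ∼ ι (1ₚ -ₚ X^ (d ℕ.* (N ℕ.+ suc i)))
      1-Q^ = ∼-sym (∼-trans (ι-1-X^ _) (1-cong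
        (∼-trans (∼-reflexive (cong (λ k → ι (X^ k)) (ℕ.*-distribˡ-+ d N (suc i))))
        (∼-trans (ι-X^-+ (d ℕ.* N) (d ℕ.* suc i)) (*-cong (ι-X^ d N) (ι-X^ d (suc i)))))))

    block-vanishes : ∀ {h C} → m ∣ h → I divides (X^ h -ₚ 1ₚ) →
      (poch 1 d h , poch d d h) ⇝ C → sumf h (term d) ⇝ 0# → sumf (m ℕ.+ h) (term d) ⇝ 0#
    block-vanishes {C = C} m∣h I∣X^h-1 hC h0 = ⇝-cong (∼-trans (+-identityˡ _)
      (block-sum taa (λ k k<N → inv-correct k (ℕ.>⇒∤ (ℕ.≤-<-trans k<N N<m))) 1≤N
        (∼-trans (*-cong 1-y 1-y) (ι-0-mod I∣[1-y]²)) i i<N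
        (∼-trans (*-cong 1-y 1-Q^) (ι-0-mod I∣)) _ m N<m))
      (sum-value m∣h I∣X^h-1 hC h0 m ℕ.≤-refl)

-- Divisibility of the reduced numerator at each cyclotomic factor

Unit₀-poch : ∀ a {b} → 1 ≤ a → ∀ k → Unit₀ (poch a b k)
Unit₀-poch a       1≤a     zero    = Unit₀-1
Unit₀-poch (suc a) (s≤s _) (suc k) = Unit₀-* (Unit₀-poch (suc a) (s≤s z≤n) k) (1ℤ , ≡.refl)

Unit₀-^ : ∀ {p} → Unit₀ p → ∀ k → Unit₀ (p ^ₚ k)
Unit₀-^ u zero    = Unit₀-1
Unit₀-^ u (suc k) = Unit₀-* u (Unit₀-^ u k)

Unit₀-sumf : ∀ {f} → (∀ k → Unit₀ (proj₂ (f k))) → ∀ n → Unit₀ (proj₂ (sumf n f))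
Unit₀-sumf u zero    = Unit₀-1
Unit₀-sumf u (suc n) = Unit₀-* (Unit₀-sumf u n) (u n)

-- (1 - X^km) / (1 - X^m) takes the value k wherever X^m = 1.
X^-quotient : ∀ {I m} → I divides (X^ m -ₚ 1ₚ) → ∀ k →
  ∃ λ s → I divides (s -ₚ const (+ k)) × (s *ₚ (1ₚ -ₚ X^ m)) ≋ (1ₚ -ₚ X^ (k ℕ.* m))
X^-quotient         I∣ zero    = 0ₚ , (0ₚ , ≋-sym 0∷[]≋0) , ≋-sym (-ₚ-inverseʳ 1ₚ)
X^-quotient {I} {m} I∣ (suc k) = from (X^-quotient I∣ k)
  where
  from : (∃ λ s → I divides (s -ₚ const (+ k)) × (s *ₚ (1ₚ -ₚ X^ m)) ≋ (1ₚ -ₚ X^ (k ℕ.* m))) → _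
  from (s , d , e) = 1ₚ +ₚ X^ m *ₚ s
    , divides-resp (solve 3 (λ s x c → (s :- c) :+ s :* (x :- con 1ℤ) := con 1ℤ :+ x :* s :- (con 1ℤ :+ c))
        ≋-refl s (X^ m) (const (+ k))) (divides-+ d (divides-*ˡ s I∣))
    , (begin
      (1ₚ +ₚ X^ m *ₚ s) *ₚ (1ₚ -ₚ X^ m)
        ≈⟨ solve 2 (λ s x → (con 1ℤ :+ x :* s) :* (con 1ℤ :- x) := con 1ℤ :- x :+ x :* (s :* (con 1ℤ :- x))) ≋-refl s (X^ m) ⟩
      (1ₚ -ₚ X^ m) +ₚ X^ m *ₚ (s *ₚ (1ₚ -ₚ X^ m))
        ≈⟨ +ₚ-cong (≋-refl {1ₚ -ₚ X^ m}) (*ₚ-congˡ (X^ m) e) ⟩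
      (1ₚ -ₚ X^ m) +ₚ X^ m *ₚ (1ₚ -ₚ X^ (k ℕ.* m))
        ≈⟨ solve 2 (λ x y → con 1ℤ :- x :+ x :* (con 1ℤ :- y) := con 1ℤ :- x :* y) ≋-refl (X^ m) (X^ (k ℕ.* m)) ⟩
      1ₚ -ₚ X^ m *ₚ X^ (k ℕ.* m)
        ≈⟨ +ₚ-cong (≋-refl {1ₚ}) (negₚ-cong (≋-sym (X^-+ m (k ℕ.* m)))) ⟩
      1ₚ -ₚ X^ (m ℕ.+ k ℕ.* m) ∎)

divides-flip : ∀ {p} k → p divides (X^ k -ₚ 1ₚ) → p divides (1ₚ -ₚ X^ k)
divides-flip k = divides-resp (solve 1 (λ x → :- (x :- con 1ℤ) := con 1ℤ :- x) ≋-refl (X^ k)) ∘ divides-neg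

Cop-const : ∀ {p k} → k ≢ 0ℤ → Cop p (const k)
Cop-const {k = k} k≢0 = cop {u = 0ₚ} {1ₚ} k≢0 (*ₚ-identityˡ (const k))

module NatSolver = +-*-Solver
open NatSolver using () renaming (_:+_ to _⊞_; _:*_ to _⊛_; _:=_ to _⊜_)

module Congruence (Φ : ℕ → Poly) (isCyclotomic : IsCyclotomicFamily Φ)
  (d n e : ℕ) (2<d : 2 < d) (1+n≡ed : suc n ≡ e ℕ.* d) (1≤n : 1 ≤ n) where
  open Cyclotomic Φ isCyclotomic

  DividesReduced : Poly → Set
  DividesReduced I = ∀ a₀ b₀ g → (a₀ *ₚ g) ≋ proj₁ (sumf n (term d)) →
    (b₀ *ₚ g) ≋ proj₂ (sumf n (term d)) → I divides a₀

  Unit₀-den : Unit₀ (proj₂ (sumf n (term d)))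
  Unit₀-den = Unit₀-sumf (λ k → Unit₀-^ (Unit₀-poch d (ℕ.≤-trans (s≤s z≤n) 2<d) k) 4) n

  module Place {I : Poly} {m′ : ℕ} (uI : Unit₀ I) (1≤m′ : 1 ≤ m′) (m∣n : suc m′ ∣ n)
    (S⇒Cop : ∀ {s} → Cop (Φ (suc m′)) s → Cop I s) (𝒦 : Specialisation I (Cop (Φ (suc m′)))) where
    open Specialisation 𝒦
    open CommutativeRing K using (0#)

    vanishing : sumf n (term d) ⇝ 0# → DividesReduced I
    vanishing h a₀ b₀ g a≋ b≋ = from (⇝-0 h)
      where
      from : (∃₂ λ s t → Cop (Φ (suc m′)) s × (proj₁ (sumf n (term d)) *ₚ s) ≋ (t *ₚ proj₂ (sumf n (term d))) × I divides t) → _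
      from (s , t , hs , f , I∣t) = vanishing-numerator {a₀ = a₀} {b₀} {g} Unit₀-den a≋ b≋ uI (S⇒Cop hs) f I∣t

    -- e is an inverse of d modulo m, because e d = n + 1 and m divides n.
    m⊥d : ∀ {k} → suc m′ ∣ d ℕ.* k → suc m′ ∣ k
    m⊥d {k} m∣dk = ℕ.∣m+n∣m⇒∣n (≡.subst (suc m′ ∣_) edk (ℕ.∣n⇒∣m*n e m∣dk)) (ℕ.∣m⇒∣m*n k m∣n)
      where
      edk : e ℕ.* (d ℕ.* k) ≡ n ℕ.* k ℕ.+ k
      edk = ≡.trans (≡.sym (ℕ.*-assoc e d k)) (≡.trans (cong (ℕ._* k) (≡.sym 1+n≡ed)) (ℕ.+-comm k (n ℕ.* k)))

    S-X^ : ∀ {k} → ¬ suc m′ ∣ k → Cop (Φ (suc m′)) (1ₚ -ₚ X^ k)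
    S-X^ {k} m∤k = Cop-divisor (Cop-Φ-X^-1 (s≤s z≤n) m∤k)
      (divides-resp (solve 1 (λ x → :- (con 1ℤ :- x) := x :- con 1ℤ) ≋-refl (X^ k)) (divides-neg divides-refl))

    module At (N : ℕ) (N<m : N < suc m′) (m∣1+dN : suc m′ ∣ 1 ℕ.+ d ℕ.* N) where
      open Evaluation 𝒦 Cop-1 Cop-* d m′ N (ℕ.<⇒≤ 2<d) 1≤m′ N<m m∣1+dN m⊥d S-X^ public
        using (I∣X^0-1; ⇝-ι; ⇝-cong; poch-block; block-vanishes; 1≤N)

      poch-start : (poch 1 d 0 , poch d d 0) ⇝ ι 1ₚ
      poch-start = ⇝-ι 1ₚ

      sum-start : sumf 0 (term d) ⇝ 0#
      sum-start = ⇝-cong ι-0 (⇝-ι 0ₚ)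

  Φ∣1-X^ : ∀ {m k} → 1 ≤ m → m ∣ k → Φ m divides (1ₚ -ₚ X^ k)
  Φ∣1-X^ {m} {k} 1≤m m∣k = divides-flip k (divides-trans (Φ-divides 1≤m 1≤m ℕ.∣-refl) (X^-1-divides m∣k))

  module _ {m′ : ℕ} (1≤m′ : 1 ≤ m′) (m∣n : suc m′ ∣ n) where
    private
      m = suc m′
      -- Modulo m, m′ is -1 and e is the inverse of d, so d N is -1.
      N = (m′ ℕ.* e) ℕ.% m

      m∣1+dN : m ∣ 1 ℕ.+ d ℕ.* N
      m∣1+dN = ℕ.∣m+n∣m⇒∣n (≡.subst (m ∣_) identity (ℕ.∣m∣n⇒∣m+n (ℕ.∣n⇒∣m*n m′ m∣n) ℕ.∣-refl))
        (ℕ.∣n⇒∣m*n (d ℕ.* q) ℕ.∣-refl)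
        where
        q = (m′ ℕ.* e) ℕ./ m
        identity : m′ ℕ.* n ℕ.+ m ≡ d ℕ.* q ℕ.* m ℕ.+ (1 ℕ.+ d ℕ.* N)
        identity = E.begin
          m′ ℕ.* n ℕ.+ suc m′
            E.≡⟨ NatSolver.solve 2 (λ m n → m ⊛ n ⊞ (NatSolver.con 1 ⊞ m) ⊜ NatSolver.con 1 ⊞ m ⊛ (NatSolver.con 1 ⊞ n)) ≡.refl m′ n ⟩
          1 ℕ.+ m′ ℕ.* suc n
            E.≡⟨ cong (λ k → 1 ℕ.+ m′ ℕ.* k) 1+n≡ed ⟩
          1 ℕ.+ m′ ℕ.* (e ℕ.* d)
            E.≡⟨ cong suc (≡.sym (ℕ.*-assoc m′ e d)) ⟩
          1 ℕ.+ m′ ℕ.* e ℕ.* d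
            E.≡⟨ cong (λ k → 1 ℕ.+ k ℕ.* d) (ℕ.m≡m%n+[m/n]*n (m′ ℕ.* e) m) ⟩
          1 ℕ.+ (N ℕ.+ q ℕ.* m) ℕ.* d
            E.≡⟨ NatSolver.solve 4 (λ N q m d → NatSolver.con 1 ⊞ (N ⊞ q ⊛ m) ⊛ d ⊜ d ⊛ q ⊛ m ⊞ (NatSolver.con 1 ⊞ d ⊛ N)) ≡.refl N q m d ⟩
          d ℕ.* q ℕ.* m ℕ.+ (1 ℕ.+ d ℕ.* N) E.∎
          where module E = ≡.≡-Reasoning

      from-place : Specialisation (Φ m) (Cop (Φ m)) → DividesReduced (Φ m)
      from-place 𝒦 = vanishing (whole m∣n)
        where
        open Specialisation 𝒦
        open CommutativeRing K using (0#)
        open Place {m′ = m′} (Unit₀-Φ (s≤s z≤n)) 1≤m′ m∣n (λ h → h) 𝒦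
        open At N (ℕ.m%n<n (m′ ℕ.* e) m) m∣1+dN
        Φ∣1-y : Φ m divides (1ₚ -ₚ X^ (1 ℕ.+ d ℕ.* N))
        Φ∣1-y = Φ∣1-X^ (s≤s z≤n) m∣1+dN
        Φ∣X^m-1 : Φ m divides (X^ m -ₚ 1ₚ)
        Φ∣X^m-1 = Φ-divides (s≤s z≤n) (s≤s z≤n) ℕ.∣-refl
        -- The quotient is congruent to the nonzero constant k modulo Φ_m, hence prime to Φ_m over
        -- ℚ.
        S-quotient : ∀ k → 1 ≤ k → ∃ λ s → Cop (Φ m) s × (s *ₚ (1ₚ -ₚ X^ m)) ≋ (1ₚ -ₚ X^ (k ℕ.* m))
        S-quotient k 1≤k = from (X^-quotient Φ∣X^m-1 k)
          where
          from : (∃ λ s → Φ m divides (s -ₚ const (+ k)) × (s *ₚ (1ₚ -ₚ X^ m)) ≋ (1ₚ -ₚ X^ (k ℕ.* m))) → _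
          from (s , Φ∣ , f) = s , Cop-resp (solve 2 (λ c s → c :+ (s :- c) := s) ≋-refl (const (+ k)) s)
            (Cop-+-multiple (Cop-const (λ h → ℕ.<⇒≢ 1≤k (≡.sym (ℤ.+-injective h)))) Φ∣) , f
        -- The value C has to be carried along with the sum, since the next block is a multiple of
        -- C⁴.
        blocks : ∀ j → (∃ λ C → (poch 1 d (j ℕ.* m) , poch d d (j ℕ.* m)) ⇝ C) × sumf (j ℕ.* m) (term d) ⇝ 0#
        blocks zero    = (_ , poch-start) , sum-start
        blocks (suc j) = step (blocks j)
          where
          m∣jm : m ∣ j ℕ.* m
          m∣jm = ℕ.∣n⇒∣m*n j ℕ.∣-refl
          X^jm≡1 : Φ m divides (X^ (j ℕ.* m) -ₚ 1ₚ)
          X^jm≡1 = divides-trans Φ∣X^m-1 (X^-1-multiple m j)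
          step : (∃ λ C → (poch 1 d (j ℕ.* m) , poch d d (j ℕ.* m)) ⇝ C) × sumf (j ℕ.* m) (term d) ⇝ 0# → _
          step ((C , hC) , h0) = poch-block m∣jm X^jm≡1 S-quotient hC
            -- Modulo Φ_m the factor 1 - y is itself zero, so the index of the second factor may be
            -- any number below N.
            , block-vanishes (divides-*ʳ (1ₚ -ₚ X^ (1 ℕ.+ d ℕ.* N)) Φ∣1-y) 0 1≤N
              (divides-*ʳ (1ₚ -ₚ X^ (d ℕ.* (N ℕ.+ 1))) Φ∣1-y) m∣jm X^jm≡1 hC h0
        whole : m ∣ n → sumf n (term d) ⇝ 0#
        whole (ℕ.divides j n≡jm) = ≡.subst (λ k → sumf k (term d) ⇝ 0#) (≡.sym n≡jm) (proj₂ (blocks j))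

    Φ-divides-reduced : DividesReduced (Φ m)
    Φ-divides-reduced = from-place (specialisation (Unit₀-Φ (s≤s z≤n)) Cop-1 Cop-* (λ h → h))

  module _ {m′ : ℕ} (1≤m′ : 1 ≤ m′) (n≡m : n ≡ suc m′) where
    private
      m = suc m′
      N = m ℕ.∸ e

      1≤e : 1 ≤ e
      1≤e = ℕ.n≢0⇒n>0 λ { ≡.refl → ℕ.1+n≢0 1+n≡ed }

      -- From d ≥ 3 follows 3e ≤ ed = m + 1, and e ≥ 1. The inequality e ≤ N that results puts the
      -- index e - 1 in the range of the product of the 1 - uQ^(i+1), i < N.
      e+e≤m : e ℕ.+ e ≤ m
      e+e≤m = ℕ.s≤s⁻¹ (ℕ.≤-trans (ℕ.+-monoˡ-≤ (e ℕ.+ e) 1≤e) (ℕ.≤-trans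
        (ℕ.≤-reflexive (NatSolver.solve 1 (λ e → e ⊞ (e ⊞ e) ⊜ e ⊛ NatSolver.con 3) ≡.refl e))
        (ℕ.≤-trans (ℕ.*-monoʳ-≤ e 2<d) (ℕ.≤-reflexive (≡.trans (≡.sym 1+n≡ed) (cong suc n≡m))))))

      e≤N : e ≤ N
      e≤N = ℕ.m+n≤o⇒m≤o∸n e e+e≤m

      N+e : N ℕ.+ e ≡ m
      N+e = ℕ.m∸n+n≡m (ℕ.≤-trans (ℕ.m≤m+n e e) e+e≤m)

      N<m : N < m
      N<m = ℕ.≤-trans (ℕ.≤-reflexive (ℕ.+-comm 1 N)) (ℕ.≤-trans (ℕ.+-monoʳ-≤ N 1≤e) (ℕ.≤-reflexive N+e))

      m∣1+dN : m ∣ 1 ℕ.+ d ℕ.* N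
      m∣1+dN = ℕ.∣m+n∣m⇒∣n (≡.subst (m ∣_) identity (ℕ.∣n⇒∣m*n d ℕ.∣-refl)) ℕ.∣-refl
        where
        identity : d ℕ.* m ≡ m ℕ.+ (1 ℕ.+ d ℕ.* N)
        identity = E.begin
          d ℕ.* m                     E.≡⟨ cong (d ℕ.*_) (≡.sym N+e) ⟩
          d ℕ.* (N ℕ.+ e)             E.≡⟨ NatSolver.solve 3 (λ d N e → d ⊛ (N ⊞ e) ⊜ e ⊛ d ⊞ d ⊛ N) ≡.refl d N e ⟩
          e ℕ.* d ℕ.+ d ℕ.* N         E.≡⟨ cong (ℕ._+ d ℕ.* N) (≡.trans (≡.sym 1+n≡ed) (cong suc n≡m)) ⟩
          suc m ℕ.+ d ℕ.* N           E.≡⟨ NatSolver.solve 2 (λ m x → NatSolver.con 1 ⊞ m ⊞ x ⊜ m ⊞ (NatSolver.con 1 ⊞ x)) ≡.refl m (d ℕ.* N) ⟩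
          m ℕ.+ (1 ℕ.+ d ℕ.* N)       E.∎
          where module E = ≡.≡-Reasoning

      Φ² = Φ m *ₚ Φ m

      Cop-Φ² : ∀ {s} → Cop (Φ m) s → Cop Φ² s
      Cop-Φ² h = Cop-sym (Cop-* (Cop-sym h) (Cop-sym h))

      m∣n : m ∣ n
      m∣n = ℕ.∣-reflexive (≡.sym n≡m)

      from-place : Specialisation Φ² (Cop (Φ m)) → DividesReduced Φ²
      from-place 𝒦 = vanishing (≡.subst (λ k → sumf k (term d) ⇝ 0#) (≡.trans (ℕ.+-identityʳ m) (≡.sym n≡m))
          -- The factor of index e - 1 has exponent d(N + e) = dm, so it contributes the second Φ_m
          -- beside that of 1 - y. Since n = m, the whole sum is the single block with offset 0.
          (block-vanishes (divides-* Φ∣1-y Φ∣1-y) (ℕ.pred e) pred-e<N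
            (divides-* Φ∣1-y (Φ∣1-X^ (s≤s z≤n) (ℕ.∣n⇒∣m*n d (ℕ.∣-reflexive (≡.sym N+1+pred-e)))))
            (m ℕ.∣0) I∣X^0-1 poch-start sum-start))
        where
        open Specialisation 𝒦
        open CommutativeRing K using (0#)
        open Place {m′ = m′} (Unit₀-* (Unit₀-Φ (s≤s z≤n)) (Unit₀-Φ (s≤s z≤n))) 1≤m′ m∣n Cop-Φ² 𝒦
        open At N N<m m∣1+dN
        Φ∣1-y : Φ m divides (1ₚ -ₚ X^ (1 ℕ.+ d ℕ.* N))
        Φ∣1-y = Φ∣1-X^ (s≤s z≤n) m∣1+dN
        1+pred-e : suc (ℕ.pred e) ≡ e
        1+pred-e = ℕ.suc-pred e ⦃ ℕ.>-nonZero 1≤e ⦄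
        pred-e<N : ℕ.pred e < N
        pred-e<N = ℕ.≤-trans (ℕ.≤-reflexive 1+pred-e) e≤N
        N+1+pred-e : N ℕ.+ suc (ℕ.pred e) ≡ m
        N+1+pred-e = ≡.trans (cong (N ℕ.+_) 1+pred-e) N+e

    Φ²-divides-reduced : DividesReduced Φ²
    Φ²-divides-reduced = from-place (specialisation
      (Unit₀-* (Unit₀-Φ (s≤s z≤n)) (Unit₀-Φ (s≤s z≤n))) Cop-1 Cop-* Cop-Φ²)

theorem2p4 : (Φ : ℕ → Poly) → IsCyclotomicFamily Φ →
    (d n : ℕ) → 2 < d → 1 ≤ n → d ∣ suc n →
    sumf n (term d) ≡0mod (qint n *ₚ Φ n)
-- The case n = 1 is impossible, since d > 2 would divide 2.
theorem2p4 Φ isCyclotomic d 1 2<d 1≤n d∣2 = ⊥-elim (ℕ.<⇒≱ 2<d (ℕ.∣⇒≤ d∣2))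
theorem2p4 Φ isCyclotomic d n@(suc (suc n′)) 2<d 1≤n (ℕ.divides e 1+n≡ed) =
  ≡0mod-reduced Unit₀-den λ a₀ b₀ g a≋ b≋ → [n]Φₙ-divides (s≤s (s≤s z≤n))
    (Φ²-divides-reduced (s≤s z≤n) ≡.refl a₀ b₀ g a≋ b≋)
    (λ { (suc m′) (s≤s 1≤m′) m<n m∣n → Φ-divides-reduced 1≤m′ m∣n a₀ b₀ g a≋ b≋ })
  where
  open CyclotomicProduct Φ isCyclotomic
  open Congruence Φ isCyclotomic d n e 2<d 1+n≡ed 1≤n
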